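{- Let $(K,v)$ be a Henselian valued field and let $\theta\in\overline{K}$, of degree $n>1$ over $K$, be tame over $K$, with minimal polynomial $F$. Let $[\alpha_0,\dots,\alpha_{r-1},\alpha_r=\theta]$ be an Okutsu sequence of $\theta$ with $\alpha_0,\dots,\alpha_{r-1}$ separable over $K$, and put $\delta_i=v(\theta-\alpha_i)$ for $0\le i<r$. Let $$v\xrightarrow{\phi_0,\gamma_0}\mu_0\xrightarrow{\phi_1,\gamma_1}\mu_1\to\cdots\xrightarrow{\phi_{r-1},\gamma_{r-1}}\mu_{r-1}\xrightarrow{F,\infty}\mu_r=v_F$$ be a Mac Lane–Vaquié chain of $v_F$, and let $\lambda_0=\gamma_0$, $\lambda_i=\gamma_i-\mu_{i-1}(\phi_i)$ for $0<i<r$ be its secondary slopes. Then $\delta_i=\lambda_0+\cdots+\lambda_i$ for all $0\le i<r$.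
   Context: $(K,v)$ is a Henselian valued field of arbitrary rank; $v$ also denotes its unique extension to a fixed algebraic closure $\overline{K}$; $\Gamma=v(\overline{K}^*)$; $\deg_K\alpha=[K(\alpha):K]$. Tameness: for a finite simple extension $L/K$ the defect $d(L/K)$ is defined by $[L:K]=e(L/K)f(L/K)d(L/K)$; $L/K$ is defectless if $d(L/K)=1$. A separable and defectless $L/K$ is tame if $Lv/Kv$ is separable and $e(L/K)$ is not divisible by $\operatorname{char}(Kv)$. An element $\alpha$ is separable, defectless, tame if $K(\alpha)/K$ is. Okutsu sequence of a defectless $\theta$: a list $[\alpha_0,\dots,\alpha_{r-1},\alpha_r=\theta]$ in $\overline{K}$ with $m_i=\deg_K\alpha_i$, $1=m_0<m_1<\cdots<m_r=n$, such that for all $0\le i<r$ and $\beta\in\overline{K}$: $\deg_K\beta<m_{i+1}\Rightarrow v(\theta-\beta)\le v(\theta-\alpha_i)$; and $\deg_K\beta<m_i\Rightarrow v(\theta-\beta)<v(\theta-\alpha_i)$. Valuations: $v_F:K[x]\to\Gamma\cup\{\infty\}$, $v_F(g)=v(g(\theta))$. All valuations $\mu:K[x]\to\Gamma\cup\{\infty\}$ considered extend $v$ (and may take the value $\infty$ on a nonzero prime ideal); $\mu\le\nu$ means $\mu(f)\le\nu(f)$ for all $f$. The graded algebra of $\mu$ is $\mathcal{G}_\mu=\bigoplus_{\alpha}\{f:\mu(f)\ge\alpha\}/\{f:\mu(f)>\alpha\}$ ($\alpha$ in the value group of $\mu$), and $\operatorname{in}_\mu f$ is the image of $f$ in degree $\mu(f)$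 when $\mu(f)<\infty$ (and $0$ otherwise). A monic $\phi\in K[x]$ is $\mu$-minimal if the ideal $I(\phi)=(\operatorname{in}_\mu\phi)\mathcal{G}_\mu$ contains no $\operatorname{in}_\mu f$ with $f\ne0$, $\deg f<\deg\phi$; $\phi$ is a key polynomial for $\mu$ if it is $\mu$-minimal and $I(\phi)$ is a prime ideal (nonzero). If key polynomials for $\mu$ exist, $\deg(\mu)$ is their minimal degree. Augmentations: (Initial) $v\xrightarrow{\phi_0,\gamma_0}\mu_0$ with $\phi_0$ monic of degree one, $\gamma_0\in\Gamma$, $\mu_0(\sum a_n\phi_0^n)=\min_n\{v(a_n)+n\gamma_0\}$ ($a_n\in K$). (Ordinary) for $\phi$ a key polynomial of $\mu$ and $\gamma>\mu(\phi)$ in $\Gamma\cup\{\infty\}$, $[\mu;\phi,\gamma](\sum a_n\phi^n)=\min_n\{\mu(a_n)+n\gamma\}$ where $\deg a_n<\deg\phi$. (Limit) let $\mathcal{A}=(\rho_j)_{j\in I}$ be a family of valuations indexed by an infinite well-ordered set, with $\rho_i<\rho_j$ for $i<j$, all of the same degree; a polynomial $g$ is $\mathcal{A}$-unstable if $\rho_i(g)<\rho_j(g)$ for all $i<j$; a limit key polynomial for $\mathcal{A}$ is a monic $\mathcal{A}$-unstable polynomial of minimal degree; $\mathcal{A}$ is a continuous family if limit key polynomials exist. Polynomials $a$ of smaller degree have a stable value $\rho_{\mathcal{A}}(a)$ (the eventually constant value of $\rho_i(a)$). For a limit key polynomial $\phi$ and $\gamma\in\Gamma\cup\{\infty\}$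 with $\gamma>\rho_i(\phi)$ for all $i$, $[\mathcal{A};\phi,\gamma](\sum a_n\phi^n)=\min_n\{\rho_{\mathcal{A}}(a_n)+n\gamma\}$, $\deg a_n<\deg\phi$. A Mac Lane–Vaquié (MLV) chain of $v_F$ is a chain $v\xrightarrow{\phi_0,\gamma_0}\mu_0\xrightarrow{\phi_1,\gamma_1}\mu_1\to\cdots\xrightarrow{\phi_{r-1},\gamma_{r-1}}\mu_{r-1}\xrightarrow{F,\infty}\mu_r=v_F$ whose initial step $v\xrightarrow{\phi_0,\gamma_0}\mu_0$ is given by a monic $\phi_0$ of degree one and $\gamma_0\in\Gamma$ through $\mu_0(\sum a_n\phi_0^n)=\min_n\{v(a_n)+n\gamma_0\}$ ($a_n\in K$) and, for $0<i\le r$ (with $\phi_r=F,\gamma_r=\infty$), either $\mu_i=[\mu_{i-1};\phi_i,\gamma_i]$ ordinary, or $\mu_i=[\mathcal{A}_{i-1};\phi_i,\gamma_i]$ limit for a continuous family $\mathcal{A}_{i-1}$ whose first valuation is $\mu_{i-1}$, such that the degrees satisfy $1=\deg\phi_0<\deg\phi_1<\cdots<\deg\phi_r=n$ and $v_F(\phi_i)=\gamma_i$ for $0\le i<r$. All MLV chains of $v_F$ have the same length, which equals the length $r$ of every Okutsu sequence of $\theta$. -}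

module Defs where

open import Level using (Level) renaming (suc to lsuc)
open import Algebra.Apartness.Bundles using (HeytingField; HeytingCommutativeRing)
open import Algebra.Bundles using (RawMonoid; RawSemiring; RawRing; CommutativeRing; AbelianGroup)
open import Algebra.Core using (Op₁; Op₂)
import Algebra.Construct.NaturalChoice.Min as Min
import Algebra.Definitions.RawMonoid as RawMonoidDefinitions
import Algebra.Morphism.RingMonomorphism as RingMonomorphism
open import Algebra.Morphism.Structures using (IsRingHomomorphism; IsRingMonomorphism)
import Algebra.Properties.Ring as RingProperties
open import Algebra.Structures using (IsAbelianGroup)
open import Data.Bool.Base using (if_then_else_)
open import Data.Fin.Base using (Fin; zero; suc; fromℕ; inject₁)
open import Data.List.Base using (List; []; _∷_; map; foldr; _++_)
open import Data.List.Relation.Unary.All using (All)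
open import Data.Maybe.Base using (just; nothing)
open import Data.Nat.Base as ℕ using (ℕ; zero; suc)
open import Data.Nat.Divisibility using (_∣_)
open import Data.Product.Base using (Σ; ∃; ∃₂; _×_; _,_; proj₁; proj₂)
open import Data.Sum.Base using (_⊎_; inj₁; inj₂)
open import Function.Base using (id; _∘_)
open import Function.Bundles using (_⇔_)
open import Induction.WellFounded using (WellFounded)
open import Relation.Binary.Bundles using (DecTotalOrder; StrictTotalOrder)
import Relation.Binary.Construct.Add.Supremum.Equality as Equality⁺
import Relation.Binary.Construct.Add.Supremum.NonStrict as NonStrict⁺
import Relation.Binary.Construct.Add.Supremum.Strict as Strict⁺
import Relation.Binary.Construct.NonStrictToStrict as NonStrictToStrict
open import Relation.Binary.Core using (Rel)
open import Relation.Binary.PropositionalEquality.Core using (_≡_)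
open import Relation.Binary.Structures using (IsDecTotalOrder)
open import Relation.Nullary.Construct.Add.Supremum using (_⁺; ⊤⁺)
open import Relation.Nullary.Decidable.Core using (does)
open import Relation.Nullary.Negation.Core using (¬_)
open import Relation.Unary using (Pred)

private
  variable
    u : Level

record OrderedAbelianGroup (u : Level) : Set (lsuc u) where
  infix  8 -_
  infixl 6 _+_
  infix  4 _≈_ _≤_
  field
    Carrier         : Set u
    _≈_             : Rel Carrier u
    _≤_             : Rel Carrier u
    _+_             : Op₂ Carrier
    0#              : Carrier
    -_              : Op₁ Carrier
    isAbelianGroup  : IsAbelianGroup _≈_ _+_ 0# -_
    isDecTotalOrder : IsDecTotalOrder _≈_ _≤_
    +-monoˡ-≤       : ∀ z {x y} → x ≤ y → (x + z) ≤ (y + z)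

  abelianGroup : AbelianGroup u u
  abelianGroup = record { isAbelianGroup = isAbelianGroup }

  open AbelianGroup abelianGroup public
    using (rawMonoid; identityˡ; comm)

  infixl 6 _-_

  _-_ : Op₂ Carrier
  x - y = x + (- y)

  open IsDecTotalOrder isDecTotalOrder public

module Extended (Γ : OrderedAbelianGroup u) where

  open OrderedAbelianGroup Γ

  open NonStrictToStrict _≈_ _≤_ public using (_<_)
  open Equality⁺ _≈_ public using (_≈⁺_)
  open NonStrict⁺ _≤_ public using (_≤⁺_)
  open Strict⁺ _<_ public using (_<⁺_; <⁺-respˡ-≈⁺)

  Γ⁺ : Set u
  Γ⁺ = Carrier ⁺

  decTotalOrder⁺ : DecTotalOrder u u u
  decTotalOrder⁺ = record
    { isDecTotalOrder = NonStrict⁺.≤⁺-isDecTotalOrder _≤_ isDecTotalOrder }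

  module ⁺ = DecTotalOrder decTotalOrder⁺

  open Min ⁺.totalOrder public using (_⊓_)

  infixl 6 _+⁺_

  _+⁺_ : Op₂ Γ⁺
  just a  +⁺ just b  = just (a + b)
  just _  +⁺ nothing = ⊤⁺
  nothing +⁺ _       = ⊤⁺

  rawMonoid⁺ : RawMonoid u u
  rawMonoid⁺ = record { _≈_ = _≈⁺_ ; _∙_ = _+⁺_ ; ε = just 0# }

  open RawMonoidDefinitions rawMonoid⁺ public using () renaming (_×_ to _×⁺_)

  +-mono-≤ : ∀ {a b c d} → a ≤ b → c ≤ d → (a + c) ≤ (b + d)
  +-mono-≤ {a} {b} {c} {d} a≤b c≤d = trans (+-monoˡ-≤ c a≤b)
    (trans (reflexive (comm b c)) (trans (+-monoˡ-≤ b c≤d) (reflexive (comm d b))))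

  +⁺-mono-≤ : ∀ {a c x y} → just a ≤⁺ x → just c ≤⁺ y → just (a + c) ≤⁺ (x +⁺ y)
  +⁺-mono-≤ {x = just _}  {y = just _}  NonStrict⁺.[ p ] NonStrict⁺.[ q ] =
    NonStrict⁺.[ +-mono-≤ p q ]
  +⁺-mono-≤ {x = just _}  {y = nothing} _ _ = _ NonStrict⁺.≤⊤⁺
  +⁺-mono-≤ {x = nothing}               _ _ = _ NonStrict⁺.≤⊤⁺

  +⁺-nonneg : ∀ {x y} → just 0# ≤⁺ x → just 0# ≤⁺ y → just 0# ≤⁺ (x +⁺ y)
  +⁺-nonneg p q = ⁺.trans (⁺.reflexive Equality⁺.[ Eq.sym (identityˡ 0#) ]) (+⁺-mono-≤ p q)

  halve-nonneg : ∀ x → (x +⁺ x) ≈⁺ just 0# → just 0# ≤⁺ x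
  halve-nonneg nothing  ()
  halve-nonneg (just a) Equality⁺.[ 2a≈0 ] with total a 0#
  ... | inj₂ 0≤a = NonStrict⁺.[ 0≤a ]
  ... | inj₁ a≤0 = NonStrict⁺.[ trans (reflexive (Eq.sym 2a≈0))
                     (trans (+-monoˡ-≤ a a≤0) (reflexive (identityˡ a))) ]

  finite : ∀ {x y} → x <⁺ y → Carrier
  finite {just a}  _ = a
  finite {nothing} ()

-- A polynomial is the list of its coefficients, constant term first; trailing
-- zeros are allowed.
module Polynomials (R : RawRing u u) where

  open RawRing R
  open RawMonoidDefinitions +-rawMonoid using () renaming (_×_ to _·_)

  Poly : Set u
  Poly = List Carrier

  coeff : Poly → ℕ → Carrier
  coeff []      _       = 0#
  coeff (a ∷ _) zero    = a
  coeff (_ ∷ p) (suc n) = coeff p n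

  infix  8 -ᴾ_
  infixl 7 _*ᴾ_
  infixl 6 _+ᴾ_ _-ᴾ_
  infix  4 _≈ᴾ_

  _≈ᴾ_ : Rel Poly u
  p ≈ᴾ q = ∀ n → coeff p n ≈ coeff q n

  _+ᴾ_ : Op₂ Poly
  []      +ᴾ q       = q
  (a ∷ p) +ᴾ []      = a ∷ p
  (a ∷ p) +ᴾ (b ∷ q) = (a + b) ∷ (p +ᴾ q)

  -ᴾ_ : Op₁ Poly
  -ᴾ_ = map -_

  _-ᴾ_ : Op₂ Poly
  p -ᴾ q = p +ᴾ -ᴾ q

  _*ᴾ_ : Op₂ Poly
  []      *ᴾ q = []
  (a ∷ p) *ᴾ q = map (a *_) q +ᴾ (0# ∷ (p *ᴾ q))

  const : Carrier → Poly
  const a = a ∷ []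

  polynomialRing : RawRing u u
  polynomialRing = record
    { _≈_ = _≈ᴾ_ ; _+_ = _+ᴾ_ ; _*_ = _*ᴾ_ ; -_ = -ᴾ_ ; 0# = [] ; 1# = const 1# }

  -- [n a₀, (n + 1) a₁, …]
  weight : ℕ → Poly → Poly
  weight _ []      = []
  weight n (a ∷ p) = (n · a) ∷ weight (suc n) p

  derivative : Poly → Poly
  derivative []      = []
  derivative (_ ∷ p) = weight 1 p

  DegreeBelow : Poly → ℕ → Set u
  DegreeBelow p n = ∀ k → n ℕ.≤ k → coeff p k ≈ 0#

  Monic : Poly → ℕ → Set u
  Monic p d = (coeff p d ≈ 1#) × DegreeBelow p (suc d)

  SeparablePolynomial : Poly → Set u
  SeparablePolynomial p = ∃₂ λ a b → (a *ᴾ p +ᴾ b *ᴾ derivative p) ≈ᴾ const 1#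

  -- a₀ + a₁φ + a₂φ² + ⋯
  expansion : Poly → List Poly → Poly
  expansion φ []       = []
  expansion φ (a ∷ as) = a +ᴾ φ *ᴾ expansion φ as

module Extension (k l : RawRing u u) (ι : RawRing.Carrier k → RawRing.Carrier l) where

  private
    module k = RawRing k
    module l = RawRing l

  open Polynomials k
  open RawMonoidDefinitions l.+-rawMonoid using (sum)

  evaluate : Poly → l.Carrier → l.Carrier
  evaluate []      x = l.0#
  evaluate (a ∷ p) x = ι a l.+ x l.* evaluate p x

  record IsMinimalPolynomial (f : Poly) (x : l.Carrier) : Set u where
    field
      degree  : ℕ
      monic   : Monic f degree
      root    : evaluate f x l.≈ l.0#
      minimal : ∀ g → DegreeBelow g degree → evaluate g x l.≈ l.0# → g ≈ᴾ []

  IsAlgebraicExtension : Set u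
  IsAlgebraicExtension = ∀ x → ∃₂ λ f d → Monic f d × (evaluate f x l.≈ l.0#)

  IsSeparableExtension : Set u
  IsSeparableExtension = ∀ x → ∃ λ f → IsMinimalPolynomial f x × SeparablePolynomial f

  combination : ∀ {n} → (Fin n → k.Carrier) → (Fin n → l.Carrier) → l.Carrier
  combination c b = sum (λ i → ι (c i) l.* b i)

  record IsBasis {n} (b : Fin n → l.Carrier) : Set u where
    field
      independent : ∀ c → combination c b l.≈ l.0# → ∀ i → c i k.≈ k.0#
      spanning    : ∀ x → ∃ λ c → x l.≈ combination c b

  HasDegree : ℕ → Set u
  HasDegree n = Σ (Fin n → l.Carrier) IsBasis

HasCharacteristic : RawRing u u → ℕ → Set u
HasCharacteristic R p = ∀ n → ((n · 1#) ≈ 0#) ⇔ (p ∣ n)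
  where
  open RawRing R
  open RawMonoidDefinitions +-rawMonoid using () renaming (_×_ to _·_)

module Ideals (R : RawSemiring u u) where

  open RawSemiring R

  PrincipalIdeal : Carrier → Pred Carrier u
  PrincipalIdeal a x = ∃ λ y → x ≈ (a * y)

  record IsPrime (I : Pred Carrier u) : Set u where
    field
      proper : ¬ I 1#
      prime  : ∀ x y → I (x * y) → I x ⊎ I y

  IsNonzero : Pred Carrier u → Set u
  IsNonzero I = ∃ λ x → I x × x ≉ 0#

-- In the presence of excluded middle, Heyting fields are the fields of
-- classical algebra.
Field : (u : Level) → Set (lsuc u)
Field u = HeytingField u u u

ring : Field u → CommutativeRing u u
ring K = HeytingCommutativeRing.commutativeRing (HeytingField.heytingCommutativeRing K)

rawRing : Field u → RawRing u u
rawRing K = CommutativeRing.rawRing (ring K)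

record FieldHom (K L : Field u) : Set u where
  field
    ⟦_⟧    : HeytingField.Carrier K → HeytingField.Carrier L
    isHom  : IsRingHomomorphism (rawRing K) (rawRing L) ⟦_⟧

  open Extension (rawRing K) (rawRing L) ⟦_⟧ public

IsAlgebraicallyClosed : Field u → Set u
IsAlgebraicallyClosed L =
  ∀ f d → Monic f (suc d) → ∃ λ x → evaluate f x ≈ 0#
  where
  open HeytingField L using (_≈_; 0#)
  open Polynomials (rawRing L)
  open Extension (rawRing L) (rawRing L) id

module Valuations (Γ : OrderedAbelianGroup u) where

  open OrderedAbelianGroup Γ using (0#; _-_) renaming (Carrier to ∣Γ∣)
  open Extended Γ

  -- The support is a prime ideal; over a field it is therefore {0}.
  record Valuation (R : RawRing u u) : Set u where
    private module R = RawRing R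
    field
      val     : R.Carrier → Γ⁺
      cong    : ∀ {x y} → x R.≈ y → val x ≈⁺ val y
      zero-∞  : val R.0# ≈⁺ ⊤⁺
      one-0   : val R.1# ≈⁺ just 0#
      *-homo  : ∀ x y → val (x R.* y) ≈⁺ (val x +⁺ val y)
      +-min   : ∀ x y → (val x ⊓ val y) ≤⁺ val (x R.+ y)

  open Valuation using (val)

  comap : ∀ {R S : RawRing u u} {h} → IsRingHomomorphism R S h → Valuation S → Valuation R
  comap {h = h} hom w = record
    { val    = λ x → w.val (h x)
    ; cong   = λ p → w.cong (h.⟦⟧-cong p)
    ; zero-∞ = ⁺.Eq.trans (w.cong h.0#-homo) w.zero-∞
    ; one-0  = ⁺.Eq.trans (w.cong h.1#-homo) w.one-0
    ; *-homo = λ x y → ⁺.Eq.trans (w.cong (h.*-homo x y)) (w.*-homo (h x) (h y))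
    ; +-min  = λ x y → ⁺.trans (w.+-min (h x) (h y))
                 (⁺.reflexive (⁺.Eq.sym (w.cong (h.+-homo x y))))
    }
    where
    module h = IsRingHomomorphism hom
    module w = Valuation w

  -- For a field this is the value group, ∞ being left out.
  Values : ∀ {R} → Valuation R → Pred ∣Γ∣ u
  Values w γ = ∃ λ x → val w x ≈⁺ just γ

  -- (G : H) = e
  HasIndex : Pred ∣Γ∣ u → Pred ∣Γ∣ u → ℕ → Set u
  HasIndex G H e = Σ (Fin e → ∣Γ∣) λ t →
    (∀ i → G (t i)) ×
    (∀ γ → G γ → ∃ λ i → H (γ - t i)) ×
    (∀ i j → H (t i - t j) → i ≡ j)

  module _ (R : CommutativeRing u u) (w : Valuation (CommutativeRing.rawRing R)) where

    private
      module R where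
        open CommutativeRing R public
        open RingProperties (CommutativeRing.ring R) public
      module w = Valuation w

    ∣Integers∣ : Set u
    ∣Integers∣ = Σ R.Carrier λ x → just 0# ≤⁺ w.val x

    private
      +-closed : ∀ {x y} → just 0# ≤⁺ w.val x → just 0# ≤⁺ w.val y → just 0# ≤⁺ w.val (x R.+ y)
      +-closed {x} {y} p q = ⁺.trans (Min.⊓-glb ⁺.totalOrder p q) (w.+-min x y)

      *-closed : ∀ {x y} → just 0# ≤⁺ w.val x → just 0# ≤⁺ w.val y → just 0# ≤⁺ w.val (x R.* y)
      *-closed {x} {y} p q = ⁺.trans (+⁺-nonneg p q) (⁺.reflexive (⁺.Eq.sym (w.*-homo x y)))

      1-integral : just 0# ≤⁺ w.val R.1#
      1-integral = ⁺.reflexive (⁺.Eq.sym w.one-0)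

      0-integral : just 0# ≤⁺ w.val R.0#
      0-integral = ⁺.trans (_ NonStrict⁺.≤⊤⁺) (⁺.reflexive (⁺.Eq.sym w.zero-∞))

      -1-integral : just 0# ≤⁺ w.val (R.- R.1#)
      -1-integral = halve-nonneg (w.val (R.- R.1#)) (⁺.Eq.trans (⁺.Eq.sym (w.*-homo _ _))
        (⁺.Eq.trans (w.cong (R.trans (R.-1*x≈-x (R.- R.1#)) (R.-‿involutive R.1#))) w.one-0))

      -‿closed : ∀ {x} → just 0# ≤⁺ w.val x → just 0# ≤⁺ w.val (R.- x)
      -‿closed {x} p = ⁺.trans (*-closed -1-integral p) (⁺.reflexive (w.cong (R.-1*x≈-x x)))

    -- The quotient of {x : w x ≥ 0} by {x : w x > 0}.
    residueRing : RawRing u u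
    residueRing = record
      { Carrier = ∣Integers∣
      ; _≈_     = λ (x , _) (y , _) → just 0# <⁺ w.val (x R.- y)
      ; _+_     = λ (x , p) (y , q) → (x R.+ y) , +-closed p q
      ; _*_     = λ (x , p) (y , q) → (x R.* y) , *-closed p q
      ; -_      = λ (x , p) → (R.- x) , -‿closed p
      ; 0#      = R.0# , 0-integral
      ; 1#      = R.1# , 1-integral
      }

-- Γ is v(K̄*); the valuation of K is the restriction of that of K̄.
record ValuedField (u : Level) : Set (lsuc u) where
  field
    K K̄              : Field u
    embedding        : FieldHom K K̄
    algebraic        : FieldHom.IsAlgebraicExtension embedding
    algebraicClosed  : IsAlgebraicallyClosed K̄
    Γ                : OrderedAbelianGroup u

  open Valuations Γ public

  field
    valuation  : Valuation (rawRing K̄)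
    surjective : ∀ γ → Values valuation γ

  valuationᴷ : Valuation (rawRing K)
  valuationᴷ = comap (FieldHom.isHom embedding) valuation

  -- The extensions of v to an algebraic extension L of K take values, up to
  -- equivalence, in the divisible hull Γ of v(K*).  They always exist, so only
  -- their uniqueness is required.
  IsHenselian : Set (lsuc u)
  IsHenselian = ∀ (L : Field u) (h : FieldHom K L) → FieldHom.IsAlgebraicExtension h →
    ∀ (w w′ : Valuation (rawRing L)) → Extends h w → Extends h w′ →
    ∀ x → Valuation.val w x ≈⁺ Valuation.val w′ x
    where
    open Extended Γ using (_≈⁺_)
    Extends : ∀ {L} → FieldHom K L → Valuation (rawRing L) → Set u
    Extends h w = ∀ a → Valuation.val w (FieldHom.⟦_⟧ h a) ≈⁺ Valuation.val valuationᴷ a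

module Theory (𝕂 : ValuedField u) where

  open ValuedField 𝕂 using (K; K̄; embedding; Γ; valuation; valuationᴷ)

  module K = HeytingField K
  module K̄ = CommutativeRing (ring K̄)
  module Γ = OrderedAbelianGroup Γ

  open FieldHom embedding public using (evaluate; IsMinimalPolynomial)
  open FieldHom embedding using () renaming (⟦_⟧ to ι; isHom to ι-isHom)
  open Extended Γ public
  open Valuations Γ
  open Polynomials (rawRing K) public

  private
    module ι = IsRingHomomorphism ι-isHom

  v : K̄.Carrier → Γ⁺
  v = Valuation.val valuation

  vᴷ : K.Carrier → Γ⁺
  vᴷ = Valuation.val valuationᴷ

  -- The smallest subfield of K̄ containing K and α
  data Adjoin (α : K̄.Carrier) : Pred K̄.Carrier u where
    base : ∀ a → Adjoin α (ι a)
    gen  : Adjoin α α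
    add  : ∀ {x y} → Adjoin α x → Adjoin α y → Adjoin α (x K̄.+ y)
    mul  : ∀ {x y} → Adjoin α x → Adjoin α y → Adjoin α (x K̄.* y)
    neg  : ∀ {x} → Adjoin α x → Adjoin α (K̄.- x)
    inv  : ∀ {x y} → Adjoin α x → (x K̄.* y) K̄.≈ K̄.1# → Adjoin α y
    resp : ∀ {x y} → x K̄.≈ y → Adjoin α x → Adjoin α y

  module _ (α : K̄.Carrier) where

    rawK⟨_⟩ : RawRing u u
    rawK⟨_⟩ = record
      { Carrier = Σ K̄.Carrier (Adjoin α)
      ; _≈_     = λ (x , _) (y , _) → x K̄.≈ y
      ; _+_     = λ (x , p) (y , q) → (x K̄.+ y) , add p q
      ; _*_     = λ (x , p) (y , q) → (x K̄.* y) , mul p q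
      ; -_      = λ (x , p) → (K̄.- x) , neg p
      ; 0#      = K̄.0# , resp ι.0#-homo (base K.0#)
      ; 1#      = K̄.1# , resp ι.1#-homo (base K.1#)
      }

    proj₁-isMonomorphism : IsRingMonomorphism rawK⟨_⟩ K̄.rawRing proj₁
    proj₁-isMonomorphism = record
      { isRingHomomorphism = record
        { isSemiringHomomorphism = record
          { isNearSemiringHomomorphism = record
            { +-isMonoidHomomorphism = record
              { isMagmaHomomorphism = record
                { isRelHomomorphism = record { cong = id }
                ; homo = λ _ _ → K̄.refl }
              ; ε-homo = K̄.refl }
            ; *-homo = λ _ _ → K̄.refl }
          ; 1#-homo = K̄.refl }
        ; -‿homo = λ _ → K̄.refl }
      ; injective = id }

    K⟨_⟩ : CommutativeRing u u
    K⟨_⟩ = record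
      { isCommutativeRing =
          RingMonomorphism.isCommutativeRing proj₁-isMonomorphism K̄.isCommutativeRing }

    L : RawRing u u
    L = CommutativeRing.rawRing K⟨_⟩

    vᴸ : Valuation L
    vᴸ = comap (IsRingMonomorphism.isRingHomomorphism proj₁-isMonomorphism) valuation

    Kv Lv : RawRing u u
    Kv = residueRing (ring K) valuationᴷ
    Lv = residueRing K⟨_⟩ vᴸ

    module L/K   = Extension (rawRing K) L (λ a → ι a , base a)
    module Lv/Kv = Extension Kv Lv (λ (a , p) → (ι a , base a) , p)

    Degree : ℕ → Set u
    Degree = L/K.HasDegree

    RamificationIndex : ℕ → Set u
    RamificationIndex = HasIndex (Values vᴸ) (Values valuationᴷ)

    ResidueDegree : ℕ → Set u
    ResidueDegree = Lv/Kv.HasDegree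

    record Defect (d : ℕ) : Set u where
      field
        n e f             : ℕ
        degree            : Degree n
        ramificationIndex : RamificationIndex e
        residueDegree     : ResidueDegree f
        n≡efd             : n ≡ e ℕ.* f ℕ.* d

    IsDefectless : Set u
    IsDefectless = Defect 1

    IsSeparable : Set u
    IsSeparable = L/K.IsSeparableExtension

    -- If char(Kv) = 0 then e, being nonzero, is not divisible by it.
    record IsTame : Set u where
      field
        separable         : IsSeparable
        defectless        : IsDefectless
        residueSeparable  : Lv/Kv.IsSeparableExtension
        e                 : ℕ
        ramificationIndex : RamificationIndex e
        p                 : ℕ
        characteristic    : HasCharacteristic Kv p
        p∤e               : ¬ (p ∣ e)

  record OkutsuSequence (θ : K̄.Carrier) (n r : ℕ) : Set u where
    field
      α       : Fin (suc r) → K̄.Carrier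
      m       : Fin (suc r) → ℕ
      α-last  : α (fromℕ r) K̄.≈ θ
      degrees : ∀ i → Degree (α i) (m i)
      m-first : m zero ≡ 1
      m-mono  : ∀ (i : Fin r) → m (inject₁ i) ℕ.< m (suc i)
      m-last  : m (fromℕ r) ≡ n
      best    : ∀ (i : Fin r) β k → Degree β k → k ℕ.< m (suc i) →
                v (θ K̄.- β) ≤⁺ v (θ K̄.- α (inject₁ i))
      strict  : ∀ (i : Fin r) β k → Degree β k → k ℕ.< m (inject₁ i) →
                v (θ K̄.- β) <⁺ v (θ K̄.- α (inject₁ i))

  record Valuationˣ : Set u where
    field
      isValuation : Valuation polynomialRing
      extends     : ∀ a → Valuation.val isValuation (const a) ≈⁺ vᴷ a

    open Valuation isValuation public

  infix 9 _⟦_⟧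
  _⟦_⟧ : Valuationˣ → Poly → Γ⁺
  μ ⟦ f ⟧ = Valuationˣ.val μ f

  infix 4 _≤ⱽ_ _<ⱽ_ _≈ⱽ_

  _≤ⱽ_ _<ⱽ_ _≈ⱽ_ : Rel Valuationˣ u
  μ ≤ⱽ ν = ∀ f → μ ⟦ f ⟧ ≤⁺ ν ⟦ f ⟧
  μ ≈ⱽ ν = ∀ f → μ ⟦ f ⟧ ≈⁺ ν ⟦ f ⟧
  μ <ⱽ ν = (μ ≤ⱽ ν) × ¬ (μ ≈ⱽ ν)

  module _ (μ : Valuationˣ) where

    private module μ = Valuationˣ μ

    record Homogeneous : Set u where
      constructor homogeneous
      field
        degree         : Γ.Carrier
        representative : Poly
        bound          : just degree ≤⁺ μ ⟦ representative ⟧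

    open Homogeneous

    -- An element of the direct sum is a formal finite sum of homogeneous
    -- elements.  The degrees run over all of Γ: outside the value group of
    -- μ the homogeneous pieces are zero.
    ∣𝒢∣ : Set u
    ∣𝒢∣ = List Homogeneous

    component : Γ.Carrier → ∣𝒢∣ → Poly
    component δ = foldr
      (λ h f → if does (degree h Γ.≟ δ) then representative h +ᴾ f else f) []

    _·ᴳ_ : Op₂ Homogeneous
    homogeneous δ f p ·ᴳ homogeneous ε g q = homogeneous (δ Γ.+ ε) (f *ᴾ g)
      (⁺.trans (+⁺-mono-≤ p q) (⁺.reflexive (⁺.Eq.sym (μ.*-homo f g))))

    _*ᴳ_ : Op₂ ∣𝒢∣
    []      *ᴳ y = []
    (h ∷ x) *ᴳ y = map (h ·ᴳ_) y ++ (x *ᴳ y)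

    gradedAlgebra : RawSemiring u u
    gradedAlgebra = record
      { Carrier = ∣𝒢∣
      ; _≈_     = λ x y → ∀ δ → just δ <⁺ μ ⟦ component δ x -ᴾ component δ y ⟧
      ; _+_     = _++_
      ; _*_     = _*ᴳ_
      ; 0#      = []
      ; 1#      = homogeneous Γ.0# (const K.1#) (⁺.reflexive (⁺.Eq.sym μ.one-0)) ∷ []
      }

    open Ideals gradedAlgebra

    initialPart : ∀ f (x : Γ⁺) → x ≤⁺ μ ⟦ f ⟧ → ∣𝒢∣
    initialPart f (just δ) p = homogeneous δ f p ∷ []
    initialPart f nothing  p = []

    initialForm : Poly → ∣𝒢∣
    initialForm f = initialPart f (μ ⟦ f ⟧) ⁺.refl

    I : Poly → Pred ∣𝒢∣ u
    I φ = PrincipalIdeal (initialForm φ)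

    record IsKeyPolynomial (φ : Poly) (d : ℕ) : Set u where
      field
        monic   : Monic φ d
        minimal : ∀ f → ¬ (f ≈ᴾ []) → DegreeBelow f d → ¬ I φ (initialForm f)
        prime   : IsPrime (I φ)
        nonzero : IsNonzero (I φ)

    HasDegree : ℕ → Set u
    HasDegree d = (∃ λ φ → IsKeyPolynomial φ d) ×
                  (∀ φ d′ → IsKeyPolynomial φ d′ → d ℕ.≤ d′)

  -- minTerms γ k [x₀, x₁, …] = minₙ (xₙ + (k + n)γ), with 0·∞ = 0
  minTerms : Γ⁺ → ℕ → List Γ⁺ → Γ⁺
  minTerms γ k []       = ⊤⁺
  minTerms γ k (x ∷ xs) = (x +⁺ k ×⁺ γ) ⊓ minTerms γ (suc k) xs

  IsInitial : Poly → Γ⁺ → Valuationˣ → Set u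
  IsInitial φ γ μ = ∀ as →
    μ ⟦ expansion φ (map const as) ⟧ ≈⁺ minTerms γ 0 (map vᴷ as)

  -- ν is given by the φ-expansions with coefficients valued by ρ, deg φ = d.
  IsAugmented : (Poly → Γ⁺) → Poly → ℕ → Γ⁺ → Valuationˣ → Set u
  IsAugmented ρ φ d γ ν = ∀ as → All (λ a → DegreeBelow a d) as →
    ν ⟦ expansion φ as ⟧ ≈⁺ minTerms γ 0 (map ρ as)

  record Family : Set (lsuc u) where
    field
      index : StrictTotalOrder u u u

    open StrictTotalOrder index public using ()
      renaming (Carrier to J; _≈_ to _≈ᴶ_; _<_ to _<ᴶ_)

    field
      wellFounded : WellFounded _<ᴶ_
      infinite    : ∀ n (list : Fin n → J) → ¬ (∀ j → ∃ λ k → j ≈ᴶ list k)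
      ρ           : J → Valuationˣ
      ρ-cong      : ∀ {i j} → i ≈ᴶ j → ρ i ≈ⱽ ρ j
      ρ-mono      : ∀ {i j} → i <ᴶ j → ρ i <ⱽ ρ j
      degree      : ℕ
      degrees     : ∀ j → HasDegree (ρ j) degree

    IsFirst : Valuationˣ → Set u
    IsFirst μ = ∃ λ i → (∀ j → ¬ (j <ᴶ i)) × (ρ i ≈ⱽ μ)

    Unstable : Pred Poly u
    Unstable g = ∀ {i j} → i <ᴶ j → ρ i ⟦ g ⟧ <⁺ ρ j ⟦ g ⟧

    record IsLimitKeyPolynomial (φ : Poly) (d : ℕ) : Set u where
      field
        monic    : Monic φ d
        unstable : Unstable φ
        minimal  : ∀ g → Unstable g → ¬ DegreeBelow g d

    HasStableValue : Poly → Γ⁺ → Set u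
    HasStableValue a x = ∃ λ i → ∀ j → ¬ (j <ᴶ i) → ρ j ⟦ a ⟧ ≈⁺ x

  record OrdinaryAugmentation
    (μ : Valuationˣ) (φ : Poly) (d : ℕ) (γ : Γ⁺) (ν : Valuationˣ) : Set u where
    field
      isKeyPolynomial : IsKeyPolynomial μ φ d
      above           : μ ⟦ φ ⟧ <⁺ γ
      isAugmented     : IsAugmented (μ ⟦_⟧) φ d γ ν

  record LimitAugmentation
    (μ : Valuationˣ) (φ : Poly) (d : ℕ) (γ : Γ⁺) (ν : Valuationˣ) : Set (lsuc u) where
    field
      𝒜 : Family

    open Family 𝒜

    field
      isFirst              : IsFirst μ
      isLimitKeyPolynomial : IsLimitKeyPolynomial φ d
      above                : ∀ j → ρ j ⟦ φ ⟧ <⁺ γ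
      ρ∞                   : Poly → Γ⁺
      ρ∞-stable            : ∀ a → DegreeBelow a d → HasStableValue a (ρ∞ a)
      isAugmented          : IsAugmented ρ∞ φ d γ ν

  data Augmentation
    (μ : Valuationˣ) (φ : Poly) (d : ℕ) (γ : Γ⁺) (ν : Valuationˣ) : Set (lsuc u) where
    ordinary : OrdinaryAugmentation μ φ d γ ν → Augmentation μ φ d γ ν
    limit    : LimitAugmentation μ φ d γ ν → Augmentation μ φ d γ ν

  augmentation-< : ∀ {μ φ d γ ν} → Augmentation μ φ d γ ν → μ ⟦ φ ⟧ <⁺ γ
  augmentation-< (ordinary A) = OrdinaryAugmentation.above A
  augmentation-< {φ = φ} (limit A) with LimitAugmentation.isFirst A
  ... | i , _ , ρᵢ≈μ = <⁺-respˡ-≈⁺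
    (NonStrictToStrict.<-respˡ-≈ Γ._≈_ Γ._≤_ Γ.Eq.trans Γ.≤-respˡ-≈)
    (ρᵢ≈μ φ) (LimitAugmentation.above A i)

  appendInfinity : ∀ {r} → (Fin r → Γ.Carrier) → Fin (suc r) → Γ⁺
  appendInfinity {zero}  γ zero    = ⊤⁺
  appendInfinity {suc r} γ zero    = just (γ zero)
  appendInfinity {suc r} γ (suc i) = appendInfinity (γ ∘ suc) i

  -- μ-last says that the chain ends in v_F, where v_F(g) = v(g(θ)).
  record MLVChain (θ : K̄.Carrier) (F : Poly) (r : ℕ) : Set (lsuc u) where
    field
      φ   : Fin (suc r) → Poly
      deg : Fin (suc r) → ℕ
      γ   : Fin r → Γ.Carrier
      μ   : Fin (suc r) → Valuationˣ

    -- γᵣ = ∞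
    γ⁺ : Fin (suc r) → Γ⁺
    γ⁺ = appendInfinity γ

    field
      φ-monic   : ∀ i → Monic (φ i) (deg i)
      φ-last    : φ (fromℕ r) ≈ᴾ F
      deg-first : deg zero ≡ 1
      deg-mono  : ∀ (i : Fin r) → deg (inject₁ i) ℕ.< deg (suc i)
      initial   : IsInitial (φ zero) (γ⁺ zero) (μ zero)
      step      : ∀ (i : Fin r) →
                  Augmentation (μ (inject₁ i)) (φ (suc i)) (deg (suc i)) (γ⁺ (suc i)) (μ (suc i))
      μ-last    : ∀ g → μ (fromℕ r) ⟦ g ⟧ ≈⁺ v (evaluate g θ)
      v-φ       : ∀ (i : Fin r) → v (evaluate (φ (inject₁ i)) θ) ≈⁺ just (γ i)

  -- λ₀ = γ₀ and λᵢ = γᵢ - μᵢ₋₁(φᵢ); the value μᵢ₋₁(φᵢ) < γᵢ is finite.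
  slope : ∀ {θ F r} → MLVChain θ F r → Fin r → Γ.Carrier
  slope C zero    = MLVChain.γ C zero
  slope C (suc i) = γ (suc i) Γ.- finite (augmentation-< (step (inject₁ i)))
    where open MLVChain C

-- At a generic point y of the ball of radius ε around θ, the value v(f(y)) is a function of f,
-- and a valuation of K[x].  By induction on i, μᵢ is this valuation for εᵢ = λ₀ + ⋯ + λᵢ.  Below the
-- degree of φᵢ₊₁ it agrees with v_F; as a root of f closer to θ than εᵢ makes v(f(θ)) exceed
-- v(f(y)), no such polynomial has one, and so εᵢ = δᵢ.  A limit augmentation is impossible: the
-- values at a polynomial g that vanishes at αᵢ would grow along the whole family, while g has too
-- small a degree to be unstable.
--
-- Tameness enters through derivatives.  The residue of φᵢ(θ)ᵉ / a, for some a ∈ K, is separable over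
-- that of K, and this gives G ∈ K[x] with v(G(y)) ≥ 0, v(G(θ)) > 0 and v(G′(θ)) = -εᵢ.  Division of G
-- by φᵢ₊₁ shows that v(φᵢ₊₁′(θ)) = μᵢ(φᵢ₊₁) - εᵢ, so that a single root of φᵢ₊₁ is closer to θ than εᵢ.
-- It accounts for the whole jump λᵢ₊₁ of φᵢ₊₁, hence lies at distance εᵢ + λᵢ₊₁ from θ.
module Submission where

open import Defs
open import Algebra.Apartness.Bundles using (HeytingField)
open import Algebra.Bundles using (AbelianGroup; CommutativeMonoid; CommutativeRing; RawRing; RawSemiring)
import Algebra.Construct.NaturalChoice.Min as Min
open import Algebra.Definitions.RawMonoid using (sum)
import Algebra.Definitions.RawMonoid as RawMonoidDefinitions
import Algebra.Morphism.Construct.Identity as Identity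
open import Algebra.Morphism.Structures using (IsRingHomomorphism)
import Algebra.Properties.AbelianGroup as AbelianGroupProperties
import Algebra.Properties.CommutativeMonoid.Sum as MonoidSum
import Algebra.Properties.Ring as RingProperties
import Algebra.Properties.Semiring.Mult.TCOptimised as SemiringMult
import Algebra.Properties.Semiring.Sum as SemiringSum
import Algebra.Solver.Ring
open import Algebra.Solver.Ring.AlmostCommutativeRing using (fromCommutativeRing; _-Raw-AlmostCommutative⟶_)
import Algebra.Solver.Ring.NaturalCoefficients.Default as NaturalSolver
open import Algebra.Structures using (IsAbelianGroup)
open import Axiom.ExcludedMiddle using (ExcludedMiddle)
open import Data.Empty using (⊥-elim)
open import Data.Fin using (Fin; zero; suc; inject₁; inject!; toℕ; punchIn)
open import Data.Fin.Induction using (<-weakInduction; >-weakInduction)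
open import Data.Fin.Permutation using (permutation)
open import Data.List.Base using (List; []; _∷_; _++_; length; map; tabulate)
open import Data.List.Properties using (map-∘)
open import Data.List.Relation.Unary.All as All using (All; []; _∷_)
open import Data.List.Relation.Unary.All.Properties using (++⁻ˡ; ++⁻ʳ; ¬All⇒Any¬)
open import Data.List.Relation.Unary.Any using (Any; here; there)
open import Data.Maybe using (Maybe; just; nothing)
open import Data.Nat using (ℕ; _<_; zero; suc; z≤n; s≤s)
import Data.Nat.Base as ℕ
open import Data.Nat.Induction using (<-rec)
import Data.Nat.Properties as ℕ
open import Data.Product.Base using (Σ; ∃; ∃₂; _×_; _,_; proj₁; proj₂)
open import Data.Sum.Base as Sum using (_⊎_; inj₁; inj₂)
open import Data.Vec.Functional using (insertAt)
open import Data.Vec.Functional.Properties using (insertAt-lookup; insertAt-punchIn)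
open import Function.Base using (_∘_)
open import Function.Bundles using (Equivalence)
open import Level using (Level) renaming (suc to lsuc)
open import Relation.Binary.Bundles using (StrictTotalOrder)
import Relation.Binary.Construct.Add.Supremum.Equality as Equality⁺
import Relation.Binary.Construct.Add.Supremum.NonStrict as NonStrict⁺
import Relation.Binary.Construct.Add.Supremum.Strict as Strict⁺
open import Relation.Binary.Definitions using (tri<; tri≈; tri>)
open import Relation.Binary.PropositionalEquality.Core as ≡ using (_≡_)
import Relation.Binary.Reasoning.Base.Triple as Triple
open import Relation.Nullary.Construct.Add.Supremum using (⊤⁺)
open import Relation.Nullary.Decidable.Core using (yes; no; decidable-stable)
open import Relation.Nullary.Negation.Core using (¬_; contradiction)
open import Relation.Unary using (Pred)

-- A generic point is an actual element of `K̄`, chosen after the finitely many polynomials that an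
-- argument mentions. It replaces the Gauss valuation of the ball and turns every claim into a
-- comparison of linear factors. The value -εᵢ of G′(θ) is that of a logarithmic derivative: for g =
-- φᵢᵉ / a one has g′ / g = e φᵢ′ / φᵢ, where e and g(θ) have value 0, and the induction carries
-- v(φᵢ′(θ)) = v(φᵢ(θ)) - εᵢ along. The chain describes μᵢ through graded algebras, and nothing says
-- beforehand which steps are ordinary. Two facts on degrees are all that is extracted from graded
-- algebras: a monic polynomial of least degree whose value grows from one valuation to a larger one
-- is a key polynomial for the first, and an augmentation at φ has no key polynomial of degree below
-- deg φ. Together they make all members of a family that begins at μᵢ agree below deg φᵢ. For g to
-- be unstable it must moreover be at least as good at θ as its competitors, which is why the
-- induction also compares g with the monic polynomials ψ of its degree that jump.

private
  variable
    u : Level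

-- Ring identities

-- A ring solver whose coefficients are the formal differences a - b of natural
-- numbers, so that terms cancel although equality in R is not decidable.
module IntegralSolver {c ℓ} (R : CommutativeRing c ℓ) where

  open CommutativeRing R hiding (ring; rawRing)
  open RingProperties (CommutativeRing.ring R) using (-‿+-comm; -‿involutive; x[y-z]≈xy-xz; [y-z]x≈yx-zx; -0#≈0#)
  open SemiringMult semiring using (×-homo-+; ×1-homo-*) renaming (_×_ to _·_)
  open import Relation.Binary.Reasoning.Setoid setoid

  private
    differences : RawRing _ _
    differences = record
      { Carrier = ℕ.ℕ × ℕ.ℕ
      ; _≈_ = λ (a , b) (c , d) → a ℕ.+ d ≡ c ℕ.+ b
      ; _+_ = λ (a , b) (c , d) → (a ℕ.+ c) , (b ℕ.+ d)
      ; _*_ = λ (a , b) (c , d) → (a ℕ.* c ℕ.+ b ℕ.* d) , (a ℕ.* d ℕ.+ b ℕ.* c)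
      ; -_  = λ (a , b) → b , a
      ; 0#  = 0 , 0
      ; 1#  = 1 , 0
      }

    difference : ℕ.ℕ × ℕ.ℕ → Carrier
    difference (a , b) = a · 1# - b · 1#

    -- The separate clause for a zero subtrahend makes `con (0 , 0)` and `con (1 , 0)` denote `0#`
    -- and `1#` definitionally, so that they match goals as they are written.
    ⟦_⟧ᶜ : ℕ.ℕ × ℕ.ℕ → Carrier
    ⟦ a , ℕ.zero ⟧ᶜ    = a · 1#
    ⟦ a , ℕ.suc b ⟧ᶜ = a · 1# - ℕ.suc b · 1#

    ⟦⟧ᶜ≈difference : ∀ x → ⟦ x ⟧ᶜ ≈ difference x
    ⟦⟧ᶜ≈difference (a , ℕ.zero)  = trans (sym (+-identityʳ _)) (+-congˡ (sym -0#≈0#))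
    ⟦⟧ᶜ≈difference (a , ℕ.suc b) = refl

    module NS = NaturalSolver commutativeSemiring

    cancel : ∀ x y z → x + y ≈ z + y → x ≈ z
    cancel x y z p = begin
      x               ≈⟨ +-identityʳ x ⟨
      x + 0#          ≈⟨ +-congˡ (-‿inverseʳ y) ⟨
      x + (y - y)     ≈⟨ +-assoc _ _ _ ⟨
      (x + y) - y     ≈⟨ +-congʳ p ⟩
      (z + y) - y     ≈⟨ +-assoc _ _ _ ⟩
      z + (y - y)     ≈⟨ +-congˡ (-‿inverseʳ y) ⟩
      z + 0#          ≈⟨ +-identityʳ z ⟩
      z               ∎

    difference-+ : ∀ w x y z → (w + y) - (x + z) ≈ (w - x) + (y - z)
    difference-+ w x y z = begin
      (w + y) - (x + z)        ≈⟨ +-congˡ (-‿+-comm x z) ⟨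
      (w + y) + (- x + - z)    ≈⟨ NS.solve 4 (λ w y x z → (w NS.:+ y) NS.:+ (x NS.:+ z) NS.:= (w NS.:+ x) NS.:+ (y NS.:+ z)) refl w y (- x) (- z) ⟩
      (w - x) + (y - z)        ∎

    difference-* : ∀ w x y z → (w * y + x * z) - (w * z + x * y) ≈ (w - x) * (y - z)
    difference-* w x y z = sym (begin
      (w - x) * (y - z)                       ≈⟨ [y-z]x≈yx-zx _ _ _ ⟩
      w * (y - z) - x * (y - z)               ≈⟨ +-cong (x[y-z]≈xy-xz _ _ _) (-‿cong (x[y-z]≈xy-xz _ _ _)) ⟩
      (w * y - w * z) - (x * y - x * z)       ≈⟨ +-congˡ (-‿+-comm _ _) ⟨
      (w * y - w * z) + (- (x * y) - - (x * z)) ≈⟨ +-congˡ (+-comm _ _) ⟩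
      (w * y - w * z) + (- - (x * z) - (x * y)) ≈⟨ +-congˡ (+-congʳ (-‿involutive _)) ⟩
      (w * y - w * z) + (x * z - x * y)       ≈⟨ difference-+ _ _ _ _ ⟨
      (w * y + x * z) - (w * z + x * y)       ∎)

    morphism : differences -Raw-AlmostCommutative⟶ fromCommutativeRing R
    morphism = record
      { ⟦_⟧    = ⟦_⟧ᶜ
      ; +-homo = λ x@(a , b) y@(c , d) → via (x +ᶜ y) (trans
          (+-cong (×-homo-+ 1# a c) (-‿cong (×-homo-+ 1# b d))) (difference-+ _ _ _ _))
          (+-cong (⟦⟧ᶜ≈difference x) (⟦⟧ᶜ≈difference y))
      ; *-homo = λ x@(a , b) y@(c , d) → via (x *ᶜ y) (trans
          (+-cong (trans (×-homo-+ 1# (a ℕ.* c) _) (+-cong (×1-homo-* a c) (×1-homo-* b d)))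
            (-‿cong (trans (×-homo-+ 1# (a ℕ.* d) _) (+-cong (×1-homo-* a d) (×1-homo-* b c)))))
          (difference-* _ _ _ _))
          (*-cong (⟦⟧ᶜ≈difference x) (⟦⟧ᶜ≈difference y))
      ; -‿homo = λ x@(a , b) → via (b , a)
          (trans (+-comm _ _) (trans (+-congˡ (sym (-‿involutive _))) (-‿+-comm _ _)))
          (-‿cong (⟦⟧ᶜ≈difference x))
      ; 0-homo = refl
      ; 1-homo = refl
      }
      where
      open RawRing differences using () renaming (_+_ to _+ᶜ_; _*_ to _*ᶜ_)
      via : ∀ x {y z} → difference x ≈ y → z ≈ y → ⟦ x ⟧ᶜ ≈ z
      via x p q = trans (⟦⟧ᶜ≈difference x) (trans p (sym q))

    _≟ᶜ_ : ∀ x y → Maybe (⟦ x ⟧ᶜ ≈ ⟦ y ⟧ᶜ)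
    (a , b) ≟ᶜ (c , d) with a ℕ.+ d ℕ.≟ c ℕ.+ b
    ... | no  _ = nothing
    ... | yes p = just (trans (⟦⟧ᶜ≈difference (a , b)) (trans (cancel _ (b · 1# + d · 1#) _ (begin
      (a · 1# - b · 1#) + (b · 1# + d · 1#)   ≈⟨ NS.solve 4 (λ a b′ b d → (a NS.:+ b′) NS.:+ (b NS.:+ d) NS.:= (a NS.:+ d) NS.:+ (b NS.:+ b′)) refl (a · 1#) _ (b · 1#) (d · 1#) ⟩
      (a · 1# + d · 1#) + (b · 1# - b · 1#)   ≈⟨ +-cong (sym (×-homo-+ 1# a d)) (trans (-‿inverseʳ _) (sym (-‿inverseʳ (d · 1#)))) ⟩
      (a ℕ.+ d) · 1# + (d · 1# - d · 1#)      ≈⟨ +-congʳ (reflexive (≡.cong (_· 1#) p)) ⟩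
      (c ℕ.+ b) · 1# + (d · 1# - d · 1#)      ≈⟨ +-congʳ (×-homo-+ 1# c b) ⟩
      (c · 1# + b · 1#) + (d · 1# - d · 1#)   ≈⟨ NS.solve 4 (λ c d′ b d → (c NS.:+ b) NS.:+ (d NS.:+ d′) NS.:= (c NS.:+ d′) NS.:+ (b NS.:+ d)) refl (c · 1#) _ (b · 1#) (d · 1#) ⟩
      (c · 1# - d · 1#) + (b · 1# + d · 1#)   ∎)) (sym (⟦⟧ᶜ≈difference (c , d)))))

  open Algebra.Solver.Ring differences (fromCommutativeRing R) morphism _≟ᶜ_ public
    using (solve; _:=_; _:+_; _:*_; _:-_; :-_; con)

-- Polynomials as coefficient lists: ring laws, degree bounds, division and expansions

module PolynomialRing (R : CommutativeRing u u) where

  open CommutativeRing R hiding (ring; rawRing)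
  open RingProperties (CommutativeRing.ring R) using (-0#≈0#)
  open Polynomials (CommutativeRing.rawRing R) public
  open import Relation.Binary.Reasoning.Setoid setoid

  -- A record, so that the two polynomials can be inferred from an equation.
  infix 4 _≋_
  record _≋_ (p q : Poly) : Set u where
    constructor coefficients
    field coefficient : p ≈ᴾ q
  open _≋_ public

  -- Opaque, since the pattern-matching operations would block unification.
  infix  8 ⊖_
  infixl 7 _⊗_
  infixr 7 _∙_
  infixl 6 _⊕_
  opaque
    _⊕_ _⊗_ : Poly → Poly → Poly
    _⊕_ = _+ᴾ_
    _⊗_ = _*ᴾ_

    ⊖_ : Poly → Poly
    ⊖_ = -ᴾ_

    _∙_ : Carrier → Poly → Poly
    a ∙ p = map (a *_) p

  X_ : Poly → Poly
  X p = 0# ∷ p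

  ≋-refl : ∀ {p} → p ≋ p
  ≋-refl = coefficients λ n → refl

  ≋-sym : ∀ {p q} → p ≋ q → q ≋ p
  ≋-sym (coefficients e) = coefficients λ n → sym (e n)

  ≋-trans : ∀ {p q r} → p ≋ q → q ≋ r → p ≋ r
  ≋-trans (coefficients e) (coefficients f) = coefficients λ n → trans (e n) (f n)

  ≡⇒≋ : ∀ {p q} → p ≡ q → p ≋ q
  ≡⇒≋ ≡.refl = ≋-refl

  ∷-cong : ∀ {a b p q} → a ≈ b → p ≋ q → (a ∷ p) ≋ (b ∷ q)
  ∷-cong e (coefficients f) = coefficients λ { zero → e ; (suc n) → f n }

  X-cong : ∀ {p q} → p ≋ q → X p ≋ X q
  X-cong = ∷-cong refl

  tail-≋ : ∀ {a b p q} → (a ∷ p) ≋ (b ∷ q) → p ≋ q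
  tail-≋ (coefficients e) = coefficients λ n → e (suc n)

  ∷≋[] : ∀ {a p} → a ≈ 0# → p ≋ [] → a ∷ p ≋ []
  ∷≋[] e (coefficients f) = coefficients λ { zero → e ; (suc n) → f n }

  opaque
    unfolding _⊕_

    ⊕-≡ : ∀ p q → p ⊕ q ≡ p +ᴾ q
    ⊕-≡ p q = ≡.refl

    ⊗-≡ : ∀ p q → p ⊗ q ≡ p *ᴾ q
    ⊗-≡ p q = ≡.refl

    ⊖-≡ : ∀ p → ⊖ p ≡ -ᴾ p
    ⊖-≡ p = ≡.refl

    coeff-⊕ : ∀ p q n → coeff (p ⊕ q) n ≈ coeff p n + coeff q n
    coeff-⊕ []      q       n       = sym (+-identityˡ _)
    coeff-⊕ (a ∷ p) []      zero    = sym (+-identityʳ _)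
    coeff-⊕ (a ∷ p) []      (suc n) = sym (+-identityʳ _)
    coeff-⊕ (a ∷ p) (b ∷ q) zero    = refl
    coeff-⊕ (a ∷ p) (b ∷ q) (suc n) = coeff-⊕ p q n

    coeff-∙ : ∀ a p n → coeff (a ∙ p) n ≈ a * coeff p n
    coeff-∙ a []      n       = sym (zeroʳ a)
    coeff-∙ a (b ∷ p) zero    = refl
    coeff-∙ a (b ∷ p) (suc n) = coeff-∙ a p n

    coeff-⊖ : ∀ p n → coeff (⊖ p) n ≈ - coeff p n
    coeff-⊖ []      n       = sym -0#≈0#
    coeff-⊖ (b ∷ p) zero    = refl
    coeff-⊖ (b ∷ p) (suc n) = coeff-⊖ p n

    []-⊗ : ∀ q → [] ⊗ q ≋ []
    []-⊗ q = ≋-refl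

    ∷-⊗ : ∀ a p q → (a ∷ p) ⊗ q ≋ a ∙ q ⊕ X (p ⊗ q)
    ∷-⊗ a p q = ≋-refl

    ∙-[] : ∀ a → a ∙ [] ≋ []
    ∙-[] a = ≋-refl

    ∷-⊕-∷ : ∀ a p b q → (a ∷ p) ⊕ (b ∷ q) ≋ (a + b) ∷ (p ⊕ q)
    ∷-⊕-∷ a p b q = ≋-refl

    ∙-∷ : ∀ a b p → a ∙ (b ∷ p) ≋ (a * b) ∷ (a ∙ p)
    ∙-∷ a b p = ≋-refl

  private
    ⊕-cong : ∀ {p q r s} → p ≋ q → r ≋ s → p ⊕ r ≋ q ⊕ s
    ⊕-cong {p} {q} {r} {s} (coefficients e) (coefficients f) = coefficients λ n →
      trans (coeff-⊕ p r n) (trans (+-cong (e n) (f n)) (sym (coeff-⊕ q s n)))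

    ⊕-comm : ∀ p q → p ⊕ q ≋ q ⊕ p
    ⊕-comm p q = coefficients λ n →
      trans (coeff-⊕ p q n) (trans (+-comm _ _) (sym (coeff-⊕ q p n)))

    ⊕-assoc : ∀ p q r → (p ⊕ q) ⊕ r ≋ p ⊕ (q ⊕ r)
    ⊕-assoc p q r = coefficients λ n → begin
      coeff ((p ⊕ q) ⊕ r) n                 ≈⟨ coeff-⊕ (p ⊕ q) r n ⟩
      coeff (p ⊕ q) n + coeff r n           ≈⟨ +-congʳ (coeff-⊕ p q n) ⟩
      (coeff p n + coeff q n) + coeff r n   ≈⟨ +-assoc _ _ _ ⟩
      coeff p n + (coeff q n + coeff r n)   ≈⟨ +-congˡ (coeff-⊕ q r n) ⟨
      coeff p n + coeff (q ⊕ r) n           ≈⟨ coeff-⊕ p _ n ⟨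
      coeff (p ⊕ (q ⊕ r)) n                 ∎

    ⊕-identityʳ : ∀ p → p ⊕ [] ≋ p
    ⊕-identityʳ p = coefficients λ n → trans (coeff-⊕ p [] n) (+-identityʳ _)

    ⊕-identityˡ : ∀ p → [] ⊕ p ≋ p
    ⊕-identityˡ p = ≋-trans (⊕-comm [] p) (⊕-identityʳ p)

    ⊖-inverseʳ : ∀ p → p ⊕ ⊖ p ≋ []
    ⊖-inverseʳ p = coefficients λ n →
      trans (coeff-⊕ p _ n) (trans (+-congˡ (coeff-⊖ p n)) (-‿inverseʳ _))

    ⊖-cong : ∀ {p q} → p ≋ q → ⊖ p ≋ ⊖ q
    ⊖-cong {p} {q} (coefficients e) = coefficients λ n →
      trans (coeff-⊖ p n) (trans (-‿cong (e n)) (sym (coeff-⊖ q n)))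

    ∙-cong : ∀ {a b p q} → a ≈ b → p ≋ q → a ∙ p ≋ b ∙ q
    ∙-cong {a} {b} {p} {q} e (coefficients f) = coefficients λ n →
      trans (coeff-∙ a p n) (trans (*-cong e (f n)) (sym (coeff-∙ b q n)))

    ∙-distribˡ : ∀ a p q → a ∙ (p ⊕ q) ≋ a ∙ p ⊕ a ∙ q
    ∙-distribˡ a p q = coefficients λ n → begin
      coeff (a ∙ (p ⊕ q)) n                 ≈⟨ coeff-∙ a (p ⊕ q) n ⟩
      a * coeff (p ⊕ q) n                   ≈⟨ *-congˡ (coeff-⊕ p q n) ⟩
      a * (coeff p n + coeff q n)           ≈⟨ distribˡ a _ _ ⟩
      a * coeff p n + a * coeff q n         ≈⟨ +-cong (coeff-∙ a p n) (coeff-∙ a q n) ⟨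
      coeff (a ∙ p) n + coeff (a ∙ q) n     ≈⟨ coeff-⊕ (a ∙ p) _ n ⟨
      coeff (a ∙ p ⊕ a ∙ q) n               ∎

    ∙-distribʳ : ∀ a b p → (a + b) ∙ p ≋ a ∙ p ⊕ b ∙ p
    ∙-distribʳ a b p = coefficients λ n → begin
      coeff ((a + b) ∙ p) n                 ≈⟨ coeff-∙ _ p n ⟩
      (a + b) * coeff p n                   ≈⟨ distribʳ _ a b ⟩
      a * coeff p n + b * coeff p n         ≈⟨ +-cong (coeff-∙ a p n) (coeff-∙ b p n) ⟨
      coeff (a ∙ p) n + coeff (b ∙ p) n     ≈⟨ coeff-⊕ (a ∙ p) _ n ⟨
      coeff (a ∙ p ⊕ b ∙ p) n               ∎

    ∙-assoc : ∀ a b p → (a * b) ∙ p ≋ a ∙ (b ∙ p)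
    ∙-assoc a b p = coefficients λ n → begin
      coeff ((a * b) ∙ p) n   ≈⟨ coeff-∙ _ p n ⟩
      (a * b) * coeff p n     ≈⟨ *-assoc a b _ ⟩
      a * (b * coeff p n)     ≈⟨ *-congˡ (coeff-∙ b p n) ⟨
      a * coeff (b ∙ p) n     ≈⟨ coeff-∙ a (b ∙ p) n ⟨
      coeff (a ∙ (b ∙ p)) n   ∎

    0∙ : ∀ {a} p → a ≈ 0# → a ∙ p ≋ []
    0∙ p e = coefficients λ n → trans (coeff-∙ _ p n) (trans (*-congʳ e) (zeroˡ _))

    1∙ : ∀ p → 1# ∙ p ≋ p
    1∙ p = coefficients λ n → trans (coeff-∙ _ p n) (*-identityˡ _)

    X-∙ : ∀ a p → X (a ∙ p) ≋ a ∙ X p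
    X-∙ a p = ≋-trans (∷-cong (sym (zeroʳ a)) ≋-refl) (≋-sym (∙-∷ a 0# p))

    X-⊕ : ∀ p q → X (p ⊕ q) ≋ X p ⊕ X q
    X-⊕ p q = ≋-trans (∷-cong (sym (+-identityʳ 0#)) ≋-refl) (≋-sym (∷-⊕-∷ 0# p 0# q))

    ⊕-left-comm : ∀ p q r → p ⊕ (q ⊕ r) ≋ q ⊕ (p ⊕ r)
    ⊕-left-comm p q r = ≋-trans (≋-sym (⊕-assoc p q r))
      (≋-trans (⊕-cong (⊕-comm p q) ≋-refl) (⊕-assoc q p r))

    ⊕-interchange : ∀ p q r s → (p ⊕ q) ⊕ (r ⊕ s) ≋ (p ⊕ r) ⊕ (q ⊕ s)
    ⊕-interchange p q r s = ≋-trans (⊕-assoc p q _)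
      (≋-trans (⊕-cong ≋-refl (⊕-left-comm q r s)) (≋-sym (⊕-assoc p r _)))

    ⊗-zeroʳ : ∀ p → p ⊗ [] ≋ []
    ⊗-zeroʳ []      = []-⊗ []
    ⊗-zeroʳ (a ∷ p) = ≋-trans (∷-⊗ a p []) (≋-trans (⊕-cong (∙-[] a) (∷≋[] refl (⊗-zeroʳ p))) (⊕-identityʳ []))

    ≋[]-⊗ : ∀ p q → p ≋ [] → p ⊗ q ≋ []
    ≋[]-⊗ []      q e = []-⊗ q
    ≋[]-⊗ (a ∷ p) q e = ≋-trans (∷-⊗ a p q) (≋-trans
      (⊕-cong (0∙ q (coefficient e 0)) (∷≋[] refl (≋[]-⊗ p q (coefficients λ n → coefficient e (suc n)))))
      (⊕-identityʳ []))

    ⊗-congˡ : ∀ p {q r} → q ≋ r → p ⊗ q ≋ p ⊗ r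
    ⊗-congˡ []      e = ≋-trans ([]-⊗ _) (≋-sym ([]-⊗ _))
    ⊗-congˡ (a ∷ p) e = ≋-trans (∷-⊗ a p _)
      (≋-trans (⊕-cong (∙-cong refl e) (X-cong (⊗-congˡ p e))) (≋-sym (∷-⊗ a p _)))

    ⊗-congʳ : ∀ {p q} r → p ≋ q → p ⊗ r ≋ q ⊗ r
    ⊗-congʳ {[]}    {q}     r e = ≋-trans ([]-⊗ r) (≋-sym (≋[]-⊗ q r (≋-sym e)))
    ⊗-congʳ {a ∷ p} {[]}    r e = ≋-trans (≋[]-⊗ (a ∷ p) r e) (≋-sym ([]-⊗ r))
    ⊗-congʳ {a ∷ p} {b ∷ q} r e = ≋-trans (∷-⊗ a p r)
      (≋-trans (⊕-cong (∙-cong (coefficient e 0) ≋-refl) (X-cong (⊗-congʳ r (tail-≋ e)))) (≋-sym (∷-⊗ b q r)))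

    ⊗-distribʳ : ∀ r p q → (p ⊕ q) ⊗ r ≋ p ⊗ r ⊕ q ⊗ r
    ⊗-distribʳ r []      q       = ≋-trans (⊗-congʳ r (⊕-identityˡ q))
      (≋-trans (≋-sym (⊕-identityˡ _)) (⊕-cong (≋-sym ([]-⊗ r)) ≋-refl))
    ⊗-distribʳ r (a ∷ p) []      = ≋-trans (⊗-congʳ r (⊕-identityʳ (a ∷ p)))
      (≋-trans (≋-sym (⊕-identityʳ _)) (⊕-cong ≋-refl (≋-sym ([]-⊗ r))))
    ⊗-distribʳ r (a ∷ p) (b ∷ q) = ≋-trans (⊗-congʳ r (∷-⊕-∷ a p b q)) (≋-trans (∷-⊗ _ _ r) (≋-trans
      (⊕-cong (∙-distribʳ a b r) (≋-trans (X-cong (⊗-distribʳ r p q)) (X-⊕ _ _)))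
      (≋-trans (⊕-interchange _ _ _ _) (⊕-cong (≋-sym (∷-⊗ a p r)) (≋-sym (∷-⊗ b q r))))))

  ⊗-∷ : ∀ p b q → p ⊗ (b ∷ q) ≋ b ∙ p ⊕ X (p ⊗ q)
  ⊗-∷ []      b q = ≋-trans ([]-⊗ (b ∷ q)) (≋-sym (≋-trans (⊕-cong
    (∙-[] b) (∷≋[] refl ([]-⊗ q))) (⊕-identityʳ [])))
  ⊗-∷ (a ∷ p) b q = ≋-trans (∷-⊗ a p (b ∷ q)) (≋-trans (⊕-cong (∙-∷ a b q) ≋-refl)
    (≋-trans (∷-⊕-∷ _ _ _ _) (≋-trans
      (∷-cong (+-congʳ (*-comm a b)) (≋-trans (⊕-cong ≋-refl (⊗-∷ p b q))
        (≋-trans (⊕-left-comm _ _ _) (⊕-cong ≋-refl (≋-sym (∷-⊗ a p q))))))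
      (≋-trans (≋-sym (∷-⊕-∷ _ _ _ _)) (⊕-cong (≋-sym (∙-∷ b a p)) ≋-refl)))))

  private
    ⊗-comm : ∀ p q → p ⊗ q ≋ q ⊗ p
    ⊗-comm []      q = ≋-trans ([]-⊗ q) (≋-sym (⊗-zeroʳ q))
    ⊗-comm (a ∷ p) q = ≋-trans (∷-⊗ a p q)
      (≋-trans (⊕-cong ≋-refl (X-cong (⊗-comm p q))) (≋-sym (⊗-∷ q a p)))

    ∙-⊗ : ∀ a p q → (a ∙ p) ⊗ q ≋ a ∙ (p ⊗ q)
    ∙-⊗ a []      q = ≋-trans (≋[]-⊗ _ q (∙-[] a)) (≋-sym (≋-trans (∙-cong refl ([]-⊗ q)) (∙-[] a)))
    ∙-⊗ a (b ∷ p) q = ≋-trans (⊗-congʳ q (∙-∷ a b p)) (≋-trans (∷-⊗ _ _ q) (≋-trans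
      (⊕-cong (∙-assoc a b q) (≋-trans (X-cong (∙-⊗ a p q)) (X-∙ a _)))
      (≋-trans (≋-sym (∙-distribˡ a _ _)) (∙-cong refl (≋-sym (∷-⊗ b p q))))))

    X-⊗ : ∀ p q → X p ⊗ q ≋ X (p ⊗ q)
    X-⊗ p q = ≋-trans (∷-⊗ 0# p q) (≋-trans (⊕-cong (0∙ q refl) ≋-refl) (⊕-identityˡ _))

    ⊗-assoc : ∀ p q r → (p ⊗ q) ⊗ r ≋ p ⊗ (q ⊗ r)
    ⊗-assoc []      q r = ≋-trans (⊗-congʳ r ([]-⊗ q)) (≋-trans ([]-⊗ r) (≋-sym ([]-⊗ _)))
    ⊗-assoc (a ∷ p) q r = ≋-trans (⊗-congʳ r (∷-⊗ a p q)) (≋-trans (⊗-distribʳ r _ _) (≋-trans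
      (⊕-cong (∙-⊗ a q r) (≋-trans (X-⊗ _ r) (X-cong (⊗-assoc p q r)))) (≋-sym (∷-⊗ a p _))))

  const-⊗ : ∀ a p → const a ⊗ p ≋ a ∙ p
  const-⊗ a p = ≋-trans (∷-⊗ a [] p) (≋-trans (⊕-cong ≋-refl (∷≋[] refl ([]-⊗ p))) (⊕-identityʳ _))

  polynomials : CommutativeRing u u
  polynomials = record
    { Carrier = Poly ; _≈_ = _≋_ ; _+_ = _⊕_ ; _*_ = _⊗_ ; -_ = ⊖_ ; 0# = [] ; 1# = const 1#
    ; isCommutativeRing = record
      { isRing = record
        { +-isAbelianGroup = record
          { isGroup = record
            { isMonoid = record
              { isSemigroup = record
                { isMagma = record
                  { isEquivalence = record { refl = ≋-refl ; sym = ≋-sym ; trans = ≋-trans }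
                  ; ∙-cong = ⊕-cong }
                ; assoc = ⊕-assoc }
              ; identity = ⊕-identityˡ , ⊕-identityʳ }
            ; inverse = (λ p → ≋-trans (⊕-comm (⊖ p) p) (⊖-inverseʳ p)) , ⊖-inverseʳ
            ; ⁻¹-cong = ⊖-cong }
          ; comm = ⊕-comm }
        ; *-cong = λ {p} {q} {r} {s} e f → ≋-trans (⊗-congʳ r e) (⊗-congˡ q f)
        ; *-assoc = ⊗-assoc
        ; *-identity = 1⊗ , λ p → ≋-trans (⊗-comm p _) (1⊗ p)
        ; distrib = (λ p q r → ≋-trans (⊗-comm p _) (≋-trans (⊗-distribʳ p q r)
                      (⊕-cong (⊗-comm q p) (⊗-comm r p)))) , ⊗-distribʳ
        }
      ; *-comm = ⊗-comm } }
    where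
    1⊗ : ∀ p → const 1# ⊗ p ≋ p
    1⊗ p = ≋-trans (const-⊗ 1# p) (1∙ p)

  module ᴾ where
    open CommutativeRing polynomials public
    open RingProperties (CommutativeRing.ring polynomials) public
    open IntegralSolver polynomials public

  infixl 6 _⊝_
  _⊝_ : Poly → Poly → Poly
  p ⊝ q = p ⊕ ⊖ q

  record Below (p : Poly) (n : ℕ) : Set u where
    constructor below
    field isBelow : DegreeBelow p n
  open Below public

  below-cong : ∀ {p q n} → p ≋ q → Below p n → Below q n
  below-cong e (below d) = below λ k n≤k → trans (sym (coefficient e k)) (d k n≤k)

  below-weaken : ∀ {p m n} → m ℕ.≤ n → Below p m → Below p n
  below-weaken m≤n (below d) = below λ k n≤k → d k (ℕ.≤-trans m≤n n≤k)

  below-⊕ : ∀ {p q n} → Below p n → Below q n → Below (p ⊕ q) n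
  below-⊕ {p} {q} (below d) (below e) = below λ k n≤k →
    trans (coeff-⊕ p q k) (trans (+-cong (d k n≤k) (e k n≤k)) (+-identityʳ _))

  below-⊖ : ∀ {p n} → Below p n → Below (⊖ p) n
  below-⊖ {p} (below d) = below λ k n≤k → trans (coeff-⊖ p k) (trans (-‿cong (d k n≤k)) -0#≈0#)

  below-∙ : ∀ a {p n} → Below p n → Below (a ∙ p) n
  below-∙ a {p} (below d) = below λ k n≤k → trans (coeff-∙ a p k) (trans (*-congˡ (d k n≤k)) (zeroʳ a))

  below-∷ : ∀ {a p n} → Below p n → Below (a ∷ p) (suc n)
  below-∷ (below d) = below λ { (suc k) (s≤s n≤k) → d k n≤k }

  below-const : ∀ {a n} → Below (const a) (suc n)
  below-const = below λ { (suc k) _ → refl }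

  below-[] : ∀ {n} → Below [] n
  below-[] = below λ k _ → refl

  below-top : ∀ {p n} → Below p (suc n) → coeff p n ≈ 0# → Below p n
  below-top {p} {n} (below d) e = below go
    where
    go : DegreeBelow p n
    go k n≤k with n ℕ.≟ k
    ... | yes ≡.refl = e
    ... | no  n≢k    = d k (ℕ.≤∧≢⇒< n≤k n≢k)

  below-0⇒[] : ∀ {p} → Below p 0 → p ≋ []
  below-0⇒[] (below d) = coefficients λ n → d n z≤n

  below-1⇒const : ∀ {p} → Below p 1 → p ≋ const (coeff p 0)
  below-1⇒const {[]}    d         = coefficients λ { zero → refl ; (suc n) → refl }
  below-1⇒const {a ∷ p} (below d) = ∷-cong refl (coefficients λ n → d (suc n) (s≤s z≤n))

  private
    constant-⊗ : ∀ {a p} q → Below (a ∷ p) 1 → (a ∷ p) ⊗ q ≋ a ∙ q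
    constant-⊗ {a} {p} q d = ≋-trans (⊗-congʳ q (below-1⇒const d)) (const-⊗ a q)

    below-tail : ∀ {a p m} → Below (a ∷ p) (suc m) → Below p m
    below-tail (below d) = below λ k m≤k → d (suc k) (s≤s m≤k)

  below-⊗ : ∀ {p q m n} → Below p (suc m) → Below q (suc n) → Below (p ⊗ q) (suc (m ℕ.+ n))
  below-⊗ {[]}    {q}         d e = below-cong (≋-sym ([]-⊗ q)) below-[]
  below-⊗ {a ∷ p} {q} {zero}  d e = below-cong (≋-sym (constant-⊗ q d)) (below-∙ a e)
  below-⊗ {a ∷ p} {q} {suc m} d e = below-cong (≋-sym (∷-⊗ a p q)) (below-⊕
    (below-∙ a (below-weaken (s≤s (ℕ.m≤n+m _ (suc m))) e)) (below-∷ (below-⊗ (below-tail d) e)))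

  top-⊗ : ∀ {p q m n} → Below p (suc m) → Below q (suc n) →
          coeff (p ⊗ q) (m ℕ.+ n) ≈ coeff p m * coeff q n
  top-⊗ {[]}    {q} {m} {n}     d e = trans (coefficient ([]-⊗ q) (m ℕ.+ n)) (sym (zeroˡ _))
  top-⊗ {a ∷ p} {q} {zero}  {n} d e = trans (coefficient (constant-⊗ q d) n) (coeff-∙ a q n)
  top-⊗ {a ∷ p} {q} {suc m} {n} d e = begin
    coeff ((a ∷ p) ⊗ q) (suc m ℕ.+ n)                    ≈⟨ coefficient (∷-⊗ a p q) _ ⟩
    coeff (a ∙ q ⊕ X (p ⊗ q)) (suc m ℕ.+ n)              ≈⟨ coeff-⊕ (a ∙ q) _ (suc m ℕ.+ n) ⟩
    coeff (a ∙ q) (suc m ℕ.+ n) + coeff (p ⊗ q) (m ℕ.+ n)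
      ≈⟨ +-cong (isBelow (below-∙ a e) _ (s≤s (ℕ.m≤n+m n m))) (top-⊗ (below-tail d) e) ⟩
    0# + coeff p m * coeff q n                            ≈⟨ +-identityˡ _ ⟩
    coeff p m * coeff q n                                 ∎

  record IsMonic (p : Poly) (d : ℕ) : Set u where
    constructor monic
    field
      leading : coeff p d ≈ 1#
      bounded : Below p (suc d)
  open IsMonic public

  toMonic : ∀ {p d} → Monic p d → IsMonic p d
  toMonic (p₁ , p₀) = monic p₁ (below p₀)

  fromMonic : ∀ {p d} → IsMonic p d → Monic p d
  fromMonic (monic p₁ (below p₀)) = p₁ , p₀

  monic-⊝ : ∀ {p q d} → IsMonic p d → IsMonic q d → Below (p ⊝ q) d
  monic-⊝ {p} {q} {d} (monic p₁ p₀) (monic q₁ q₀) = below-top (below-⊕ p₀ (below-⊖ q₀))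
    (trans (coeff-⊕ p _ d) (trans (+-cong p₁ (trans (coeff-⊖ q d) (-‿cong q₁))) (-‿inverseʳ 1#)))

  module _ {φ : Poly} {d : ℕ} (φ-monic : IsMonic φ d) where

    open IsMonic φ-monic using () renaming (leading to φ₁; bounded to φ₀)

    private
      reduce : ∀ {p} → Below p (suc d) → Below (p ⊝ coeff p d ∙ φ) d
      reduce {p} p₀ = below-top (below-⊕ p₀ (below-⊖ (below-∙ _ φ₀))) (begin
        coeff (p ⊝ coeff p d ∙ φ) d              ≈⟨ coeff-⊕ p _ d ⟩
        coeff p d + coeff (⊖ (coeff p d ∙ φ)) d  ≈⟨ +-congˡ (coeff-⊖ (coeff p d ∙ φ) d) ⟩
        coeff p d - coeff (coeff p d ∙ φ) d      ≈⟨ +-congˡ (-‿cong (trans (coeff-∙ _ φ d) (trans (*-congˡ φ₁) (*-identityʳ _)))) ⟩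
        coeff p d - coeff p d                    ≈⟨ -‿inverseʳ _ ⟩
        0#                                       ∎)

    opaque
      -- Horner's scheme from the leading coefficient downwards: if `f = q φ + r`, then
      -- `a + X f = (X q) φ + (a + X r)`, and the coefficient of degree `d` in the new remainder
      -- moves into the quotient.
      divide : ∀ f → ∃₂ λ q r → f ≋ q ⊗ φ ⊕ r × Below r d
      divide []      = [] , [] , ≋-sym (≋-trans (⊕-identityʳ _) ([]-⊗ φ)) , below-[]
      divide (a ∷ f) with divide f
      ... | q , r , e , r₀ = c ∷ q , (a ∷ r) ⊝ c ∙ φ , split , reduce (below-∷ r₀)
        where
        c : Carrier
        c = coeff (a ∷ r) d
        split : a ∷ f ≋ (c ∷ q) ⊗ φ ⊕ ((a ∷ r) ⊝ c ∙ φ)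
        split = ≋-trans (∷-cong (sym (+-identityˡ a)) e) (≋-trans (≋-sym (∷-⊕-∷ _ _ _ _)) (≋-trans
          (ᴾ.solve 3 (λ s t w → s ᴾ.:+ t ᴾ.:= (w ᴾ.:+ s) ᴾ.:+ (t ᴾ.:- w)) ≋-refl (X (q ⊗ φ)) (a ∷ r) (c ∙ φ))
          (⊕-cong (≋-sym (∷-⊗ c q φ)) ≋-refl)))

    private
      -- The digits to base `φ` of `c + X f`, given those of `f`: the coefficient of degree `d` that
      -- multiplication by `X` creates in one digit is carried into the next. The last carry is a
      -- new constant digit, which is admissible only for `1 ≤ d`.
      shift : Carrier → List Poly → List Poly
      shift c []       = const c ∷ []
      shift c (a ∷ as) = ((c ∷ a) ⊝ coeff (c ∷ a) d ∙ φ) ∷ shift (coeff (c ∷ a) d) as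

      shift-below : 1 ℕ.≤ d → ∀ c as → All (λ a → Below a d) as → All (λ a → Below a d) (shift c as)
      shift-below 1≤d c []       []        = below-weaken 1≤d below-const ∷ []
      shift-below 1≤d c (a ∷ as) (a₀ ∷ as₀) = reduce (below-∷ a₀) ∷ shift-below 1≤d _ as as₀

      expansion-∷ : ∀ a as → expansion φ (a ∷ as) ≋ a ⊕ φ ⊗ expansion φ as
      expansion-∷ a as = ≡⇒≋ (≡.sym (≡.trans (⊕-≡ a _) (≡.cong (a +ᴾ_) (⊗-≡ φ _))))

      shift-expansion : ∀ c as → expansion φ (shift c as) ≋ c ∷ expansion φ as
      shift-expansion c []       = ≋-trans (expansion-∷ (const c) [])
        (≋-trans (⊕-cong ≋-refl (⊗-zeroʳ φ)) (⊕-identityʳ _))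
      shift-expansion c (a ∷ as) = ≋-trans (expansion-∷ _ (shift (coeff (c ∷ a) d) as)) (≋-trans
        (⊕-cong ≋-refl (≋-trans (⊗-congˡ φ (shift-expansion (coeff (c ∷ a) d) as)) (⊗-∷ φ _ _)))
        (≋-trans (ᴾ.solve 3 (λ s w t → (s ᴾ.:- w) ᴾ.:+ (w ᴾ.:+ t) ᴾ.:= s ᴾ.:+ t) ≋-refl (c ∷ a) (coeff (c ∷ a) d ∙ φ) _)
          (≋-trans (∷-⊕-∷ _ _ _ _) (∷-cong (+-identityʳ c) (≋-sym (expansion-∷ a as))))))

    opaque
      expand : 1 ℕ.≤ d → ∀ f → ∃ λ as → All (λ a → Below a d) as × expansion φ as ≋ f
      expand 1≤d []      = [] , [] , ≋-refl
      expand 1≤d (c ∷ f) with expand 1≤d f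
      ... | as , as₀ , e = shift c as , shift-below 1≤d c as as₀ , ≋-trans (shift-expansion c as) (∷-cong refl e)

-- Evaluation, derivatives and composition

module Evaluation (R S : CommutativeRing u u) {ι : CommutativeRing.Carrier R → CommutativeRing.Carrier S}
  (ι-isHom : IsRingHomomorphism (CommutativeRing.rawRing R) (CommutativeRing.rawRing S) ι) where

  private module R where
    open CommutativeRing R public
    open RawMonoidDefinitions +-rawMonoid public using () renaming (_×_ to _·_)
  open CommutativeRing S hiding (ring; rawRing)
  open RawMonoidDefinitions +-rawMonoid using () renaming (_×_ to _·_)
  open IntegralSolver S
  open PolynomialRing R
  open Extension R.rawRing (CommutativeRing.rawRing S) ι public using (evaluate)
  open IsRingHomomorphism ι-isHom using (⟦⟧-cong; +-homo; *-homo; 0#-homo; 1#-homo; -‿homo)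
  open import Relation.Binary.Reasoning.Setoid setoid

  evaluate-zero : ∀ {p} x → p ≋ [] → evaluate p x ≈ 0#
  evaluate-zero {[]}    x e = refl
  evaluate-zero {a ∷ p} x e = begin
    ι a + x * evaluate p x   ≈⟨ +-cong (trans (⟦⟧-cong (coefficient e 0)) 0#-homo) (*-congˡ (evaluate-zero {p} x (coefficients λ n → coefficient e (suc n)))) ⟩
    0# + x * 0#              ≈⟨ trans (+-identityˡ _) (zeroʳ x) ⟩
    0#                       ∎

  evaluate-cong : ∀ {p q} x → p ≋ q → evaluate p x ≈ evaluate q x
  evaluate-cong {[]}    {q}     x e = sym (evaluate-zero x (≋-sym e))
  evaluate-cong {a ∷ p} {[]}    x e = evaluate-zero {a ∷ p} x e
  evaluate-cong {a ∷ p} {b ∷ q} x e = +-cong (⟦⟧-cong (coefficient e 0)) (*-congˡ (evaluate-cong x (tail-≋ e)))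

  evaluate-const : ∀ a x → evaluate (const a) x ≈ ι a
  evaluate-const a x = trans (+-congˡ (zeroʳ x)) (+-identityʳ _)

  evaluate-X : ∀ p x → evaluate (X p) x ≈ x * evaluate p x
  evaluate-X p x = trans (+-congʳ 0#-homo) (+-identityˡ _)

  evaluate-⊕ : ∀ p q x → evaluate (p ⊕ q) x ≈ evaluate p x + evaluate q x
  evaluate-⊕ []      q       x = trans (evaluate-cong x (ᴾ.+-identityˡ q)) (sym (+-identityˡ _))
  evaluate-⊕ (a ∷ p) []      x = trans (evaluate-cong x (ᴾ.+-identityʳ (a ∷ p))) (sym (+-identityʳ _))
  evaluate-⊕ (a ∷ p) (b ∷ q) x = begin
    evaluate ((a ∷ p) ⊕ (b ∷ q)) x                          ≈⟨ evaluate-cong x (∷-⊕-∷ a p b q) ⟩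
    ι (a R.+ b) + x * evaluate (p ⊕ q) x                    ≈⟨ +-cong (+-homo a b) (*-congˡ (evaluate-⊕ p q x)) ⟩
    (ι a + ι b) + x * (evaluate p x + evaluate q x)
      ≈⟨ solve 5 (λ a b x p q → (a :+ b) :+ x :* (p :+ q) := (a :+ x :* p) :+ (b :+ x :* q)) refl _ _ _ _ _ ⟩
    (ι a + x * evaluate p x) + (ι b + x * evaluate q x)     ∎

  evaluate-∙ : ∀ a p x → evaluate (a ∙ p) x ≈ ι a * evaluate p x
  evaluate-∙ a []      x = trans (evaluate-zero x (∙-[] a)) (sym (zeroʳ _))
  evaluate-∙ a (b ∷ p) x = begin
    evaluate (a ∙ (b ∷ p)) x                    ≈⟨ evaluate-cong x (∙-∷ a b p) ⟩
    ι (a R.* b) + x * evaluate (a ∙ p) x        ≈⟨ +-cong (*-homo a b) (*-congˡ (evaluate-∙ a p x)) ⟩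
    ι a * ι b + x * (ι a * evaluate p x)        ≈⟨ solve 4 (λ a b x p → a :* b :+ x :* (a :* p) := a :* (b :+ x :* p)) refl _ _ _ _ ⟩
    ι a * (ι b + x * evaluate p x)              ∎

  evaluate-⊗ : ∀ p q x → evaluate (p ⊗ q) x ≈ evaluate p x * evaluate q x
  evaluate-⊗ []      q x = trans (evaluate-cong x ([]-⊗ q)) (sym (zeroˡ _))
  evaluate-⊗ (a ∷ p) q x = begin
    evaluate ((a ∷ p) ⊗ q) x                                      ≈⟨ evaluate-cong x (∷-⊗ a p q) ⟩
    evaluate (a ∙ q ⊕ X (p ⊗ q)) x                                ≈⟨ evaluate-⊕ (a ∙ q) _ x ⟩
    evaluate (a ∙ q) x + evaluate (X (p ⊗ q)) x                   ≈⟨ +-cong (evaluate-∙ a q x) (trans (evaluate-X (p ⊗ q) x) (*-congˡ (evaluate-⊗ p q x))) ⟩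
    ι a * evaluate q x + x * (evaluate p x * evaluate q x)
      ≈⟨ solve 4 (λ a q x p → a :* q :+ x :* (p :* q) := (a :+ x :* p) :* q) refl _ _ _ _ ⟩
    (ι a + x * evaluate p x) * evaluate q x                       ∎

  evaluate-⊖ : ∀ p x → evaluate (⊖ p) x ≈ - evaluate p x
  evaluate-⊖ p x = begin
    evaluate (⊖ p) x                                    ≈⟨ solve 2 (λ m p → m := (p :+ m) :- p) refl _ (evaluate p x) ⟩
    evaluate p x + evaluate (⊖ p) x - evaluate p x      ≈⟨ +-congʳ (evaluate-⊕ p (⊖ p) x) ⟨
    evaluate (p ⊝ p) x - evaluate p x                   ≈⟨ +-congʳ (evaluate-zero x (ᴾ.-‿inverseʳ p)) ⟩
    0# - evaluate p x                                   ≈⟨ +-identityˡ _ ⟩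
    - evaluate p x                                      ∎

  -- The product rule for `a + X p`, taken at a point. In this form the Leibniz and chain rules are
  -- structural inductions; `evaluate-derivative` links it to the formal `derivative`, in whose
  -- terms separability is defined.
  derivativeAt : Poly → Carrier → Carrier
  derivativeAt []      x = 0#
  derivativeAt (a ∷ p) x = evaluate p x + x * derivativeAt p x

  derivativeAt-zero : ∀ {p} x → p ≋ [] → derivativeAt p x ≈ 0#
  derivativeAt-zero {[]}    x e = refl
  derivativeAt-zero {a ∷ p} x e = begin
    evaluate p x + x * derivativeAt p x   ≈⟨ +-cong (evaluate-zero x e′) (*-congˡ (derivativeAt-zero x e′)) ⟩
    0# + x * 0#                           ≈⟨ trans (+-identityˡ _) (zeroʳ x) ⟩
    0#                                    ∎
    where
    e′ : p ≋ []
    e′ = coefficients λ n → coefficient e (suc n)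

  derivativeAt-cong : ∀ {p q} x → p ≋ q → derivativeAt p x ≈ derivativeAt q x
  derivativeAt-cong {[]}    {q}     x e = sym (derivativeAt-zero x (≋-sym e))
  derivativeAt-cong {a ∷ p} {[]}    x e = derivativeAt-zero {a ∷ p} x e
  derivativeAt-cong {a ∷ p} {b ∷ q} x e =
    +-cong (evaluate-cong x (tail-≋ e)) (*-congˡ (derivativeAt-cong x (tail-≋ e)))

  derivativeAt-const : ∀ a x → derivativeAt (const a) x ≈ 0#
  derivativeAt-const a x = trans (+-identityˡ _) (zeroʳ x)

  derivativeAt-⊕ : ∀ p q x → derivativeAt (p ⊕ q) x ≈ derivativeAt p x + derivativeAt q x
  derivativeAt-⊕ []      q       x = trans (derivativeAt-cong x (ᴾ.+-identityˡ q)) (sym (+-identityˡ _))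
  derivativeAt-⊕ (a ∷ p) []      x = trans (derivativeAt-cong x (ᴾ.+-identityʳ (a ∷ p))) (sym (+-identityʳ _))
  derivativeAt-⊕ (a ∷ p) (b ∷ q) x = begin
    derivativeAt ((a ∷ p) ⊕ (b ∷ q)) x                  ≈⟨ derivativeAt-cong x (∷-⊕-∷ a p b q) ⟩
    evaluate (p ⊕ q) x + x * derivativeAt (p ⊕ q) x     ≈⟨ +-cong (evaluate-⊕ p q x) (*-congˡ (derivativeAt-⊕ p q x)) ⟩
    (evaluate p x + evaluate q x) + x * (derivativeAt p x + derivativeAt q x)
      ≈⟨ solve 5 (λ a b x p q → (a :+ b) :+ x :* (p :+ q) := (a :+ x :* p) :+ (b :+ x :* q)) refl _ _ _ _ _ ⟩
    (evaluate p x + x * derivativeAt p x) + (evaluate q x + x * derivativeAt q x)     ∎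

  derivativeAt-∙ : ∀ a p x → derivativeAt (a ∙ p) x ≈ ι a * derivativeAt p x
  derivativeAt-∙ a []      x = trans (derivativeAt-zero x (∙-[] a)) (sym (zeroʳ _))
  derivativeAt-∙ a (b ∷ p) x = begin
    derivativeAt (a ∙ (b ∷ p)) x                          ≈⟨ derivativeAt-cong x (∙-∷ a b p) ⟩
    evaluate (a ∙ p) x + x * derivativeAt (a ∙ p) x       ≈⟨ +-cong (evaluate-∙ a p x) (*-congˡ (derivativeAt-∙ a p x)) ⟩
    ι a * evaluate p x + x * (ι a * derivativeAt p x)     ≈⟨ solve 4 (λ a b x p → a :* b :+ x :* (a :* p) := a :* (b :+ x :* p)) refl _ _ _ _ ⟩
    ι a * (evaluate p x + x * derivativeAt p x)           ∎

  derivativeAt-⊗ : ∀ p q x →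
    derivativeAt (p ⊗ q) x ≈ derivativeAt p x * evaluate q x + evaluate p x * derivativeAt q x
  derivativeAt-⊗ []      q x = trans (derivativeAt-cong x ([]-⊗ q))
    (sym (trans (+-cong (zeroˡ _) (zeroˡ _)) (+-identityˡ 0#)))
  derivativeAt-⊗ (a ∷ p) q x = begin
    derivativeAt ((a ∷ p) ⊗ q) x                                  ≈⟨ derivativeAt-cong x (∷-⊗ a p q) ⟩
    derivativeAt (a ∙ q ⊕ X (p ⊗ q)) x                            ≈⟨ derivativeAt-⊕ (a ∙ q) _ x ⟩
    derivativeAt (a ∙ q) x + (evaluate (p ⊗ q) x + x * derivativeAt (p ⊗ q) x)
      ≈⟨ +-cong (derivativeAt-∙ a q x) (+-cong (evaluate-⊗ p q x) (*-congˡ (derivativeAt-⊗ p q x))) ⟩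
    ι a * derivativeAt q x + (evaluate p x * evaluate q x +
      x * (derivativeAt p x * evaluate q x + evaluate p x * derivativeAt q x))
      ≈⟨ solve 6 (λ a x p p′ q q′ → a :* q′ :+ (p :* q :+ x :* (p′ :* q :+ p :* q′)) :=
           (p :+ x :* p′) :* q :+ (a :+ x :* p) :* q′) refl _ _ _ _ _ _ ⟩
    (evaluate p x + x * derivativeAt p x) * evaluate q x + (ι a + x * evaluate p x) * derivativeAt q x  ∎

  private
    ·-homo : ∀ n a → ι (n R.· a) ≈ n · ι a
    ·-homo zero    a = 0#-homo
    ·-homo (suc n) a = trans (+-homo a _) (+-congˡ (·-homo n a))

    weight-suc : ∀ n p x → evaluate (weight (suc n) p) x ≈ evaluate p x + evaluate (weight n p) x
    weight-suc n []      x = sym (+-identityˡ 0#)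
    weight-suc n (a ∷ p) x = begin
      ι (a R.+ n R.· a) + x * evaluate (weight (suc (suc n)) p) x    ≈⟨ +-cong (+-homo a _) (*-congˡ (weight-suc (suc n) p x)) ⟩
      (ι a + ι (n R.· a)) + x * (evaluate p x + evaluate (weight (suc n) p) x)
        ≈⟨ solve 5 (λ a b x p q → (a :+ b) :+ x :* (p :+ q) := (a :+ x :* p) :+ (b :+ x :* q)) refl _ _ _ _ _ ⟩
      evaluate (a ∷ p) x + evaluate (weight n (a ∷ p)) x             ∎

    evaluate-weight : ∀ p x → evaluate (weight 1 p) x ≈ evaluate p x + x * derivativeAt p x
    evaluate-weight []      x = sym (trans (+-identityˡ _) (zeroʳ x))
    evaluate-weight (a ∷ p) x = trans (weight-suc 0 (a ∷ p) x)
      (+-congˡ (trans (+-congʳ 0#-homo) (trans (+-identityˡ _) (*-congˡ (evaluate-weight p x)))))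

  evaluate-derivative : ∀ p x → evaluate (derivative p) x ≈ derivativeAt p x
  evaluate-derivative []      x = refl
  evaluate-derivative (a ∷ p) x = evaluate-weight p x

  compose : Poly → Poly → Poly
  compose []      g = []
  compose (a ∷ h) g = const a ⊕ g ⊗ compose h g

  evaluate-compose : ∀ h g x → evaluate (compose h g) x ≈ evaluate h (evaluate g x)
  evaluate-compose []      g x = refl
  evaluate-compose (a ∷ h) g x = trans (evaluate-⊕ (const a) _ x)
    (+-cong (evaluate-const a x) (trans (evaluate-⊗ g _ x) (*-congˡ (evaluate-compose h g x))))

  derivativeAt-compose : ∀ h g x →
    derivativeAt (compose h g) x ≈ derivativeAt h (evaluate g x) * derivativeAt g x
  derivativeAt-compose []      g x = sym (zeroˡ _)
  derivativeAt-compose (a ∷ h) g x = begin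
    derivativeAt (const a ⊕ g ⊗ compose h g) x                     ≈⟨ derivativeAt-⊕ (const a) _ x ⟩
    derivativeAt (const a) x + derivativeAt (g ⊗ compose h g) x    ≈⟨ +-cong (derivativeAt-const a x) (derivativeAt-⊗ g _ x) ⟩
    0# + (derivativeAt g x * evaluate (compose h g) x + evaluate g x * derivativeAt (compose h g) x)
      ≈⟨ +-congˡ (+-cong (*-congˡ (evaluate-compose h g x)) (*-congˡ (derivativeAt-compose h g x))) ⟩
    0# + (derivativeAt g x * evaluate h (evaluate g x) + evaluate g x * (derivativeAt h (evaluate g x) * derivativeAt g x))
      ≈⟨ +-identityˡ _ ⟩
    derivativeAt g x * evaluate h (evaluate g x) + evaluate g x * (derivativeAt h (evaluate g x) * derivativeAt g x)
      ≈⟨ solve 4 (λ g g′ h h′ → g′ :* h :+ g :* (h′ :* g′) := (h :+ g :* h′) :* g′) refl _ _ _ _ ⟩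
    (evaluate h (evaluate g x) + evaluate g x * derivativeAt h (evaluate g x)) * derivativeAt g x  ∎

  power : Poly → ℕ → Poly
  power f zero    = const R.1#
  power f (suc k) = f ⊗ power f k

  -- The power rule cleared of the exponent `k - 1`: after multiplication by `f` it covers `k = 0`
  -- too, and as a statement on logarithmic derivatives it is what the tame witness needs.
  derivativeAt-power : ∀ f k x →
    evaluate f x * derivativeAt (power f k) x ≈ (k · 1#) * (evaluate (power f k) x * derivativeAt f x)
  derivativeAt-power f zero    x = trans (*-congˡ (derivativeAt-const R.1# x)) (trans (zeroʳ _) (sym (zeroˡ _)))
  derivativeAt-power f (suc k) x = begin
    evaluate f x * derivativeAt (f ⊗ power f k) x           ≈⟨ *-congˡ (derivativeAt-⊗ f _ x) ⟩
    evaluate f x * (derivativeAt f x * evaluate (power f k) x + evaluate f x * derivativeAt (power f k) x)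
      ≈⟨ *-congˡ (+-congˡ (derivativeAt-power f k x)) ⟩
    evaluate f x * (derivativeAt f x * evaluate (power f k) x + (k · 1#) * (evaluate (power f k) x * derivativeAt f x))
      ≈⟨ solve 5 (λ f f′ p k i → f :* (f′ :* p :+ k :* (p :* f′)) := f :* p :* f′ :+ k :* ((f :* p) :* f′)) refl (evaluate f x) _ _ _ 1# ⟩
    evaluate f x * evaluate (power f k) x * derivativeAt f x + (k · 1#) * ((evaluate f x * evaluate (power f k) x) * derivativeAt f x)
      ≈⟨ +-cong (*-identityˡ _) refl ⟨
    1# * (evaluate f x * evaluate (power f k) x * derivativeAt f x) + (k · 1#) * ((evaluate f x * evaluate (power f k) x) * derivativeAt f x)
      ≈⟨ distribʳ _ 1# (k · 1#) ⟨
    (1# + k · 1#) * (evaluate f x * evaluate (power f k) x * derivativeAt f x)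
      ≈⟨ *-congˡ (*-congʳ (evaluate-⊗ f _ x)) ⟨
    (suc k · 1#) * (evaluate (f ⊗ power f k) x * derivativeAt f x)  ∎

  evaluate-isHom : ∀ x → IsRingHomomorphism polynomialRing (CommutativeRing.rawRing S) (λ p → evaluate p x)
  evaluate-isHom x = record
    { isSemiringHomomorphism = record
      { isNearSemiringHomomorphism = record
        { +-isMonoidHomomorphism = record
          { isMagmaHomomorphism = record
            { isRelHomomorphism = record { cong = λ {p} {q} e → evaluate-cong {p} {q} x (coefficients e) }
            ; homo = λ p q → trans (reflexive (≡.cong (λ f → evaluate f x) (≡.sym (⊕-≡ p q)))) (evaluate-⊕ p q x) }
          ; ε-homo = refl }
        ; *-homo = λ p q → trans (reflexive (≡.cong (λ f → evaluate f x) (≡.sym (⊗-≡ p q)))) (evaluate-⊗ p q x) }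
      ; 1#-homo = trans (evaluate-const R.1# x) 1#-homo }
    ; -‿homo = λ p → trans (reflexive (≡.cong (λ f → evaluate f x) (≡.sym (⊖-≡ p)))) (evaluate-⊖ p x) }

-- The ordered group extended by ∞

module ExtendedProperties (Γ : OrderedAbelianGroup u) where

  private module Γ where
    open OrderedAbelianGroup Γ public hiding (_-_)
    open AbelianGroupProperties (OrderedAbelianGroup.abelianGroup Γ) public
    open IsAbelianGroup isAbelianGroup public using (assoc; identityʳ; inverseʳ; ∙-cong; ∙-congˡ; ∙-congʳ)
  open Γ using (_+_; -_; 0#)
  open Extended Γ
  open NonStrict⁺ Γ._≤_ using (_≤⊤⁺) renaming ([_] to [_]≤) public
  open Strict⁺ (Extended._<_ Γ) using ([_]<⊤⁺) renaming ([_] to [_]<) public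
  open Equality⁺ Γ._≈_ using (⊤⁺≈⊤⁺) renaming ([_] to [_]≈) public
  open Min ⁺.totalOrder public using (x⊓y≤x; x⊓y≤y; ⊓-glb; ⊓-cong; ⊓-sel)

  ≰⇒> : ∀ {x y} → ¬ (y ≤⁺ x) → x <⁺ y
  ≰⇒> {just a}  {nothing} ¬p = [ a ]<⊤⁺
  ≰⇒> {nothing} {y}       ¬p = contradiction (y ≤⊤⁺) ¬p
  ≰⇒> {just a}  {just b}  ¬p with Γ.total a b
  ... | inj₁ a≤b = [ a≤b , (λ a≈b → ¬p [ Γ.reflexive (Γ.Eq.sym a≈b) ]≤) ]<
  ... | inj₂ b≤a = contradiction [ b≤a ]≤ ¬p

  <⇒≱ : ∀ {x y} → x <⁺ y → ¬ (y ≤⁺ x)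
  <⇒≱ [ a≤b , a≉b ]< [ b≤a ]≤ = a≉b (Γ.antisym a≤b b≤a)

  <⇒≤ : ∀ {x y} → x <⁺ y → x ≤⁺ y
  <⇒≤ [ a≤b , _ ]< = [ a≤b ]≤
  <⇒≤ [ a ]<⊤⁺     = just a ≤⊤⁺

  ≮⇒≥ : ∀ {x y} → ¬ (x <⁺ y) → y ≤⁺ x
  ≮⇒≥ {x} {y} ¬p with ⁺.total y x
  ... | inj₁ y≤x = y≤x
  ... | inj₂ x≤y with y ⁺.≤? x
  ...   | yes y≤x = y≤x
  ...   | no y≰x  = contradiction (≰⇒> y≰x) ¬p

  ≤-<-trans : ∀ {x y z} → x ≤⁺ y → y <⁺ z → x <⁺ z
  ≤-<-trans x≤y y<z = ≰⇒> λ z≤x → <⇒≱ y<z (⁺.trans z≤x x≤y)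

  <-≤-trans : ∀ {x y z} → x <⁺ y → y ≤⁺ z → x <⁺ z
  <-≤-trans x<y y≤z = ≰⇒> λ z≤x → <⇒≱ x<y (⁺.trans y≤z z≤x)

  <-trans : ∀ {x y z} → x <⁺ y → y <⁺ z → x <⁺ z
  <-trans x<y y<z = <-≤-trans x<y (<⇒≤ y<z)

  <-irrefl : ∀ {x y} → x ≈⁺ y → ¬ (x <⁺ y)
  <-irrefl x≈y x<y = <⇒≱ x<y (⁺.reflexive (⁺.Eq.sym x≈y))

  <-resp-≈ : (∀ {x y z} → y ≈⁺ z → x <⁺ y → x <⁺ z) × (∀ {x y z} → y ≈⁺ z → y <⁺ x → z <⁺ x)
  <-resp-≈ = (λ y≈z x<y → <-≤-trans x<y (⁺.reflexive y≈z))
           , (λ y≈z y<x → ≤-<-trans (⁺.reflexive (⁺.Eq.sym y≈z)) y<x)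

  ≤∧≉⇒< : ∀ {x y} → x ≤⁺ y → ¬ (x ≈⁺ y) → x <⁺ y
  ≤∧≉⇒< x≤y x≉y = ≰⇒> λ y≤x → x≉y (⁺.antisym x≤y y≤x)

  module ⁺-Reasoning = Triple ⁺.isPreorder (λ x<y y<x → <⇒≱ x<y (<⇒≤ y<x)) <-trans <-resp-≈
    <⇒≤ <-≤-trans ≤-<-trans

  Finite : Γ⁺ → Set u
  Finite x = ∃ λ a → x ≈⁺ just a

  <⇒finite : ∀ {x y} → x <⁺ y → Finite x
  <⇒finite {just a} _ = a , ⁺.Eq.refl

  ≤-finite : ∀ {x y} → x ≤⁺ y → Finite y → Finite x
  ≤-finite {just a}  p          (b , e) = a , ⁺.Eq.refl
  ≤-finite {nothing} (_ ≤⊤⁺)    (b , ())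

  ≈-finite : ∀ {x y} → x ≈⁺ y → Finite y → Finite x
  ≈-finite p (a , e) = a , ⁺.Eq.trans p e

  infinite : ∀ {x} → ¬ Finite x → x ≈⁺ ⊤⁺
  infinite {just a}  ¬f = contradiction (a , ⁺.Eq.refl) ¬f
  infinite {nothing} ¬f = ⊤⁺≈⊤⁺

  finite⇒<⊤ : ∀ {x} → Finite x → x <⁺ ⊤⁺
  finite⇒<⊤ (a , e) = ≤-<-trans (⁺.reflexive e) [ a ]<⊤⁺

  ≤⊤ : ∀ {x} → x ≤⁺ ⊤⁺
  ≤⊤ = _ ≤⊤⁺

  +⁺-commutativeMonoid : CommutativeMonoid u u
  +⁺-commutativeMonoid = record
    { Carrier = Γ⁺ ; _≈_ = _≈⁺_ ; _∙_ = _+⁺_ ; ε = just 0#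
    ; isCommutativeMonoid = record
      { isMonoid = record
        { isSemigroup = record
          { isMagma = record { isEquivalence = ⁺.isEquivalence ; ∙-cong = cong }
          ; assoc = assoc }
        ; identity = identity , λ x → ⁺.Eq.trans (comm x _) (identity x) }
      ; comm = comm } }
    where
    cong : ∀ {x y z w} → x ≈⁺ y → z ≈⁺ w → x +⁺ z ≈⁺ y +⁺ w
    cong [ p ]≈ [ q ]≈ = [ Γ.∙-cong p q ]≈
    cong [ p ]≈ ⊤⁺≈⊤⁺  = ⊤⁺≈⊤⁺
    cong ⊤⁺≈⊤⁺  q      = ⊤⁺≈⊤⁺
    comm : ∀ x y → x +⁺ y ≈⁺ y +⁺ x
    comm (just a) (just b) = [ Γ.comm a b ]≈
    comm (just a) nothing  = ⊤⁺≈⊤⁺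
    comm nothing  (just b) = ⊤⁺≈⊤⁺
    comm nothing  nothing  = ⊤⁺≈⊤⁺
    assoc : ∀ x y z → (x +⁺ y) +⁺ z ≈⁺ x +⁺ (y +⁺ z)
    assoc (just a) (just b) (just c) = [ Γ.assoc a b c ]≈
    assoc (just a) (just b) nothing  = ⊤⁺≈⊤⁺
    assoc (just a) nothing  z        = ⊤⁺≈⊤⁺
    assoc nothing  y        z        = ⊤⁺≈⊤⁺
    identity : ∀ x → just 0# +⁺ x ≈⁺ x
    identity (just a) = [ Γ.identityˡ a ]≈
    identity nothing  = ⊤⁺≈⊤⁺

  open CommutativeMonoid +⁺-commutativeMonoid public using ()
    renaming (∙-cong to +⁺-cong; ∙-congˡ to +⁺-congˡ; ∙-congʳ to +⁺-congʳ; comm to +⁺-comm; assoc to +⁺-assoc;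
              identityˡ to +⁺-identityˡ; identityʳ to +⁺-identityʳ)

  +⁺-⊤ : ∀ x → x +⁺ ⊤⁺ ≈⁺ ⊤⁺
  +⁺-⊤ (just a) = ⊤⁺≈⊤⁺
  +⁺-⊤ nothing  = ⊤⁺≈⊤⁺

  +⁺-mono : ∀ {x y z w} → x ≤⁺ y → z ≤⁺ w → x +⁺ z ≤⁺ y +⁺ w
  +⁺-mono {y = just _}  {w = just _}  [ p ]≤ [ q ]≤ = [ +-mono-≤ p q ]≤
  +⁺-mono {y = just _}  {w = nothing} p q = ≤⊤
  +⁺-mono {y = nothing}               p q = ≤⊤

  +⁺-monoˡ : ∀ {x y} z → x ≤⁺ y → x +⁺ z ≤⁺ y +⁺ z
  +⁺-monoˡ z p = +⁺-mono p ⁺.refl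

  +⁺-monoʳ : ∀ {x y} z → x ≤⁺ y → z +⁺ x ≤⁺ z +⁺ y
  +⁺-monoʳ z p = +⁺-mono (⁺.refl {z}) p

  finite-+ : ∀ {x y} → Finite x → Finite y → Finite (x +⁺ y)
  finite-+ (a , p) (b , q) = a + b , +⁺-cong p q

  finite-+ˡ : ∀ {x y} → Finite (x +⁺ y) → Finite x
  finite-+ˡ {just a}  {y} (b , e) = a , ⁺.Eq.refl

  finite-+ʳ : ∀ {x y} → Finite (x +⁺ y) → Finite y
  finite-+ʳ {x} {y} f = finite-+ˡ {y} {x} (≈-finite (+⁺-comm y x) f)

  +⁺-cancelʳ : ∀ {x y z} → Finite z → x +⁺ z ≤⁺ y +⁺ z → x ≤⁺ y
  +⁺-cancelʳ {x} {y} {z} (c , e) p = begin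
    x                       ≈⟨ back x ⟨
    (x +⁺ z) +⁺ just (- c)  ≤⟨ +⁺-monoˡ _ p ⟩
    (y +⁺ z) +⁺ just (- c)  ≈⟨ back y ⟩
    y                       ∎
    where
    open ⁺-Reasoning
    back : ∀ x → (x +⁺ z) +⁺ just (- c) ≈⁺ x
    back x = ⁺.Eq.trans (+⁺-assoc x z _) (⁺.Eq.trans
      (+⁺-congˡ {x} (⁺.Eq.trans (+⁺-congʳ e) [ Γ.inverseʳ c ]≈)) (+⁺-identityʳ x))

  +⁺-cancelʳ-≈ : ∀ {x y z} → Finite z → x +⁺ z ≈⁺ y +⁺ z → x ≈⁺ y
  +⁺-cancelʳ-≈ f p = ⁺.antisym (+⁺-cancelʳ f (⁺.reflexive p)) (+⁺-cancelʳ f (⁺.reflexive (⁺.Eq.sym p)))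

  +⁺-monoˡ-< : ∀ {x y z} → Finite z → x <⁺ y → x +⁺ z <⁺ y +⁺ z
  +⁺-monoˡ-< f x<y = ≰⇒> (<⇒≱ x<y ∘ +⁺-cancelʳ f)

  +⁺-monoʳ-< : ∀ {x y z} → Finite z → x <⁺ y → z +⁺ x <⁺ z +⁺ y
  +⁺-monoʳ-< {x} {y} {z} f x<y = proj₁ <-resp-≈ (+⁺-comm y z) (proj₂ <-resp-≈ (+⁺-comm x z) (+⁺-monoˡ-< f x<y))

  +⁺-mono-<-≤ : ∀ {x y z w} → Finite z → x <⁺ y → z ≤⁺ w → x +⁺ z <⁺ y +⁺ w
  +⁺-mono-<-≤ {y = y} f x<y z≤w = <-≤-trans (+⁺-monoˡ-< f x<y) (+⁺-monoʳ y z≤w)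

  +⁺-mono-≤-< : ∀ {x y z w} → Finite x → x ≤⁺ y → z <⁺ w → x +⁺ z <⁺ y +⁺ w
  +⁺-mono-≤-< {w = w} f x≤y z<w = <-≤-trans (+⁺-monoʳ-< f z<w) (+⁺-monoˡ w x≤y)

  -- An infinite `x` has to be allowed, as quotients may vanish at a point; strictness then comes
  -- from the finiteness of `t` and not from the step from `y` to `y′`.
  +⁺-<-jump : ∀ {t x x′ y y′} → Finite t → t ≤⁺ x +⁺ y → x ≤⁺ x′ → y <⁺ y′ → t <⁺ x′ +⁺ y′
  +⁺-<-jump {x = just a}          t-finite t≤ x≤x′ y<y′ = ≤-<-trans t≤ (+⁺-mono-≤-< (a , ⁺.Eq.refl) x≤x′ y<y′)
  +⁺-<-jump {x = nothing} {y′ = y′} t-finite t≤ x≤x′ y<y′ = <-≤-trans (finite⇒<⊤ t-finite) (+⁺-monoˡ y′ x≤x′)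

  -- Lower bounds of two summands whose sum does not exceed the sum of the bounds leave no slack in
  -- either. This is how the exact value of a product fixes the value of each factor.
  +⁺-≤-split : ∀ {x y z w} → Finite (z +⁺ w) → x ≤⁺ z → y ≤⁺ w → z +⁺ w ≤⁺ x +⁺ y → (z ≤⁺ x) × (w ≤⁺ y)
  +⁺-≤-split {x} {y} {z} {w} f x≤z y≤w p =
    +⁺-cancelʳ (finite-+ʳ {z} f) (⁺.trans p (+⁺-monoʳ x y≤w)) ,
    +⁺-cancelʳ (finite-+ˡ {z} f) (⁺.trans (⁺.reflexive (+⁺-comm w z)) (⁺.trans p (⁺.trans (+⁺-monoˡ y x≤z) (⁺.reflexive (+⁺-comm z y)))))

  ≤-+⁺-⊓ : ∀ {t} z {x y} → t ≤⁺ x +⁺ z → t ≤⁺ y +⁺ z → t ≤⁺ (x ⊓ y) +⁺ z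
  ≤-+⁺-⊓ z {x} {y} p q with ⊓-sel x y
  ... | inj₁ e = ⁺.trans p (⁺.reflexive (+⁺-congʳ {z} (⁺.Eq.sym e)))
  ... | inj₂ e = ⁺.trans q (⁺.reflexive (+⁺-congʳ {z} (⁺.Eq.sym e)))

  <-+⁺-⊓ : ∀ {t} z {x y} → t <⁺ x +⁺ z → t <⁺ y +⁺ z → t <⁺ (x ⊓ y) +⁺ z
  <-+⁺-⊓ z {x} {y} p q with ⊓-sel x y
  ... | inj₁ e = <-≤-trans p (⁺.reflexive (+⁺-congʳ {z} (⁺.Eq.sym e)))
  ... | inj₂ e = <-≤-trans q (⁺.reflexive (+⁺-congʳ {z} (⁺.Eq.sym e)))

  -- An ordered group has no 2-torsion. Applied to `-1`, whose square is 1, this makes a valuation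
  -- insensitive to signs.
  double-zero : ∀ {x} → x +⁺ x ≈⁺ just 0# → x ≈⁺ just 0#
  double-zero {x} p = ⁺.antisym
    (+⁺-cancelʳ f (begin
      x +⁺ x         ≈⟨ p ⟩
      just 0#        ≤⟨ halve-nonneg x p ⟩
      x              ≈⟨ +⁺-identityˡ x ⟨
      just 0# +⁺ x   ∎))
    (halve-nonneg x p)
    where
    open ⁺-Reasoning
    f : Finite x
    f = finite-+ˡ {x} (0# , p)

-- Valuations of a commutative ring

module ValuationProperties (Γ : OrderedAbelianGroup u) (R : CommutativeRing u u)
  (w : Valuations.Valuation Γ (CommutativeRing.rawRing R)) where

  open CommutativeRing R hiding (ring; rawRing)
  open RingProperties (CommutativeRing.ring R) using (-1*x≈-x; -‿involutive)
  open OrderedAbelianGroup Γ using () renaming (0# to 0ᴳ)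
  open Extended Γ
  open ExtendedProperties Γ
  open Valuations.Valuation w renaming (cong to val-cong) public

  val-neg : ∀ x → val (- x) ≈⁺ val x
  val-neg x = begin-equality
    val (- x)               ≈⟨ val-cong (-1*x≈-x x) ⟨
    val (- 1# * x)          ≈⟨ *-homo _ x ⟩
    val (- 1#) +⁺ val x     ≈⟨ +⁺-congʳ (double-zero (⁺.Eq.trans (⁺.Eq.sym (*-homo _ _))
                                 (⁺.Eq.trans (val-cong (trans (-1*x≈-x _) (-‿involutive 1#))) one-0))) ⟩
    just 0ᴳ +⁺ val x        ≈⟨ +⁺-identityˡ _ ⟩
    val x                   ∎
    where open ⁺-Reasoning

  ≤-val-+ : ∀ {z x y} → z ≤⁺ val x → z ≤⁺ val y → z ≤⁺ val (x + y)
  ≤-val-+ p q = ⁺.trans (⊓-glb p q) (+-min _ _)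

  ≤-val-sub : ∀ {z x y} → z ≤⁺ val x → z ≤⁺ val y → z ≤⁺ val (x - y)
  ≤-val-sub {y = y} p q = ≤-val-+ p (⁺.trans q (⁺.reflexive (⁺.Eq.sym (val-neg y))))

  ≤-val-+⁺ : ∀ {t x y} z → t ≤⁺ val x +⁺ z → t ≤⁺ val y +⁺ z → t ≤⁺ val (x + y) +⁺ z
  ≤-val-+⁺ z p q = ⁺.trans (≤-+⁺-⊓ z p q) (+⁺-monoˡ z (+-min _ _))

  <-val-+⁺ : ∀ {t x y} z → t <⁺ val x +⁺ z → t <⁺ val y +⁺ z → t <⁺ val (x + y) +⁺ z
  <-val-+⁺ z p q = <-≤-trans (<-+⁺-⊓ z p q) (+⁺-monoˡ z (+-min _ _))

  <-val-+ : ∀ {z x y} → z <⁺ val x → z <⁺ val y → z <⁺ val (x + y)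
  <-val-+ {z} {x} {y} p q with ⁺.total (val x) (val y)
  ... | inj₁ x≤y = <-≤-trans p (≤-val-+ ⁺.refl x≤y)
  ... | inj₂ y≤x = <-≤-trans q (≤-val-+ y≤x ⁺.refl)

  <-val-sub : ∀ {z x y} → z <⁺ val x → z <⁺ val y → z <⁺ val (x - y)
  <-val-sub {y = y} p q = <-val-+ p (<-≤-trans q (⁺.reflexive (⁺.Eq.sym (val-neg y))))

  val-+-dominant : ∀ {x y} → val x <⁺ val y → val (x + y) ≈⁺ val x
  val-+-dominant {x} {y} x<y = ⁺.antisym
    (≮⇒≥ λ x<x+y → <-irrefl (val-cong (begin
      x              ≈⟨ +-identityʳ x ⟨
      x + 0#         ≈⟨ +-congˡ (-‿inverseʳ y) ⟨
      x + (y - y)    ≈⟨ +-assoc x y _ ⟨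
      (x + y) - y    ∎)) (<-val-sub x<x+y x<y))
    (≤-val-+ ⁺.refl (<⇒≤ x<y))
    where open import Relation.Binary.Reasoning.Setoid setoid

  val-*-finite : ∀ {x y} → Finite (val (x * y)) → Finite (val x)
  val-*-finite f = finite-+ˡ (≈-finite (⁺.Eq.sym (*-homo _ _)) f)

  val-swap : ∀ x y → val (x - y) ≈⁺ val (y - x)
  val-swap x y = ⁺.Eq.trans (⁺.Eq.sym (val-neg (x - y)))
    (val-cong (solve 2 (λ x y → :- (x :- y) := y :- x) refl x y))
    where open IntegralSolver R

-- Classical logic and least numbers

module Classical (em : ∀ {ℓ} → ExcludedMiddle ℓ) where

  dne : ∀ {ℓ} {P : Set ℓ} → ¬ ¬ P → P
  dne = decidable-stable em

  ¬∀⇒∃¬ : ∀ {a ℓ} {A : Set a} {P : A → Set ℓ} → ¬ (∀ x → P x) → ∃ λ x → ¬ P x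
  ¬∀⇒∃¬ ¬∀ = dne λ ¬∃ → ¬∀ λ x → dne λ ¬P → ¬∃ (x , ¬P)

  opaque
    least : ∀ {ℓ} (P : ℕ → Set ℓ) → ∃ P → ∃ λ n → P n × (∀ m → m ℕ.< n → ¬ P m)
    least P (n , p) = <-rec (λ n → P n → ∃ λ n → P n × (∀ m → m ℕ.< n → ¬ P m)) step n p
      where
      step : ∀ n → (∀ {m} → m ℕ.< n → P m → ∃ λ n → P n × (∀ m → m ℕ.< n → ¬ P m)) →
             P n → ∃ λ n → P n × (∀ m → m ℕ.< n → ¬ P m)
      step n rec p with em {P = ∃ λ m → m ℕ.< n × P m}
      ... | yes (m , m<n , q) = rec m<n q
      ... | no  ¬q            = n , p , λ m m<n q → ¬q (m , m<n , q)

-- Polynomials over a field: divisibility and Bézout identities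

module FieldPolynomials (em : ∀ {ℓ} → ExcludedMiddle ℓ) (K : Field u) where

  private module F = HeytingField K
  open CommutativeRing (ring K) hiding (ring; rawRing)
  open RingProperties (CommutativeRing.ring (ring K)) using (-0#≈0#)
  open PolynomialRing (ring K)
  open Classical em
  open import Relation.Binary.Reasoning.Setoid setoid

  1≉0 : ¬ (1# ≈ 0#)
  1≉0 = λ e → F.#-irrefl e (F.invertible⇒# (1# , lemma , lemma′))
    where
    1-0≈1 : 1# - 0# ≈ 1#
    1-0≈1 = trans (+-congˡ -0#≈0#) (+-identityʳ 1#)
    lemma : 1# * (1# - 0#) ≈ 1#
    lemma = trans (*-identityˡ _) 1-0≈1
    lemma′ : (1# - 0#) * 1# ≈ 1#
    lemma′ = trans (*-identityʳ _) 1-0≈1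

  opaque
    inverse : ∀ {x} → ¬ (x ≈ 0#) → ∃ λ y → y * x ≈ 1#
    inverse {x} x≉0 with F.#⇒invertible (dne λ ¬x#0 → x≉0 (proj₁ (F.tight x 0#) ¬x#0))
    ... | y , e , _ = y , trans (*-congˡ (sym (trans (+-congˡ -0#≈0#) (+-identityʳ x)))) e

  zero-product : ∀ {x y} → x * y ≈ 0# → ¬ (x ≈ 0#) → y ≈ 0#
  zero-product {x} {y} e x≉0 with inverse x≉0
  ... | z , zx≈1 = begin
    y             ≈⟨ *-identityˡ y ⟨
    1# * y        ≈⟨ *-congʳ zx≈1 ⟨
    (z * x) * y   ≈⟨ *-assoc z x y ⟩
    z * (x * y)   ≈⟨ trans (*-congˡ e) (zeroʳ z) ⟩
    0#            ∎

  opaque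
    degreeOf : ∀ f → ¬ (f ≋ []) → ∃ λ d → ¬ (coeff f d ≈ 0#) × Below f (suc d)
    degreeOf []      f≄[] = contradiction ≋-refl f≄[]
    degreeOf (a ∷ f) f≄[] with em {P = f ≋ []}
    ... | no  f≄[]′ with degreeOf f f≄[]′
    ...   | d , c , b = suc d , c , below-∷ b
    degreeOf (a ∷ f) f≄[] | yes f≋[] =
      0 , (λ a≈0 → f≄[] (∷≋[] a≈0 f≋[])) , below-cong (∷-cong refl (≋-sym f≋[])) below-const

    normalise : ∀ {f n} → ¬ (f ≋ []) → Below f n →
                ∃₂ λ c d → ¬ (c ≈ 0#) × IsMonic (c ∙ f) d × d ℕ.< n
    normalise {f} {n} f≄[] f₀ with degreeOf f f≄[]
    ... | d , f_d≉0 , b with inverse f_d≉0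
    ...   | c , cf≈1 = c , d ,
      (λ c≈0 → 1≉0 (trans (sym cf≈1) (trans (*-congʳ c≈0) (zeroˡ _)))) ,
      monic (trans (coeff-∙ c f d) cf≈1) (below-∙ c b) ,
      ℕ.≰⇒> λ n≤d → f_d≉0 (isBelow f₀ d n≤d)

  monic≄[] : ∀ {f d} → IsMonic f d → ¬ (f ≋ [])
  monic≄[] {f} {d} (monic f₁ _) e = 1≉0 (trans (sym f₁) (coefficient e d))

  -- The leading coefficient of `s` survives multiplication by a monic polynomial, so a degree bound
  -- for the product is one for `s`.
  below-cancel : ∀ {φ d s n} → IsMonic φ d → Below (s ⊗ φ) (n ℕ.+ d) → Below s n
  below-cancel {φ} {d} {s} {n} (monic φ₁ φ₀) b with em {P = s ≋ []}
  ... | yes s≋[] = below-cong (≋-sym s≋[]) below-[]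
  ... | no  s≄[] with degreeOf s s≄[]
  ...   | j , s_j≉0 , s₀ = below-weaken (ℕ.≰⇒> λ n≤j → s_j≉0 (begin
    coeff s j                     ≈⟨ *-identityʳ _ ⟨
    coeff s j * 1#                ≈⟨ *-congˡ φ₁ ⟨
    coeff s j * coeff φ d         ≈⟨ top-⊗ s₀ φ₀ ⟨
    coeff (s ⊗ φ) (j ℕ.+ d)       ≈⟨ isBelow b _ (ℕ.+-monoˡ-≤ d n≤j) ⟩
    0#                            ∎)) s₀

  record GCD (f g : Poly) : Set u where
    field
      h s t b   : Poly
      k         : ℕ
      h-monic   : IsMonic h k
      combine   : h ≋ s ⊗ f ⊕ t ⊗ g
      g≋b⊗h     : g ≋ b ⊗ h

  opaque
    -- `h` is a monic combination of least degree. The remainder of `g` modulo `h` is again a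
    -- combination, so a nonzero one would, once normalised, have smaller degree. Competition with
    -- `f` itself gives `k ≤ d`.
    gcd : ∀ {f d} → IsMonic f d → ∀ g → Σ (GCD f g) λ G → GCD.k G ℕ.≤ d
    gcd {f} {d} f-monic g with least Combination (d , f , const 1# , [] , f-monic , f≋)
      where
      Combination : ℕ → Set u
      Combination k = ∃ λ h → ∃₂ λ s t → IsMonic h k × h ≋ s ⊗ f ⊕ t ⊗ g
      f≋ : f ≋ const 1# ⊗ f ⊕ [] ⊗ g
      f≋ = ≋-sym (≋-trans (ᴾ.+-cong (ᴾ.*-identityˡ f) ([]-⊗ g)) (ᴾ.+-identityʳ f))
    ... | k , (h , s , t , h-monic , e) , minimal = record
      { h-monic = h-monic ; combine = e ; g≋b⊗h = proj₂ divisible } ,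
      ℕ.≮⇒≥ λ d<k → minimal d d<k (f , const 1# , [] , f-monic , f≋)
      where
      f≋ : f ≋ const 1# ⊗ f ⊕ [] ⊗ g
      f≋ = ≋-sym (≋-trans (ᴾ.+-cong (ᴾ.*-identityˡ f) ([]-⊗ g)) (ᴾ.+-identityʳ f))
      divisible : ∃ λ b → g ≋ b ⊗ h
      divisible with divide h-monic g
      ... | q , r , g≋qh+r , r₀ with em {P = r ≋ []}
      ...   | yes r≋[] = q , ≋-trans g≋qh+r (≋-trans (ᴾ.+-congˡ r≋[]) (ᴾ.+-identityʳ _))
      ...   | no  r≄[] with normalise r≄[] r₀
      ...     | c , j , _ , cr-monic , j<k = contradiction
        (c ∙ r , const c ⊗ ⊖ (q ⊗ s) , const c ⊗ (const 1# ⊝ q ⊗ t) , cr-monic , cr≋) (minimal j j<k)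
        where
        r≋ : r ≋ g ⊝ q ⊗ (s ⊗ f ⊕ t ⊗ g)
        r≋ = ≋-trans (ᴾ.solve 2 (λ r qh → r ᴾ.:= (qh ᴾ.:+ r) ᴾ.:- qh) ≋-refl r (q ⊗ h))
          (ᴾ.+-cong (≋-sym g≋qh+r) (ᴾ.-‿cong (ᴾ.*-congˡ e)))
        cr≋ : c ∙ r ≋ const c ⊗ ⊖ (q ⊗ s) ⊗ f ⊕ const c ⊗ (const 1# ⊝ q ⊗ t) ⊗ g
        cr≋ = ≋-trans (≋-sym (const-⊗ c r)) (≋-trans (ᴾ.*-congˡ r≋)
          (ᴾ.solve 6 (λ c f g q s t → c ᴾ.:* (g ᴾ.:- q ᴾ.:* (s ᴾ.:* f ᴾ.:+ t ᴾ.:* g)) ᴾ.:=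
              c ᴾ.:* ᴾ.:- (q ᴾ.:* s) ᴾ.:* f ᴾ.:+ c ᴾ.:* (ᴾ.con (1 , 0) ᴾ.:- q ᴾ.:* t) ᴾ.:* g)
            ≋-refl (const c) f g q s t))

    -- A common divisor of positive degree is a proper factor of `φ`, because its degree is at most
    -- `D < d`. Otherwise `s` can be reduced modulo `φ`, and `t φ = 1 - s χ` bounds the degree of
    -- `t`. Apart from `φ`, either alternative involves only degrees below `d`, the range in which
    -- the valuations to be compared agree.
    bezout : ∀ {χ D φ d} → IsMonic χ D → IsMonic φ d → D ℕ.< d →
      (∃₂ λ b h → φ ≋ b ⊗ h × Below b d × Below h d) ⊎
      (∃₂ λ s t → s ⊗ χ ⊕ t ⊗ φ ≋ const 1# × Below s d × Below t d)
    bezout {χ} {D} {φ} {suc d} χ-monic φ-monic D<d with gcd χ-monic φ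
    ... | record { h = h ; b = b ; k = suc k ; h-monic = h-monic ; g≋b⊗h = φ≋ } , k≤D =
      inj₁ (b , h , φ≋ ,
        below-cancel h-monic (below-cong φ≋ (below-weaken (s≤s (ℕ.m<m+n d (s≤s z≤n))) (bounded φ-monic))) ,
        below-weaken (ℕ.≤-<-trans k≤D D<d) (bounded h-monic))
    ... | record { h = h ; s = s ; t = t ; k = zero ; h-monic = h-monic ; combine = e } , _
      with divide φ-monic s
    ...   | q , s′ , s≋ , s′₀ = inj₂ (s′ , t ⊕ q ⊗ χ , combined , s′₀ ,
        below-weaken (ℕ.<⇒≤ D<d) (below-cancel {n = D} φ-monic (below-cong tφ≋ (below-⊕ below-one (below-⊖ s′χ₀)))))
      where
      h≋1 : h ≋ const 1#
      h≋1 = ≋-trans (below-1⇒const (bounded h-monic)) (∷-cong (leading h-monic) ≋-refl)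
      combined : s′ ⊗ χ ⊕ (t ⊕ q ⊗ χ) ⊗ φ ≋ const 1#
      combined = ≋-trans (≋-trans
        (ᴾ.solve 5 (λ s′ χ t q φ → s′ ᴾ.:* χ ᴾ.:+ (t ᴾ.:+ q ᴾ.:* χ) ᴾ.:* φ ᴾ.:= (q ᴾ.:* φ ᴾ.:+ s′) ᴾ.:* χ ᴾ.:+ t ᴾ.:* φ)
          ≋-refl s′ χ t q φ)
        (ᴾ.+-congʳ (ᴾ.*-congʳ (≋-sym s≋)))) (≋-trans (≋-sym e) h≋1)
      tφ≋ : const 1# ⊝ s′ ⊗ χ ≋ (t ⊕ q ⊗ χ) ⊗ φ
      tφ≋ = ≋-trans (ᴾ.+-congʳ (≋-sym combined))
        (ᴾ.solve 2 (λ a b → (a ᴾ.:+ b) ᴾ.:- a ᴾ.:= b) ≋-refl (s′ ⊗ χ) ((t ⊕ q ⊗ χ) ⊗ φ))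
      below-one : Below (const 1#) (D ℕ.+ suc d)
      below-one = below-weaken (ℕ.≤-trans (s≤s z≤n) (ℕ.m≤n+m (suc d) D)) below-const
      s′χ₀ : Below (s′ ⊗ χ) (D ℕ.+ suc d)
      s′χ₀ = below-weaken (ℕ.≤-reflexive (≡.trans (≡.cong suc (ℕ.+-comm d D)) (≡.sym (ℕ.+-suc D d)))) (below-⊗ s′₀ (bounded χ-monic))

-- Splitting into linear factors

-- Products of linear factors are treated as functions of the point.
module LinearFactors (em : ∀ {ℓ} → ExcludedMiddle ℓ) (L : Field u) where

  open CommutativeRing (ring L) hiding (ring; rawRing)
  open PolynomialRing (ring L) hiding (_≈ᴾ_)
  open FieldPolynomials em L
  open Evaluation (ring L) (ring L) (Identity.isRingHomomorphism (CommutativeRing.rawRing (ring L)) refl) public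
  open IntegralSolver (ring L)
  open import Relation.Binary.Reasoning.Setoid setoid

  productAt : List Carrier → Carrier → Carrier
  productAt []       z = 1#
  productAt (b ∷ bs) z = (z - b) * productAt bs z

  productDerivativeAt : List Carrier → Carrier → Carrier
  productDerivativeAt []       z = 0#
  productDerivativeAt (b ∷ bs) z = productAt bs z + (z - b) * productDerivativeAt bs z

  productAt-root : ∀ {b} bs → Any (b ≈_) bs → productAt bs b ≈ 0#
  productAt-root (c ∷ bs) (here b≈c) = trans (*-congʳ (trans (+-congʳ b≈c) (-‿inverseʳ c))) (zeroˡ _)
  productAt-root (c ∷ bs) (there i)  = trans (*-congˡ (productAt-root bs i)) (zeroʳ _)

  root∈ : ∀ {b} bs → productAt bs b ≈ 0# → Any (b ≈_) bs
  root∈ []       e = contradiction e 1≉0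
  root∈ {b} (c ∷ bs) e with em {P = b - c ≈ 0#}
  ... | yes b-c≈0 = here (trans (solve 2 (λ b c → b := (b :- c) :+ c) refl b c) (trans (+-congʳ b-c≈0) (+-identityˡ c)))
  ... | no  b-c≉0 = there (root∈ bs (zero-product e b-c≉0))

  remove : ∀ {b} bs → Any (b ≈_) bs → ∃ λ cs → ∀ z → productAt bs z ≈ (z - b) * productAt cs z
  remove (c ∷ bs) (here b≈c) = bs , λ z → *-congʳ (+-congˡ (-‿cong (sym b≈c)))
  remove {b} (c ∷ bs) (there i) with remove bs i
  ... | cs , e = c ∷ cs , λ z → trans (*-congˡ (e z))
    (solve 4 (λ z b c p → (z :- c) :* ((z :- b) :* p) := (z :- b) :* ((z :- c) :* p)) refl z b c (productAt cs z))

  -- Stated for functions, so that polynomials over a subfield share the record: then `f` and `f′`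
  -- take values in `L`, while `IsZero` speaks of the polynomial over the smaller field. The scalar
  -- may vanish, so that the zero polynomial factorises as well.
  record Factorisation (f f′ : Carrier → Carrier) (IsZero : Set u) : Set u where
    field
      scalar    : Carrier
      roots     : List Carrier
      scalar≈0  : scalar ≈ 0# → IsZero
      value     : ∀ z → f z ≈ scalar * productAt roots z
      slope-at  : ∀ z → f′ z ≈ scalar * productDerivativeAt roots z

    evaluate-root : ∀ {b} → Any (b ≈_) roots → f b ≈ 0#
    evaluate-root b∈ = trans (value _) (trans (*-congˡ (productAt-root roots b∈)) (zeroʳ _))

    root-member : ∀ {b} → ¬ IsZero → f b ≈ 0# → Any (b ≈_) roots
    root-member f≄0 e = root∈ roots (zero-product (trans (sym (value _)) e) (f≄0 ∘ scalar≈0))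

  Factorises : Poly → Set u
  Factorises f = Factorisation (evaluate f) (derivativeAt f) (f ≋ [])

  private
    constant : ∀ {f} a → f ≋ const a → Factorises f
    constant {f} a e = record
      { scalar = a ; roots = []
      ; scalar≈0 = λ a≈0 → ≋-trans e (∷≋[] a≈0 ≋-refl)
      ; value = λ z → trans (evaluate-cong z e) (trans (evaluate-const a z) (sym (*-identityʳ a)))
      ; slope-at = λ z → trans (derivativeAt-cong z e) (trans (derivativeAt-const a z) (sym (zeroʳ a))) }

    linear : Carrier → Poly
    linear b = (- b) ∷ 1# ∷ []

    evaluate-linear : ∀ b z → evaluate (linear b) z ≈ z - b
    evaluate-linear b z = trans (+-congˡ (trans (*-congˡ (trans (+-congˡ (zeroʳ z)) (+-identityʳ 1#))) (*-identityʳ z))) (+-comm _ _)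

    derivativeAt-linear : ∀ b z → derivativeAt (linear b) z ≈ 1#
    derivativeAt-linear b z = trans (+-cong (evaluate-const 1# z) (trans (*-congˡ (derivativeAt-const 1# z)) (zeroʳ z))) (+-identityʳ 1#)

    linear-monic : ∀ b → IsMonic (linear b) 1
    linear-monic b = monic refl (below-∷ below-const)

    extend : ∀ {f q} b → f ≋ q ⊗ linear b → Factorises q → Factorises f
    extend {f} {q} b f≋ql F = record
      { scalar = scalar ; roots = b ∷ roots
      ; scalar≈0 = λ s≈0 → ≋-trans f≋ql (≋-trans (ᴾ.*-congʳ (scalar≈0 s≈0)) (ᴾ.zeroˡ (linear b)))
      ; value = λ z → begin
          evaluate f z                               ≈⟨ evaluate-cong z f≋ql ⟩
          evaluate (q ⊗ linear b) z                  ≈⟨ evaluate-⊗ q (linear b) z ⟩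
          evaluate q z * evaluate (linear b) z       ≈⟨ *-cong (value z) (evaluate-linear b z) ⟩
          scalar * productAt roots z * (z - b)       ≈⟨ trans (*-assoc _ _ _) (*-congˡ (*-comm _ _)) ⟩
          scalar * ((z - b) * productAt roots z)     ∎
      ; slope-at = λ z → begin
          derivativeAt f z                           ≈⟨ derivativeAt-cong z f≋ql ⟩
          derivativeAt (q ⊗ linear b) z              ≈⟨ derivativeAt-⊗ q (linear b) z ⟩
          derivativeAt q z * evaluate (linear b) z + evaluate q z * derivativeAt (linear b) z
            ≈⟨ +-cong (*-cong (slope-at z) (evaluate-linear b z)) (trans (*-cong (value z) (derivativeAt-linear b z)) (*-identityʳ _)) ⟩
          scalar * productDerivativeAt roots z * (z - b) + scalar * productAt roots z
            ≈⟨ solve 4 (λ s d l p → s :* d :* l :+ s :* p := s :* (p :+ l :* d)) refl scalar _ (z - b) _ ⟩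
          scalar * (productAt roots z + (z - b) * productDerivativeAt roots z) ∎ }
      where open Factorisation F

  module _ (closed : IsAlgebraicallyClosed L) where

    private
      opaque
        peel : ∀ n {f} → Below f (suc (suc n)) → ¬ (coeff f (suc n) ≈ 0#) →
               ∃₂ λ b q → f ≋ q ⊗ linear b × Below q (suc n)
        peel n {f} f₀ f_n≉0 with inverse f_n≉0
        ... | c , cf_n≈1 with closed (c ∙ f) n (fromMonic cf-monic)
          where
          cf-monic : IsMonic (c ∙ f) (suc n)
          cf-monic = monic (trans (coeff-∙ c f (suc n)) cf_n≈1) (below-∙ c f₀)
        ... | b , cf[b]≈0 with divide (linear-monic b) f
        ... | q , r , f≋ql+r , r₀ = b , q , f≋ql , below-cancel (linear-monic b)
          (below-cong f≋ql (below-weaken (ℕ.≤-reflexive (ℕ.+-comm 1 (suc n))) f₀))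
          where
          c≉0 : ¬ (c ≈ 0#)
          c≉0 c≈0 = 1≉0 (trans (sym cf_n≈1) (trans (*-congʳ c≈0) (zeroˡ _)))
          f[b]≈0 : evaluate f b ≈ 0#
          f[b]≈0 = zero-product (trans (sym (evaluate-∙ c f b)) cf[b]≈0) c≉0
          r[b]≈0 : evaluate r b ≈ 0#
          r[b]≈0 = begin
            evaluate r b                                        ≈⟨ +-identityˡ _ ⟨
            0# + evaluate r b                                   ≈⟨ +-congʳ (zeroʳ _) ⟨
            evaluate q b * 0# + evaluate r b                    ≈⟨ +-congʳ (*-congˡ (trans (evaluate-linear b b) (-‿inverseʳ b))) ⟨
            evaluate q b * evaluate (linear b) b + evaluate r b ≈⟨ +-congʳ (evaluate-⊗ q (linear b) b) ⟨
            evaluate (q ⊗ linear b) b + evaluate r b            ≈⟨ evaluate-⊕ (q ⊗ linear b) r b ⟨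
            evaluate (q ⊗ linear b ⊕ r) b                       ≈⟨ evaluate-cong b f≋ql+r ⟨
            evaluate f b                                        ≈⟨ f[b]≈0 ⟩
            0#                                                  ∎
          r≋[] : r ≋ []
          r≋[] = ≋-trans (below-1⇒const r₀) (∷≋[]
            (trans (sym (evaluate-const _ b)) (trans (evaluate-cong b (≋-sym (below-1⇒const r₀))) r[b]≈0)) ≋-refl)
          f≋ql : f ≋ q ⊗ linear b
          f≋ql = ≋-trans f≋ql+r (≋-trans (ᴾ.+-congˡ r≋[]) (ᴾ.+-identityʳ _))

      -- The recursion is on a bound for the degree: if the coefficient at the bound vanishes, the
      -- bound drops, and no leading coefficient has to be located.
      lower : ∀ n → (∀ {q} → Below q n → Factorises q) → ∀ {f} → Below f (suc n) → Factorises f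
      lower n rec {f} f₀ with em {P = coeff f n ≈ 0#}
      ... | yes f_n≈0 = rec (below-top f₀ f_n≈0)
      lower zero    rec {f} f₀ | no _ = constant _ (below-1⇒const f₀)
      lower (suc n) rec {f} f₀ | no f_n≉0 =
        let b , q , f≋ql , q₀ = peel n f₀ f_n≉0 in extend b f≋ql (rec q₀)

    opaque
      factorise : ∀ n {f} → Below f n → Factorises f
      factorise zero    f₀ = constant 0# (≋-trans (below-0⇒[] f₀) (≋-sym (∷≋[] refl ≋-refl)))
      factorise (suc n) f₀ = lower n (factorise n) f₀

module Splitting (em : ∀ {ℓ} → ExcludedMiddle ℓ) {K L : Field u} (embedding : FieldHom K L)
  (closed : IsAlgebraicallyClosed L) where

  open FieldHom embedding using () renaming (⟦_⟧ to ι; isHom to ι-isHom)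
  open CommutativeRing (ring L) hiding (ring; rawRing)
  open IsRingHomomorphism ι-isHom using (⟦⟧-cong; *-homo; 0#-homo; 1#-homo)
  open PolynomialRing (ring K) using (Poly; _≋_; coeff; coefficients)
  open Evaluation (ring K) (ring L) ι-isHom
  private
    module K where
      open CommutativeRing (ring K) public
      open FieldPolynomials em K public
    module L where
      open LinearFactors em L public
      open PolynomialRing (ring L) public
      open FieldPolynomials em L public
  open L using (productAt; productDerivativeAt)

  ι-injective : ∀ {a} → ι a ≈ 0# → a K.≈ K.0#
  ι-injective {a} ιa≈0 with em {P = a K.≈ K.0#}
  ... | yes a≈0 = a≈0
  ... | no  a≉0 with K.inverse a≉0
  ...   | b , ba≈1 = contradiction (trans (sym 1#-homo) (trans (⟦⟧-cong (K.sym ba≈1))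
            (trans (*-homo b a) (trans (*-congˡ ιa≈0) (zeroʳ _))))) L.1≉0

  private
    evaluate-map : ∀ f z → L.evaluate (map ι f) z ≡ evaluate f z
    evaluate-map []      z = ≡.refl
    evaluate-map (a ∷ f) z = ≡.cong (λ x → ι a + z * x) (evaluate-map f z)

    derivativeAt-map : ∀ f z → L.derivativeAt (map ι f) z ≡ derivativeAt f z
    derivativeAt-map []      z = ≡.refl
    derivativeAt-map (a ∷ f) z = ≡.cong₂ (λ x y → x + z * y) (evaluate-map f z) (derivativeAt-map f z)

    coeff-map : ∀ f n → L.coeff (map ι f) n ≈ ι (coeff f n)
    coeff-map []      n       = sym 0#-homo
    coeff-map (a ∷ f) zero    = refl
    coeff-map (a ∷ f) (suc n) = coeff-map f n

    map-below : ∀ f → ∃ λ n → L.Below (map ι f) n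
    map-below []      = 0 , L.below-[]
    map-below (a ∷ f) with map-below f
    ... | n , b = suc n , L.below-∷ b

  Split : Poly → Set u
  Split f = L.Factorisation (evaluate f) (derivativeAt f) (f ≋ [])

  opaque
    split : ∀ f → Split f
    split f = record
      { scalar = scalar ; roots = roots
      ; scalar≈0 = λ s≈0 → coefficients λ n → ι-injective
          (trans (sym (coeff-map f n)) (L.coefficient (scalar≈0 s≈0) n))
      ; value = λ z → trans (reflexive (≡.sym (evaluate-map f z))) (value z)
      ; slope-at = λ z → trans (reflexive (≡.sym (derivativeAt-map f z))) (slope-at z) }
      where
      open L.Factorisation (L.factorise closed _ (proj₂ (map-below f)))

-- Generic points of a ball around θ

module GenericPoints (em : ∀ {ℓ} → ExcludedMiddle ℓ) (𝕂 : ValuedField u)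
  (θ : HeytingField.Carrier (ValuedField.K̄ 𝕂)) where

  open ValuedField 𝕂 using (K; K̄; embedding; algebraicClosed; Γ; valuation; surjective)
  open Theory 𝕂 using (v)
  open CommutativeRing (ring K̄) hiding (ring; rawRing)
  open Extended Γ
  open ExtendedProperties Γ
  open ValuationProperties Γ (ring K̄) valuation
  open FieldHom embedding using () renaming (isHom to ι-isHom)
  open PolynomialRing (ring K) using (Poly; _≋_)
  open Evaluation (ring K) (ring K̄) ι-isHom using (evaluate; derivativeAt)
  open LinearFactors em K̄ using (productAt; productDerivativeAt; remove; module Factorisation)
  open Splitting em embedding algebraicClosed using (split)
  open IntegralSolver (ring K̄)
  private module Γ = OrderedAbelianGroup Γ

  Near : Γ.Carrier → Carrier → Set u
  Near ε z = just ε ≤⁺ v (z - θ)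

  -- When `bs` consists of roots, these are the points of the ball that are as far as possible from
  -- every root. A `b` outside the ball imposes no condition.
  record Generic (ε : Γ.Carrier) (bs : List Carrier) (y : Carrier) : Set u where
    constructor generic
    field
      radius : v (y - θ) ≈⁺ just ε
      avoids : All (λ b → v (y - b) ≤⁺ just ε) bs

  open Generic public

  -- P holds on the sphere of radius ε around θ outside finitely many open balls of radius ε.
  Generically : Γ.Carrier → (Carrier → Set u) → Set u
  Generically ε P = ∃ λ bs → ∀ {y} → Generic ε bs y → P y

  private
    variable
      ε : Γ.Carrier
      P Q : Carrier → Set u

  infixr 4 _⟪×⟫_
  -- The exceptional points are concatenated, so finitely many conditions can be met at once. Later
  -- arguments collect their conditions in this way and then pick one point.
  _⟪×⟫_ : Generically ε P → Generically ε Q → Generically ε (λ y → P y × Q y)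
  (bs , p) ⟪×⟫ (cs , q) = bs ++ cs , λ (generic r a) → p (generic r (++⁻ˡ bs a)) , q (generic r (++⁻ʳ bs a))

  generically-map : (∀ {y} → P y → Q y) → Generically ε P → Generically ε Q
  generically-map f (bs , p) = bs , f ∘ p

  generically-radius : Generically ε (λ y → v (y - θ) ≈⁺ just ε)
  generically-radius = [] , radius

  generically-avoids : ∀ b → Generically ε (λ y → v (y - b) ≤⁺ just ε)
  generically-avoids b = b ∷ [] , λ g → All.head (avoids g)

  generic-near : ∀ {y} → v (y - θ) ≈⁺ just ε → Near ε y
  generic-near r = ⁺.reflexive (⁺.Eq.sym r)

  near-difference : ∀ {y z} → Near ε y → Near ε z → just ε ≤⁺ v (z - y)
  near-difference {y = y} {z} p q = ⁺.trans (≤-val-sub q p)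
    (⁺.reflexive (val-cong (solve 3 (λ y z θ → (z :- θ) :- (y :- θ) := z :- y) refl y z θ)))

  private
    Avoids : Γ.Carrier → Carrier → Carrier → Set u
    Avoids ε y b = v (y - b) ≤⁺ just ε

    via : ∀ a b c → v ((a - b) + (b - c)) ≈⁺ v (a - c)
    via a b c = val-cong (solve 3 (λ a b c → (a :- b) :+ (b :- c) := a :- c) refl a b c)

    -- Moving from `y` to `z` changes `y - b` by `z - y`, whose value is at least `ε ≥ v (y - b)`;
    -- this cannot lower the value.
    factor-≤ : ∀ {y z b} → v (y - θ) ≈⁺ just ε → Near ε z → Avoids ε y b → v (y - b) ≤⁺ v (z - b)
    factor-≤ {y = y} {z} {b} r z≈θ a = ⁺.trans
      (≤-val-+ (⁺.trans a (near-difference (generic-near r) z≈θ)) ⁺.refl) (⁺.reflexive (via z y b))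

    product-≤ : ∀ {y z} bs → v (y - θ) ≈⁺ just ε → Near ε z → All (Avoids ε y) bs →
                v (productAt bs y) ≤⁺ v (productAt bs z)
    product-≤ []       r n []       = ⁺.refl
    product-≤ (b ∷ bs) r n (a ∷ as) = ⁺.trans (⁺.reflexive (*-homo _ _))
      (⁺.trans (+⁺-mono (factor-≤ r n a) (product-≤ bs r n as)) (⁺.reflexive (⁺.Eq.sym (*-homo _ _))))

    product-finite : ∀ {y} bs → All (Avoids ε y) bs → Finite (v (productAt bs y))
    product-finite []       []       = _ , one-0
    product-finite (b ∷ bs) (a ∷ as) = ≈-finite (*-homo _ _)
      (finite-+ (≤-finite a (_ , ⁺.Eq.refl)) (product-finite bs as))

    product-< : ∀ {y z b} bs → v (y - θ) ≈⁺ just ε → Near ε z → All (Avoids ε y) bs →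
                Any (b ≈_) bs → just ε <⁺ v (z - b) → v (productAt bs y) <⁺ v (productAt bs z)
    product-< (c ∷ bs) r n (a ∷ as) (here b≈c) p = proj₂ <-resp-≈ (⁺.Eq.sym (*-homo _ _)) (proj₁ <-resp-≈ (⁺.Eq.sym (*-homo _ _))
      (+⁺-mono-<-≤ (product-finite bs as)
        (≤-<-trans a (<-≤-trans p (⁺.reflexive (val-cong (+-congˡ (-‿cong b≈c)))))) (product-≤ bs r n as)))
    product-< (c ∷ bs) r n (a ∷ as) (there i) p = proj₂ <-resp-≈ (⁺.Eq.sym (*-homo _ _)) (proj₁ <-resp-≈ (⁺.Eq.sym (*-homo _ _))
      (+⁺-mono-≤-< (≤-finite a (_ , ⁺.Eq.refl)) (factor-≤ r n a) (product-< bs r n as i p)))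

    product-≥ : ∀ {y z} bs → v (y - θ) ≈⁺ just ε → Near ε z → All (λ b → v (z - b) ≤⁺ just ε) bs →
                v (productAt bs z) ≤⁺ v (productAt bs y)
    product-≥ []       r n []       = ⁺.refl
    product-≥ {y = y} {z} (b ∷ bs) r n (a ∷ as) = ⁺.trans (⁺.reflexive (*-homo _ _))
      (⁺.trans (+⁺-mono factor (product-≥ bs r n as)) (⁺.reflexive (⁺.Eq.sym (*-homo _ _))))
      where
      factor : v (z - b) ≤⁺ v (y - b)
      factor = ⁺.trans (≤-val-+ (⁺.trans a (near-difference n (generic-near r))) ⁺.refl) (⁺.reflexive (via y z b))

  private
    split-value : ∀ f z → let open Factorisation (split f) in v (evaluate f z) ≈⁺ v scalar +⁺ v (productAt roots z)
    split-value f z = ⁺.Eq.trans (val-cong (Factorisation.value (split f) z)) (*-homo _ _)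

    split-slope : ∀ f z → let open Factorisation (split f) in v (derivativeAt f z) ≈⁺ v scalar +⁺ v (productDerivativeAt roots z)
    split-slope f z = ⁺.Eq.trans (val-cong (Factorisation.slope-at (split f) z)) (*-homo _ _)

  opaque
    -- By `factor-≤` every linear factor takes its least value over the ball at a generic point. The
    -- common value at generic points is thus the minimum of `v ∘ f` on the ball, that is, the Gauss
    -- valuation of the ball.
    minimum : ∀ f → Generically ε (λ y → ∀ {z} → Near ε z → v (evaluate f y) ≤⁺ v (evaluate f z))
    minimum f = roots , λ {y} (generic r a) {z} n → let open ⁺-Reasoning in begin
      v (evaluate f y)                      ≈⟨ split-value f y ⟩
      v scalar +⁺ v (productAt roots y)     ≤⟨ +⁺-monoʳ _ (product-≤ roots r n a) ⟩
      v scalar +⁺ v (productAt roots z)     ≈⟨ split-value f z ⟨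
      v (evaluate f z)                      ∎
      where open Factorisation (split f)

    -- Were no root in the open ball of radius `ε` around `z`, then `z` would be so far from all
    -- roots that no factor could have a larger value at `z` than at `y`.
    jump⇒root : ∀ f → Generically ε (λ y → ∀ {z} → Near ε z → v (evaluate f y) <⁺ v (evaluate f z) →
                ∃ λ b → evaluate f b ≈ 0# × just ε <⁺ v (z - b))
    jump⇒root {ε = ε} f = roots , λ {y} (generic r a) {z} n y<z →
      let i = ¬All⇒Any¬ (λ b → v (z - b) ⁺.≤? just ε) roots λ all → <⇒≱ y<z (let open ⁺-Reasoning in begin
                v (evaluate f z)                      ≈⟨ split-value f z ⟩
                v scalar +⁺ v (productAt roots z)     ≤⟨ +⁺-monoʳ _ (product-≥ roots r n all) ⟩
                v scalar +⁺ v (productAt roots y)     ≈⟨ split-value f y ⟨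
                v (evaluate f y)                      ∎)
          b , b∈ , p = member i
      in b , evaluate-root b∈ , ≰⇒> p
      where
      open Factorisation (split f)
      member : ∀ {bs z} → Any (λ b → ¬ (v (z - b) ≤⁺ just ε)) bs → ∃ λ b → Any (b ≈_) bs × ¬ (v (z - b) ≤⁺ just ε)
      member {c ∷ bs} (here p)  = c , here refl , p
      member {c ∷ bs} (there i) = let b , b∈ , p = member i in b , there b∈ , p

  module _ {f : Poly} (f≄0 : ¬ (f ≋ [])) where

    open Factorisation (split f)

    private
      scalar-finite : Finite (v scalar)
      scalar-finite = val-finite (λ s≈0 → f≄0 (scalar≈0 s≈0))
        where
        open FieldPolynomials em K̄ using (inverse)
        val-finite : ∀ {x} → ¬ (x ≈ 0#) → Finite (v x)
        val-finite x≉0 = let y , yx≈1 = inverse x≉0 in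
          finite-+ʳ {v y} (Γ.0# , ⁺.Eq.trans (⁺.Eq.sym (*-homo _ _)) (⁺.Eq.trans (val-cong yx≈1) one-0))

    opaque
      generically-finite : Generically ε (λ y → Finite (v (evaluate f y)))
      generically-finite = roots , λ (generic r a) → ≈-finite (split-value f _) (finite-+ scalar-finite (product-finite roots a))

      -- The factor of `b` grows strictly from `y` to `z` and no other factor decreases. Strictness
      -- survives because the factors at `y` are finite and so is the scalar, `f` being nonzero.
      root⇒jump : Generically ε (λ y → ∀ {b z} → evaluate f b ≈ 0# → Near ε z → just ε <⁺ v (z - b) →
                  v (evaluate f y) <⁺ v (evaluate f z))
      root⇒jump = roots , λ {y} (generic r a) {b} {z} f[b]≈0 n p → let open ⁺-Reasoning in begin-strict
        v (evaluate f y)                      ≈⟨ split-value f y ⟩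
        v scalar +⁺ v (productAt roots y)     <⟨ +⁺-monoʳ-< scalar-finite (product-< roots r n a (root-member f≄0 f[b]≈0) p) ⟩
        v scalar +⁺ v (productAt roots z)     ≈⟨ split-value f z ⟨
        v (evaluate f z)                      ∎

      -- The quotient of `f` by `x - b` is kept as a function, since its coefficients need not lie
      -- in `K`. As a product of the remaining factors it is again minimal at generic points, for
      -- every radius.
      cofactor : ∀ {b} → evaluate f b ≈ 0# → Σ (Carrier → Carrier) λ h → (∀ z → evaluate f z ≈ (z - b) * h z) ×
        (∀ ε → Generically ε (λ y → ∀ {z} → Near ε z → v (h y) ≤⁺ v (h z)))
      cofactor {b} f[b]≈0 = let cs , e = remove roots (root-member f≄0 f[b]≈0) in
        (λ z → scalar * productAt cs z) ,
        (λ z → trans (value z) (trans (*-congˡ (e z))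
          (solve 3 (λ s l p → s :* (l :* p) := l :* (s :* p)) refl scalar (z - b) (productAt cs z)))) ,
        λ ε → cs , λ {y} (generic r a) {z} n → let open ⁺-Reasoning in begin
          v (scalar * productAt cs y)         ≈⟨ *-homo _ _ ⟩
          v scalar +⁺ v (productAt cs y)      ≤⟨ +⁺-monoʳ _ (product-≤ cs r n a) ⟩
          v scalar +⁺ v (productAt cs z)      ≈⟨ *-homo _ _ ⟨
          v (scalar * productAt cs z)         ∎

    -- `f′ / f` is the sum of the `1 / (z - b)`. If each of these has value above `-κ`, so has the
    -- sum; this is the claim with denominators cleared.
    close-root : ∀ {κ} z → (∀ {b} → evaluate f b ≈ 0# → v (z - b) <⁺ κ) →
                 v (evaluate f z) <⁺ v (derivativeAt f z) +⁺ κ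
    close-root {κ} z far = let open ⁺-Reasoning in begin-strict
      v (evaluate f z)                                ≈⟨ split-value f z ⟩
      v scalar +⁺ v (productAt roots z)               <⟨ +⁺-monoʳ-< scalar-finite (proj₁ (go roots evaluate-root)) ⟩
      v scalar +⁺ (v (productDerivativeAt roots z) +⁺ κ)   ≈⟨ +⁺-assoc (v scalar) _ κ ⟨
      (v scalar +⁺ v (productDerivativeAt roots z)) +⁺ κ   ≈⟨ +⁺-congʳ {κ} (split-slope f z) ⟨
      v (derivativeAt f z) +⁺ κ                       ∎
      where
      go : ∀ bs → (∀ {b} → Any (b ≈_) bs → evaluate f b ≈ 0#) →
           (v (productAt bs z) <⁺ v (productDerivativeAt bs z) +⁺ κ) × Finite (v (productAt bs z))
      go []       zeros = <-≤-trans (finite⇒<⊤ (_ , one-0)) (⁺.reflexive (⁺.Eq.sym (+⁺-congʳ {κ} zero-∞))) , _ , one-0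
      go (b ∷ bs) zeros = let
          p , fin = go bs (zeros ∘ there)
          z-b<κ   = far (zeros (here refl))
          open ⁺-Reasoning
          first : v ((z - b) * productAt bs z) <⁺ v (productAt bs z) +⁺ κ
          first = begin-strict
            v ((z - b) * productAt bs z)       ≈⟨ *-homo _ _ ⟩
            v (z - b) +⁺ v (productAt bs z)    <⟨ +⁺-monoˡ-< fin z-b<κ ⟩
            κ +⁺ v (productAt bs z)            ≈⟨ +⁺-comm κ _ ⟩
            v (productAt bs z) +⁺ κ            ∎
          second : v ((z - b) * productAt bs z) <⁺ v ((z - b) * productDerivativeAt bs z) +⁺ κ
          second = begin-strict
            v ((z - b) * productAt bs z)                            ≈⟨ *-homo _ _ ⟩
            v (z - b) +⁺ v (productAt bs z)                         <⟨ +⁺-monoʳ-< (<⇒finite z-b<κ) p ⟩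
            v (z - b) +⁺ (v (productDerivativeAt bs z) +⁺ κ)        ≈⟨ +⁺-assoc (v (z - b)) _ κ ⟨
            (v (z - b) +⁺ v (productDerivativeAt bs z)) +⁺ κ        ≈⟨ +⁺-congʳ {κ} (*-homo _ _) ⟨
            v ((z - b) * productDerivativeAt bs z) +⁺ κ             ∎
        in <-val-+⁺ κ first second , ≈-finite (*-homo _ _) (finite-+ (<⇒finite z-b<κ) fin)

  -- The weak form needs no finiteness: `f` may vanish at `z`, even identically, and `κ` may be
  -- infinite.
  close-root-≤ : ∀ f {κ} z → (∀ {b} → evaluate f b ≈ 0# → v (z - b) ≤⁺ κ) →
                 v (evaluate f z) ≤⁺ v (derivativeAt f z) +⁺ κ
  close-root-≤ f {κ} z far = let open ⁺-Reasoning in begin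
    v (evaluate f z)                                     ≈⟨ split-value f z ⟩
    v scalar +⁺ v (productAt roots z)                    ≤⟨ +⁺-monoʳ (v scalar) (go roots evaluate-root) ⟩
    v scalar +⁺ (v (productDerivativeAt roots z) +⁺ κ)   ≈⟨ +⁺-assoc (v scalar) _ κ ⟨
    (v scalar +⁺ v (productDerivativeAt roots z)) +⁺ κ   ≈⟨ +⁺-congʳ {κ} (split-slope f z) ⟨
    v (derivativeAt f z) +⁺ κ                            ∎
    where
    open Factorisation (split f)
    go : ∀ bs → (∀ {b} → Any (b ≈_) bs → evaluate f b ≈ 0#) →
         v (productAt bs z) ≤⁺ v (productDerivativeAt bs z) +⁺ κ
    go []       zeros = ⁺.trans ≤⊤ (⁺.reflexive (⁺.Eq.sym (+⁺-congʳ {κ} zero-∞)))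
    go (b ∷ bs) zeros = ≤-val-+⁺ κ first second
      where
      open ⁺-Reasoning
      z-b≤κ : v (z - b) ≤⁺ κ
      z-b≤κ = far (zeros (here refl))
      first : v ((z - b) * productAt bs z) ≤⁺ v (productAt bs z) +⁺ κ
      first = begin
        v ((z - b) * productAt bs z)       ≈⟨ *-homo _ _ ⟩
        v (z - b) +⁺ v (productAt bs z)    ≤⟨ +⁺-monoˡ _ z-b≤κ ⟩
        κ +⁺ v (productAt bs z)            ≈⟨ +⁺-comm κ _ ⟩
        v (productAt bs z) +⁺ κ            ∎
      second : v ((z - b) * productAt bs z) ≤⁺ v ((z - b) * productDerivativeAt bs z) +⁺ κ
      second = begin
        v ((z - b) * productAt bs z)                            ≈⟨ *-homo _ _ ⟩
        v (z - b) +⁺ v (productAt bs z)                         ≤⟨ +⁺-monoʳ (v (z - b)) (go bs (zeros ∘ there)) ⟩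
        v (z - b) +⁺ (v (productDerivativeAt bs z) +⁺ κ)        ≈⟨ +⁺-assoc (v (z - b)) _ κ ⟨
        (v (z - b) +⁺ v (productDerivativeAt bs z)) +⁺ κ        ≈⟨ +⁺-congʳ {κ} (*-homo _ _) ⟨
        v ((z - b) * productDerivativeAt bs z) +⁺ κ             ∎

  opaque
    -- `f′(θ)` is a sum of products that lack one factor each. At `y` the missing factor has value
    -- at most `ε`, and the other factors have values no larger than at `θ`.
    derivative-bound : ∀ f → Generically ε (λ y → v (evaluate f y) ≤⁺ v (derivativeAt f θ) +⁺ just ε)
    derivative-bound {ε = ε} f = roots , λ {y} (generic r a) → let open ⁺-Reasoning in begin
      v (evaluate f y)                                          ≈⟨ split-value f y ⟩
      v scalar +⁺ v (productAt roots y)                         ≤⟨ +⁺-monoʳ (v scalar) (go roots r a) ⟩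
      v scalar +⁺ (v (productDerivativeAt roots θ) +⁺ just ε)   ≈⟨ +⁺-assoc (v scalar) _ (just ε) ⟨
      (v scalar +⁺ v (productDerivativeAt roots θ)) +⁺ just ε   ≈⟨ +⁺-congʳ {just ε} (split-slope f θ) ⟨
      v (derivativeAt f θ) +⁺ just ε                            ∎
      where
      open Factorisation (split f)
      θ-near : Near ε θ
      θ-near = ⁺.trans ≤⊤ (⁺.reflexive (⁺.Eq.sym (⁺.Eq.trans (val-cong (-‿inverseʳ θ)) zero-∞)))
      go : ∀ {y} bs → v (y - θ) ≈⁺ just ε → All (Avoids ε y) bs →
           v (productAt bs y) ≤⁺ v (productDerivativeAt bs θ) +⁺ just ε
      go []       r []       = ⁺.trans ≤⊤ (⁺.reflexive (⁺.Eq.sym (+⁺-congʳ {just ε} zero-∞)))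
      go {y} (b ∷ bs) r (a ∷ as) = ≤-val-+⁺ (just ε) first second
        where
        open ⁺-Reasoning
        first : v ((y - b) * productAt bs y) ≤⁺ v (productAt bs θ) +⁺ just ε
        first = begin
          v ((y - b) * productAt bs y)            ≈⟨ *-homo _ _ ⟩
          v (y - b) +⁺ v (productAt bs y)         ≤⟨ +⁺-mono a (product-≤ bs r θ-near as) ⟩
          just ε +⁺ v (productAt bs θ)            ≈⟨ +⁺-comm (just ε) _ ⟩
          v (productAt bs θ) +⁺ just ε            ∎
        second : v ((y - b) * productAt bs y) ≤⁺ v ((θ - b) * productDerivativeAt bs θ) +⁺ just ε
        second = begin
          v ((y - b) * productAt bs y)                                ≈⟨ *-homo _ _ ⟩
          v (y - b) +⁺ v (productAt bs y)                             ≤⟨ +⁺-mono (factor-≤ r θ-near a) (go bs r as) ⟩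
          v (θ - b) +⁺ (v (productDerivativeAt bs θ) +⁺ just ε)       ≈⟨ +⁺-assoc (v (θ - b)) _ (just ε) ⟨
          (v (θ - b) +⁺ v (productDerivativeAt bs θ)) +⁺ just ε       ≈⟨ +⁺-congʳ {just ε} (*-homo _ _) ⟨
          v ((θ - b) * productDerivativeAt bs θ) +⁺ just ε            ∎

    -- With π of value ε and B the given points in the ball of radius ε around θ,
    -- every root of (x - θ) ∏ (x - b) + π ^ (1 + |B|), b ∈ B, is generic.
    generic-exists : ∀ ε bs → ∃ (Generic ε bs)
    generic-exists ε bs = y , generic (⁺.antisym (All.head avoids′) y-near) avoid-all
      where
      open PolynomialRing (ring K̄) using (IsMonic; monic; fromMonic; below-⊕; below-const; below-weaken; below-∷; below-⊗; top-⊗; coeff-⊕; _⊕_; _⊗_)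
        renaming (Poly to Poly̅)
      open Polynomials (rawRing K̄) using (const)
      module E = LinearFactors em K̄
      π : Carrier
      π = proj₁ (surjective ε)
      vπ : v π ≈⁺ just ε
      vπ = proj₂ (surjective ε)
      near : List Carrier → List Carrier
      near []       = []
      near (b ∷ bs) with just ε ⁺.≤? v (b - θ)
      ... | yes _ = b ∷ near bs
      ... | no  _ = near bs
      near-near : ∀ bs → All (Near ε) (near bs)
      near-near []       = []
      near-near (b ∷ bs) with just ε ⁺.≤? v (b - θ)
      ... | yes p = p ∷ near-near bs
      ... | no  _ = near-near bs
      -- A point outside the ball is at one and the same distance from all points of the ball, so
      -- only points inside it have to enter the equation.
      far : ∀ {y b} → Near ε y → ¬ Near ε b → Avoids ε y b
      far {y} {b} n ¬n = ⁺.trans (⁺.reflexive (⁺.Eq.trans (val-cong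
          (solve 3 (λ y b θ → y :- b := (θ :- b) :+ (y :- θ)) refl y b θ))
          (⁺.Eq.trans (val-+-dominant (<-≤-trans (proj₂ <-resp-≈ (val-swap b θ) (≰⇒> ¬n)) n)) (val-swap θ b)))) (<⇒≤ (≰⇒> ¬n))
      near-avoids : ∀ {y} → Near ε y → ∀ bs → All (Avoids ε y) (near bs) → All (Avoids ε y) bs
      near-avoids n []       _ = []
      near-avoids n (b ∷ bs) as with just ε ⁺.≤? v (b - θ)
      near-avoids n (b ∷ bs) (a ∷ as) | yes _ = a ∷ near-avoids n bs as
      near-avoids n (b ∷ bs) as       | no ¬p = far n ¬p ∷ near-avoids n bs as
      -- `θ` is to be avoided as well: this puts the solution on the sphere and not merely in the
      -- ball.
      B : List Carrier
      B = θ ∷ near bs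
      power : ℕ → Carrier
      power zero    = 1#
      power (suc k) = π * power k
      polynomial : List Carrier → Poly̅
      polynomial []       = const 1#
      polynomial (b ∷ bs) = (- b ∷ 1# ∷ []) ⊗ polynomial bs
      polynomial-monic : ∀ bs → IsMonic (polynomial bs) (length bs)
      polynomial-monic []       = monic refl below-const
      polynomial-monic (b ∷ bs) = let monic p₁ p₀ = polynomial-monic bs in
        monic (trans (top-⊗ {m = 1} (below-∷ below-const) p₀) (trans (*-identityˡ _) p₁)) (below-⊗ (below-∷ below-const) p₀)
      evaluate-polynomial : ∀ bs z → E.evaluate (polynomial bs) z ≈ productAt bs z
      evaluate-polynomial []       z = E.evaluate-const 1# z
      evaluate-polynomial (b ∷ bs) z = trans (E.evaluate-⊗ (- b ∷ 1# ∷ []) (polynomial bs) z) (*-cong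
        (trans (+-congˡ (trans (*-congˡ (E.evaluate-const 1# z)) (*-identityʳ z))) (+-comm (- b) z)) (evaluate-polynomial bs z))
      equation : Poly̅
      equation = polynomial B ⊕ const (power (length B))
      equation-monic : IsMonic equation (length B)
      equation-monic = let monic p₁ p₀ = polynomial-monic B in
        monic (trans (coeff-⊕ (polynomial B) _ (length B)) (trans (+-cong p₁ refl) (+-identityʳ 1#)))
          (below-⊕ p₀ (below-weaken (s≤s z≤n) below-const))
      solution : ∃ λ y → E.evaluate equation y ≈ 0#
      solution = algebraicClosed equation (length (near bs)) (fromMonic equation-monic)
      y : Carrier
      y = proj₁ solution
      product-value : v (productAt B y) ≈⁺ v (power (length B))
      product-value = ⁺.Eq.trans (val-cong (trans (solve 2 (λ p q → p := (p :+ q) :- q) refl (productAt B y) (power (length B)))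
        (trans (+-congʳ (trans (sym (+-cong (evaluate-polynomial B y) (E.evaluate-const _ y)))
          (trans (sym (E.evaluate-⊕ (polynomial B) _ y)) (proj₂ solution)))) (+-identityˡ _)))) (val-neg _)
      power-finite : ∀ k → Finite (v (power k))
      power-finite zero    = Γ.0# , one-0
      power-finite (suc k) = ≈-finite (*-homo _ _) (finite-+ (ε , vπ) (power-finite k))
      -- Seen from outside the ball, all of `B` is at the distance of `θ`. Every factor then has
      -- value below `ε`, and the product falls short of the constant term.
      too-far : ¬ Near ε y → ∀ bs → All (Near ε) bs → v (productAt bs y) ≤⁺ v (power (length bs))
      too-far ¬n []       []       = ⁺.refl
      too-far ¬n (b ∷ bs) (n ∷ ns) = ⁺.trans (⁺.reflexive (*-homo _ _)) (⁺.trans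
        (+⁺-mono (<⇒≤ (≤-<-trans (⁺.reflexive y-b≈) (proj₁ <-resp-≈ (⁺.Eq.sym vπ) (≰⇒> ¬n)))) (too-far ¬n bs ns))
        (⁺.reflexive (⁺.Eq.sym (*-homo _ _))))
        where
        y-b≈ : v (y - b) ≈⁺ v (y - θ)
        y-b≈ = ⁺.Eq.trans (⁺.Eq.sym (via y θ b)) (val-+-dominant (<-≤-trans (≰⇒> ¬n) (⁺.trans n (⁺.reflexive (val-swap b θ)))))
      y-near : Near ε y
      y-near = Classical.dne em λ ¬n → <-irrefl product-value (let open ⁺-Reasoning in begin-strict
        v (productAt B y)                              ≈⟨ *-homo _ _ ⟩
        v (y - θ) +⁺ v (productAt (near bs) y)         ≤⟨ +⁺-monoʳ (v (y - θ)) (too-far ¬n (near bs) (near-near bs)) ⟩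
        v (y - θ) +⁺ v (power (length (near bs)))      <⟨ +⁺-monoˡ-< (power-finite (length (near bs))) (proj₁ <-resp-≈ (⁺.Eq.sym vπ) (≰⇒> ¬n)) ⟩
        v π +⁺ v (power (length (near bs)))            ≈⟨ *-homo _ _ ⟨
        v (power (length B))                           ∎)
      lower-bound : ∀ bs → All (Near ε) bs → v (power (length bs)) ≤⁺ v (productAt bs y)
      lower-bound []       []       = ⁺.refl
      lower-bound (b ∷ bs) (n ∷ ns) = ⁺.trans (⁺.reflexive (*-homo _ _)) (⁺.trans
        (+⁺-mono (⁺.trans (⁺.reflexive vπ) (near-difference n y-near)) (lower-bound bs ns))
        (⁺.reflexive (⁺.Eq.sym (*-homo _ _))))
      -- Inside the ball every factor has value at least `ε`, while the total is exactly `ε` times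
      -- the number of factors.
      tight : ∀ bs → All (Near ε) bs → v (productAt bs y) ≤⁺ v (power (length bs)) → All (Avoids ε y) bs
      tight []       []       p = []
      tight (b ∷ bs) (n ∷ ns) p =
        let p₁ , p₂ = +⁺-≤-split {v π} {v (power (length bs))} {v (y - b)} {v (productAt bs y)}
              (finite-y-b) (⁺.trans (⁺.reflexive vπ) (near-difference n y-near)) (lower-bound bs ns)
              (⁺.trans (⁺.reflexive (⁺.Eq.sym (*-homo _ _))) (⁺.trans p (⁺.reflexive (*-homo _ _))))
        in ⁺.trans p₁ (⁺.reflexive vπ) ∷ tight bs ns p₂
        where
        finite-y-b : Finite (v (y - b) +⁺ v (productAt bs y))
        finite-y-b = ≈-finite (⁺.Eq.sym (*-homo _ _)) (≤-finite p (power-finite (suc (length bs))))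
      avoids′ : All (Avoids ε y) B
      avoids′ = tight B (⁺.trans ≤⊤ (⁺.reflexive (⁺.Eq.sym (⁺.Eq.trans (val-cong (-‿inverseʳ θ)) zero-∞))) ∷ near-near bs) (⁺.reflexive product-value)
      avoid-all : All (Avoids ε y) bs
      avoid-all = near-avoids y-near bs (All.tail avoids′)

  point : Generically ε P → ∃ P
  point {ε = ε} (bs , p) = let y , g = generic-exists ε bs in y , p g

-- Linear dependence over a field

module LinearDependence (em : ∀ {ℓ} → ExcludedMiddle ℓ) (K : Field u) where

  open CommutativeRing (ring K) hiding (ring; rawRing; zero)
  open SemiringSum (CommutativeRing.semiring (ring K)) using (sum-cong-≋; sum-remove; sum-replicate-zero; *-distribʳ-sum; ∑-distrib-+) renaming (sum to ∑)
  open FieldPolynomials em K using (1≉0; inverse)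
  open Classical em
  open IntegralSolver (ring K)
  open import Relation.Binary.Reasoning.Setoid setoid

  sum-zero : ∀ {n} {t : Fin n → Carrier} → (∀ i → t i ≈ 0#) → ∑ t ≈ 0#
  sum-zero {n} e = trans (sum-cong-≋ e) (sum-replicate-zero n)

  Dependence : ∀ {m n} → (Fin n → Fin m → Carrier) → Set u
  Dependence {n = n} A = Σ (Fin n → Carrier) λ x → (∃ λ i → ¬ (x i ≈ 0#)) × ∀ j → ∑ (λ i → x i * A i j) ≈ 0#

  private
    module Elimination {m} (A : Fin (suc (suc m)) → Fin (suc m) → Carrier)
      (p : Fin (suc (suc m))) {w : Carrier} (wA≈1 : w * A p zero ≈ 1#) where

      A′ : Fin (suc m) → Fin (suc m) → Carrier
      A′ i = A (punchIn p i)

      B : Fin (suc m) → Fin m → Carrier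
      B i j = A′ i (suc j) - (A′ i zero * w) * A p (suc j)

      lift : Dependence B → Dependence A
      lift (x , (i , xᵢ≉0) , e) =
        y , (punchIn p i , λ y≈0 → xᵢ≉0 (trans (reflexive (≡.sym (insertAt-punchIn x p v i))) y≈0)) , vanish
        where
        s v : Carrier
        s = ∑ (λ i → x i * A′ i zero)
        -- The coefficient of the pivot row that cancels column zero. The other columns then vanish
        -- because `B` is what elimination leaves of them.
        v = - (s * w)
        y : Fin (suc (suc m)) → Carrier
        y = insertAt x p v
        expand : ∀ j → ∑ (λ i → y i * A i j) ≈ v * A p j + ∑ (λ i → x i * A′ i j)
        expand j = trans (sum-remove {i = p} (λ i → y i * A i j)) (+-cong
          (*-congʳ {A p j} (reflexive (insertAt-lookup x p v)))
          (sum-cong-≋ λ i → *-congʳ {A′ i j} (reflexive (insertAt-punchIn x p v i))))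
        vanish : ∀ j → ∑ (λ i → y i * A i j) ≈ 0#
        vanish zero = begin
          ∑ (λ i → y i * A i zero)           ≈⟨ expand zero ⟩
          v * A p zero + s                     ≈⟨ solve 3 (λ s w a → :- (s :* w) :* a :+ s := s :- s :* (w :* a)) refl s w (A p zero) ⟩
          s - s * (w * A p zero)               ≈⟨ +-congˡ (-‿cong (trans (*-congˡ wA≈1) (*-identityʳ s))) ⟩
          s - s                                ≈⟨ -‿inverseʳ s ⟩
          0#                                   ∎
        vanish (suc j) = begin
          ∑ (λ i → y i * A i (suc j))        ≈⟨ expand (suc j) ⟩
          v * c + ∑ (λ i → x i * A′ i (suc j))
            ≈⟨ +-congˡ (sum-cong-≋ λ i → solve 5 (λ x a a₀ w c → x :* a := x :* (a :- (a₀ :* w) :* c) :+ (x :* a₀) :* (w :* c)) refl (x i) (A′ i (suc j)) (A′ i zero) w c) ⟩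
          v * c + ∑ (λ i → x i * B i j + (x i * A′ i zero) * (w * c))
            ≈⟨ +-congˡ (∑-distrib-+ (λ i → x i * B i j) (λ i → (x i * A′ i zero) * (w * c))) ⟩
          v * c + (∑ (λ i → x i * B i j) + ∑ (λ i → (x i * A′ i zero) * (w * c)))
            ≈⟨ +-congˡ (+-cong (e j) (sym (*-distribʳ-sum (w * c) (λ i → x i * A′ i zero)))) ⟩
          v * c + (0# + s * (w * c))
            ≈⟨ solve 3 (λ s w a → :- (s :* w) :* a :+ (con (0 , 0) :+ s :* (w :* a)) := con (0 , 0)) refl s w c ⟩
          0#                                   ∎
          where
          c : Carrier
          c = A p (suc j)

  opaque
    -- Gaussian elimination on the first column. Without a pivot that column is zero, and the first
    -- row may be discarded with it: there is still one row more than there are columns.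
    dependent : ∀ m (A : Fin (suc m) → Fin m → Carrier) → Dependence A
    dependent zero    A = (λ _ → 1#) , (zero , 1≉0) , λ ()
    dependent (suc m) A with em {P = ∃ λ p → ¬ (A p zero ≈ 0#)}
    ... | yes (p , Aₚ₀≉0) = lift (dependent m B)
      where open Elimination A p (proj₂ (inverse Aₚ₀≉0))
    ... | no ¬pivot with dependent m (λ i j → A (suc i) (suc j))
    ...   | x , (i , xᵢ≉0) , e = y , (suc i , xᵢ≉0) , vanish
      where
      y : Fin (suc (suc m)) → Carrier
      y zero    = 0#
      y (suc i) = x i
      column : ∀ i → A i zero ≈ 0#
      column i = dne λ Aᵢ₀≉0 → ¬pivot (i , Aᵢ₀≉0)
      vanish : ∀ j → ∑ (λ i → y i * A i j) ≈ 0#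
      vanish zero    = sum-zero λ i → trans (*-congˡ (column i)) (zeroʳ (y i))
      vanish (suc j) = trans (+-cong (zeroˡ _) (e j)) (+-identityˡ 0#)

-- Degrees of elements and annihilating polynomials

module SimpleExtensions (em : ∀ {ℓ} → ExcludedMiddle ℓ) (𝕂 : ValuedField u) where

  open ValuedField 𝕂 using (K; K̄; embedding)
  open Theory 𝕂 using (Adjoin; base; gen; add; mul; neg; inv; resp; Degree; module L/K)
  open CommutativeRing (ring K̄) hiding (ring; rawRing; zero)
  open FieldHom embedding using () renaming (⟦_⟧ to ι; isHom to ι-isHom)
  open IsRingHomomorphism ι-isHom using (⟦⟧-cong; +-homo; *-homo; 0#-homo; 1#-homo)
  private
    module K where
      open CommutativeRing (ring K) public hiding (ring; rawRing)
      open FieldPolynomials em K public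
      open SemiringSum (CommutativeRing.semiring (ring K)) public using () renaming (sum to ∑)
      open LinearDependence em K public
    module K̄ = FieldPolynomials em K̄
  open PolynomialRing (ring K)
  open Evaluation (ring K) (ring K̄) ι-isHom
  open SemiringSum (CommutativeRing.semiring (ring K̄)) using (sum-cong-≋; sum-replicate-zero; *-distribˡ-sum; *-distribʳ-sum; ∑-comm) renaming (sum to ∑)
  open Classical em
  open IntegralSolver (ring K̄)
  open import Relation.Binary.Reasoning.Setoid setoid

  private
    module _ (α : Carrier) where

      open L/K α public using (IsBasis; combination)

      L : Set u
      L = Σ Carrier (Adjoin α)

      powers : ℕ → L
      powers zero    = 1# , resp 1#-homo (base K.1#)
      powers (suc n) = let x , a = powers n in α * x , mul gen a

      combination-value : ∀ {n} c (b : Fin n → L) → proj₁ (combination c b) ≈ ∑ (λ i → ι (c i) * proj₁ (b i))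
      combination-value {zero}  c b = refl
      combination-value {suc n} c b = +-congˡ (combination-value (c ∘ suc) (b ∘ suc))

  -- The weight `w` accumulates the powers of `α` that Horner evaluation leaves implicit; the case
  -- `w = 1` is the one wanted.
  evaluate-tabulate : ∀ {n} (c : Fin n → K.Carrier) α w →
    ∑ (λ i → ι (c i) * (w * proj₁ (powers α (toℕ i)))) ≈ w * evaluate (tabulate c) α
  evaluate-tabulate {zero}  c α w = sym (zeroʳ w)
  evaluate-tabulate {suc n} c α w = begin
    ι (c zero) * (w * 1#) + ∑ (λ i → ι (c (suc i)) * (w * (α * proj₁ (powers α (toℕ i)))))
      ≈⟨ +-cong (*-congˡ (*-identityʳ w)) (sum-cong-≋ λ i → *-congˡ {ι (c (suc i))} (sym (*-assoc w α (proj₁ (powers α (toℕ i)))))) ⟩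
    ι (c zero) * w + ∑ (λ i → ι (c (suc i)) * ((w * α) * proj₁ (powers α (toℕ i))))
      ≈⟨ +-congˡ (evaluate-tabulate (c ∘ suc) α (w * α)) ⟩
    ι (c zero) * w + (w * α) * evaluate (tabulate (c ∘ suc)) α
      ≈⟨ solve 4 (λ c w a e → c :* w :+ (w :* a) :* e := w :* (c :+ a :* e)) refl _ w α _ ⟩
    w * (ι (c zero) + α * evaluate (tabulate (c ∘ suc)) α)   ∎

  evaluate-combination : ∀ {n} (c : Fin n → K.Carrier) α →
    proj₁ (combination α c (powers α ∘ toℕ)) ≈ evaluate (tabulate c) α
  evaluate-combination c α = begin
    proj₁ (combination α c (powers α ∘ toℕ))                  ≈⟨ combination-value α c (powers α ∘ toℕ) ⟩
    ∑ (λ i → ι (c i) * proj₁ (powers α (toℕ i)))            ≈⟨ sum-cong-≋ (λ i → *-congˡ {ι (c i)} (sym (*-identityˡ (proj₁ (powers α (toℕ i)))))) ⟩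
    ∑ (λ i → ι (c i) * (1# * proj₁ (powers α (toℕ i))))     ≈⟨ evaluate-tabulate c α 1# ⟩
    1# * evaluate (tabulate c) α                              ≈⟨ *-identityˡ _ ⟩
    evaluate (tabulate c) α                                   ∎

  tabulate-below : ∀ {n} (c : Fin n → K.Carrier) → Below (tabulate c) n
  tabulate-below {zero}  c = below-[]
  tabulate-below {suc n} c = below-∷ (tabulate-below (c ∘ suc))

  coeff-tabulate : ∀ {n} (c : Fin n → K.Carrier) i → coeff (tabulate c) (toℕ i) ≡ c i
  coeff-tabulate c zero    = ≡.refl
  coeff-tabulate c (suc i) = coeff-tabulate (c ∘ suc) i

  tabulate-coeff : ∀ {n} {f : Poly} → Below f n → tabulate {n = n} (coeff f ∘ toℕ) ≋ f
  tabulate-coeff {zero}  f₀ = ≋-sym (below-0⇒[] f₀)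
  tabulate-coeff {suc n} {[]}    f₀ = ∷≋[] K.refl (tabulate-coeff {n} {[]} below-[])
  tabulate-coeff {suc n} {a ∷ f} f₀ = ∷-cong K.refl (tabulate-coeff (below λ k n≤k → isBelow f₀ (suc k) (s≤s n≤k)))

  opaque
    -- The `m + 1` powers of `α` up to the exponent `m` lie in a space of dimension `m`; the
    -- coefficients of a linear dependence are those of the polynomial.
    annihilator : ∀ {α m} → Degree α m → ∃₂ λ g d → IsMonic g d × d ℕ.≤ m × evaluate g α ≈ 0#
    annihilator {α} {m} (b , basis) with K.dependent m (λ i → proj₁ (IsBasis.spanning basis (powers α (toℕ i))))
    ... | x , (i , xᵢ≉0) , e with K.normalise f≄[] (tabulate-below x)
      where
      f≄[] : ¬ (tabulate x ≋ [])
      f≄[] f≋[] = xᵢ≉0 (K.trans (K.reflexive (≡.sym (coeff-tabulate x i))) (coefficient f≋[] (toℕ i)))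
    ... | c , d , _ , g-monic , d<1+m =
      c ∙ tabulate x , d , g-monic , ℕ.s≤s⁻¹ d<1+m , trans (evaluate-∙ c (tabulate x) α) (trans (*-congˡ f[α]≈0) (zeroʳ _))
      where
      open IsBasis α basis
      A : Fin (suc m) → Fin m → K.Carrier
      A i = proj₁ (spanning (powers α (toℕ i)))
      sum-homo : ∀ {n} (t : Fin n → K.Carrier) → ι (K.∑ t) ≈ ∑ (ι ∘ t)
      sum-homo {zero}  t = 0#-homo
      sum-homo {suc n} t = trans (+-homo _ _) (+-congˡ (sum-homo (t ∘ suc)))
      column : ∀ j → ∑ (λ i → ι (x i) * (ι (A i j) * proj₁ (b j))) ≈ 0#
      column j = begin
        ∑ (λ i → ι (x i) * (ι (A i j) * proj₁ (b j)))
          ≈⟨ sum-cong-≋ (λ i → trans (sym (*-assoc (ι (x i)) (ι (A i j)) (proj₁ (b j)))) (*-congʳ (sym (*-homo (x i) (A i j))))) ⟩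
        ∑ (λ i → ι (x i K.* A i j) * proj₁ (b j))   ≈⟨ *-distribʳ-sum (proj₁ (b j)) (λ i → ι (x i K.* A i j)) ⟨
        ∑ (λ i → ι (x i K.* A i j)) * proj₁ (b j)   ≈⟨ *-congʳ (sum-homo (λ i → x i K.* A i j)) ⟨
        ι (K.∑ (λ i → x i K.* A i j)) * proj₁ (b j) ≈⟨ *-congʳ (trans (⟦⟧-cong (e j)) 0#-homo) ⟩
        0# * proj₁ (b j)                              ≈⟨ zeroˡ _ ⟩
        0#                                            ∎
      f[α]≈0 : evaluate (tabulate x) α ≈ 0#
      f[α]≈0 = begin
        evaluate (tabulate x) α                                             ≈⟨ evaluate-combination x α ⟨
        proj₁ (combination α x (powers α ∘ toℕ))                            ≈⟨ combination-value α x (powers α ∘ toℕ) ⟩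
        ∑ (λ i → ι (x i) * proj₁ (powers α (toℕ i)))
          ≈⟨ sum-cong-≋ (λ i → *-congˡ {ι (x i)} (trans (proj₂ (spanning (powers α (toℕ i)))) (combination-value α (A i) b))) ⟩
        ∑ (λ i → ι (x i) * ∑ (λ j → ι (A i j) * proj₁ (b j)))
          ≈⟨ sum-cong-≋ (λ i → *-distribˡ-sum (ι (x i)) (λ j → ι (A i j) * proj₁ (b j))) ⟩
        ∑ (λ i → ∑ (λ j → ι (x i) * (ι (A i j) * proj₁ (b j))))
          ≈⟨ ∑-comm (λ i j → ι (x i) * (ι (A i j) * proj₁ (b j))) ⟩
        ∑ (λ j → ∑ (λ i → ι (x i) * (ι (A i j) * proj₁ (b j))))         ≈⟨ sum-cong-≋ column ⟩
        ∑ {m} (λ j → 0#)                                                  ≈⟨ sum-replicate-zero m ⟩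
        0#                                                                  ∎

  private
    module MinimalPolynomial {b k P} (P-monic : IsMonic P k) (P[b]≈0 : evaluate P b ≈ 0#)
      (minimal : ∀ {g} → Below g k → evaluate g b ≈ 0# → g ≋ []) where

      remainder : ∀ g → ∃ λ r → Below r k × evaluate g b ≈ evaluate r b
      remainder g with divide P-monic g
      ... | q , r , e , r₀ = r , r₀ , (begin
        evaluate g b                                  ≈⟨ evaluate-cong b e ⟩
        evaluate (q ⊗ P ⊕ r) b                        ≈⟨ evaluate-⊕ (q ⊗ P) r b ⟩
        evaluate (q ⊗ P) b + evaluate r b             ≈⟨ +-congʳ (trans (evaluate-⊗ q P b) (trans (*-congˡ P[b]≈0) (zeroʳ _))) ⟩
        0# + evaluate r b                             ≈⟨ +-identityˡ _ ⟩
        evaluate r b                                  ∎)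

      -- `Adjoin` is closed under inverses, so K(b) = K[b] has to be proved. A Bézout identity
      -- inverts `g` modulo `P`; a proper factorisation of `P` is excluded, since one of the factors
      -- would vanish at `b` in degree below `k`.
      reciprocal : ∀ g {y} → evaluate g b * y ≈ 1# → ∃ λ h → y ≈ evaluate h b
      reciprocal g {y} gy≈1 with remainder g
      ... | r , r₀ , g≈r with K.normalise r≄[] r₀
        where
        r≄[] : ¬ (r ≋ [])
        r≄[] r≋[] = K̄.1≉0 (trans (sym gy≈1) (trans (*-congʳ (trans g≈r (evaluate-zero b r≋[]))) (zeroˡ y)))
      ... | c , D , _ , cr-monic , D<k = bezout-case g≈r c (K.bezout cr-monic P-monic D<k)
        where
        bezout-case : ∀ {r} → evaluate g b ≈ evaluate r b → ∀ c → 
          (∃₂ λ B h → P ≋ B ⊗ h × Below B k × Below h k) ⊎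
          (∃₂ λ s t → s ⊗ (c ∙ r) ⊕ t ⊗ P ≋ const K.1# × Below s k × Below t k) → ∃ λ h → y ≈ evaluate h b
        bezout-case g≈r c (inj₁ (B , h , P≋Bh , B₀ , h₀)) = contradiction P≋[] (K.monic≄[] P-monic)
          where
          P≋[] : P ≋ []
          P≋[] with em {P = evaluate B b ≈ 0#}
          ... | yes B[b]≈0 = ≋-trans P≋Bh (≋-trans (ᴾ.*-congʳ (minimal B₀ B[b]≈0)) (ᴾ.zeroˡ h))
          ... | no  B[b]≉0 = ≋-trans P≋Bh (≋-trans (ᴾ.*-congˡ (minimal h₀ (K̄.zero-product
            (trans (sym (evaluate-⊗ B h b)) (trans (evaluate-cong b (≋-sym P≋Bh)) P[b]≈0)) B[b]≉0))) (ᴾ.zeroʳ B))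
        bezout-case {r} g≈r c (inj₂ (s , t , e , _)) = s ⊗ const c , (begin
          y                                           ≈⟨ *-identityˡ y ⟨
          1# * y                                      ≈⟨ *-congʳ one ⟨
          evaluate s b * (ι c * evaluate r b) * y     ≈⟨ solve 4 (λ s c r y → s :* (c :* r) :* y := s :* c :* (r :* y)) refl (evaluate s b) (ι c) (evaluate r b) y ⟩
          evaluate s b * ι c * (evaluate r b * y)     ≈⟨ *-congˡ (trans (*-congʳ (sym g≈r)) gy≈1) ⟩
          evaluate s b * ι c * 1#                     ≈⟨ *-identityʳ _ ⟩
          evaluate s b * ι c                          ≈⟨ *-congˡ (evaluate-const c b) ⟨
          evaluate s b * evaluate (const c) b         ≈⟨ evaluate-⊗ s (const c) b ⟨
          evaluate (s ⊗ const c) b                    ∎)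
          where
          one : evaluate s b * (ι c * evaluate r b) ≈ 1#
          one = begin
            evaluate s b * (ι c * evaluate r b)       ≈⟨ *-congˡ (evaluate-∙ c r b) ⟨
            evaluate s b * evaluate (c ∙ r) b         ≈⟨ evaluate-⊗ s (c ∙ r) b ⟨
            evaluate (s ⊗ (c ∙ r)) b                  ≈⟨ +-identityʳ _ ⟨
            evaluate (s ⊗ (c ∙ r)) b + 0#             ≈⟨ +-congˡ (trans (evaluate-⊗ t P b) (trans (*-congˡ P[b]≈0) (zeroʳ _))) ⟨
            evaluate (s ⊗ (c ∙ r)) b + evaluate (t ⊗ P) b  ≈⟨ evaluate-⊕ (s ⊗ (c ∙ r)) (t ⊗ P) b ⟨
            evaluate (s ⊗ (c ∙ r) ⊕ t ⊗ P) b          ≈⟨ evaluate-cong b e ⟩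
            evaluate (const K.1#) b                   ≈⟨ trans (evaluate-const K.1# b) 1#-homo ⟩
            1#                                        ∎

      polynomial-in-b : ∀ {x} → Adjoin b x → ∃ λ g → x ≈ evaluate g b
      polynomial-in-b (base a)   = const a , sym (evaluate-const a b)
      polynomial-in-b gen        = X (const K.1#) , sym (trans (evaluate-X (const K.1#) b) (trans (*-congˡ (trans (evaluate-const K.1# b) 1#-homo)) (*-identityʳ b)))
      polynomial-in-b (add p q)  = let f , e = polynomial-in-b p ; g , e′ = polynomial-in-b q in
        f ⊕ g , trans (+-cong e e′) (sym (evaluate-⊕ f g b))
      polynomial-in-b (mul p q)  = let f , e = polynomial-in-b p ; g , e′ = polynomial-in-b q in
        f ⊗ g , trans (*-cong e e′) (sym (evaluate-⊗ f g b))
      polynomial-in-b (neg p)    = let f , e = polynomial-in-b p in ⊖ f , trans (-‿cong e) (sym (evaluate-⊖ f b))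
      polynomial-in-b (inv p e)  = let f , e′ = polynomial-in-b p in reciprocal f (trans (*-congʳ (sym e′)) e)
      polynomial-in-b (resp e p) = let f , e′ = polynomial-in-b p in f , trans (sym e) e′

      isBasis : IsBasis b {k} (powers b ∘ toℕ)
      isBasis = record
        { independent = λ c e i → K.trans (K.reflexive (≡.sym (coeff-tabulate c i)))
            (coefficient (minimal (tabulate-below c) (trans (sym (evaluate-combination c b)) e)) (toℕ i))
        ; spanning = λ (x , p) → span x (polynomial-in-b p) }
        where
        span : ∀ x → (∃ λ g → x ≈ evaluate g b) → ∃ λ (c : Fin k → K.Carrier) → x ≈ proj₁ (combination b {k} c (powers b ∘ toℕ))
        span x (g , x≈g) with remainder g
        ... | r , r₀ , g≈r = coeff r ∘ toℕ , (begin
          x                                                         ≈⟨ trans x≈g g≈r ⟩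
          evaluate r b                                              ≈⟨ evaluate-cong b (tabulate-coeff r₀) ⟨
          evaluate (tabulate {n = k} (coeff r ∘ toℕ)) b             ≈⟨ evaluate-combination {k} (coeff r ∘ toℕ) b ⟨
          proj₁ (combination b {k} (coeff r ∘ toℕ) (powers b ∘ toℕ))  ∎)

  opaque
    -- `Degree` asks for a basis of K(b). The powers of `b` below the least degree of a monic
    -- annihilator form one, and the normalisation of `f` bounds that degree.
    root-degree : ∀ {f k b} → ¬ (f ≋ []) → Below f k → evaluate f b ≈ 0# → ∃ λ d → Degree b d × d ℕ.< k
    root-degree {f} {k} {b} f≄[] f₀ f[b]≈0 with K.normalise f≄[] f₀
    ... | c , j , c≉0 , cf-monic , j<k
      with least (λ d → ∃ λ P → IsMonic P d × evaluate P b ≈ 0#) (j , c ∙ f , cf-monic , scale c f[b]≈0)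
      where
      scale : ∀ c {f} → evaluate f b ≈ 0# → evaluate (c ∙ f) b ≈ 0#
      scale c {f} e = trans (evaluate-∙ c f b) (trans (*-congˡ e) (zeroʳ _))
    ... | d , (P , P-monic , P[b]≈0) , least-d =
      d , (powers b ∘ toℕ , MinimalPolynomial.isBasis P-monic P[b]≈0 minimal) ,
      ℕ.≤-<-trans (ℕ.≮⇒≥ λ j<d → least-d j j<d (c ∙ f , cf-monic , scale c f[b]≈0)) j<k
      where
      scale : ∀ c {f} → evaluate f b ≈ 0# → evaluate (c ∙ f) b ≈ 0#
      scale c {f} e = trans (evaluate-∙ c f b) (trans (*-congˡ e) (zeroʳ _))
      minimal : ∀ {g} → Below g d → evaluate g b ≈ 0# → g ≋ []
      minimal {g} g₀ g[b]≈0 = dne λ g≄[] → smaller (K.normalise g≄[] g₀)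
        where
        smaller : ¬ (∃₂ λ a i → ¬ (a K.≈ K.0#) × IsMonic (a ∙ g) i × i ℕ.< d)
        smaller (a , i , _ , ag-monic , i<d) = least-d i i<d (a ∙ g , ag-monic , scale a g[b]≈0)

-- Graded algebras and key polynomials

module PolynomialValuations (em : ∀ {ℓ} → ExcludedMiddle ℓ) (𝕂 : ValuedField u) where

  open ValuedField 𝕂 using (K; Γ)
  open Theory 𝕂 using (Valuationˣ; _⟦_⟧; _≤ⱽ_; vᴷ; Homogeneous; homogeneous; IsKeyPolynomial; HasDegree; ∣𝒢∣; component; gradedAlgebra; initialPart; initialForm; I) renaming (module Homogeneous to H)
  open Extended Γ
  open ExtendedProperties Γ
  open Valuations Γ using (Valuation)
  open PolynomialRing (ring K)
  open FieldPolynomials em K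
  open Classical em
  private
    module Γ where
      open OrderedAbelianGroup Γ public
      open AbelianGroupProperties (OrderedAbelianGroup.abelianGroup Γ) public
      open IsAbelianGroup (OrderedAbelianGroup.isAbelianGroup Γ) public using (assoc; identityʳ; inverseˡ; ∙-congˡ; ∙-congʳ; ⁻¹-cong)
    module K = CommutativeRing (ring K)

  onPolynomials : Valuationˣ → Valuation (CommutativeRing.rawRing polynomials)
  onPolynomials μ = record
    { val    = μ ⟦_⟧
    ; cong   = λ e → μ.cong (coefficient e)
    ; zero-∞ = μ.zero-∞
    ; one-0  = μ.one-0
    ; *-homo = λ p q → ⁺.Eq.trans (⁺.Eq.reflexive (≡.cong (μ ⟦_⟧) (⊗-≡ p q))) (μ.*-homo p q)
    ; +-min  = λ p q → ⁺.trans (μ.+-min p q) (⁺.reflexive (⁺.Eq.reflexive (≡.cong (μ ⟦_⟧) (≡.sym (⊕-≡ p q)))))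
    }
    where module μ = Valuationˣ μ

  module Val (μ : Valuationˣ) where
    open ValuationProperties Γ polynomials (onPolynomials μ) public

    val-const : ∀ {c} → ¬ (c K.≈ K.0#) → Finite (μ ⟦ const c ⟧)
    val-const {c} c≉0 with inverse c≉0
    ... | d , dc≈1 = finite-+ʳ {μ ⟦ const d ⟧} (Γ.0# , ⁺.Eq.trans (⁺.Eq.sym (*-homo (const d) (const c)))
      (⁺.Eq.trans (val-cong (≋-trans (const-⊗ d (const c)) (≋-trans (∙-∷ d c []) (∷-cong dc≈1 (∙-[] d))))) one-0))

    val-∙ : ∀ c f → μ ⟦ c ∙ f ⟧ ≈⁺ vᴷ c +⁺ μ ⟦ f ⟧
    val-∙ c f = ⁺.Eq.trans (val-cong (≋-sym (const-⊗ c f))) (⁺.Eq.trans (*-homo (const c) f)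
      (+⁺-congʳ {μ ⟦ f ⟧} (Valuationˣ.extends μ c)))

  finite-vᴷ : ∀ (μ : Valuationˣ) {c} → ¬ (c K.≈ K.0#) → Finite (vᴷ c)
  finite-vᴷ μ c≉0 = ≈-finite (⁺.Eq.sym (Valuationˣ.extends μ _)) (Val.val-const μ c≉0)

  just-+-cancel : ∀ a b → just (a Γ.- b) +⁺ just b ≈⁺ just a
  just-+-cancel a b = [ Γ.Eq.trans (Γ.assoc a (Γ.- b) b) (Γ.Eq.trans (Γ.∙-congˡ (Γ.inverseˡ b)) (Γ.identityʳ a)) ]≈

  private
    module Graded (μ : Valuationˣ) where

      open Val μ
      open RawSemiring (gradedAlgebra μ) using (_≈_; _*_) renaming (1# to 1ᴳ)

      -- `initialForm f` does not reduce while the value of `f` is unknown; abstracting the value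
      -- and its bound permits the case distinction.
      view : ∀ f x p → (∃ λ c → x ≡ just c × ∃ λ q → initialPart μ f x p ≡ homogeneous c f q ∷ []) ⊎
                       (x ≡ nothing × initialPart μ f x p ≡ [])
      view f (just c) p = inj₁ (c , ≡.refl , p , ≡.refl)
      view f nothing  p = inj₂ (≡.refl , ≡.refl)

      -- Opaque for the same reason as the operations on polynomials.
      opaque
        part : Γ.Carrier → ∣𝒢∣ μ → Poly
        part = component μ

        part-≡ : ∀ δ x → part δ x ≡ component μ δ x
        part-≡ δ x = ≡.refl

        part-[] : ∀ δ → part δ [] ≋ []
        part-[] δ = ≋-refl

        part-∷-≈ : ∀ {δ} h x → H.degree h Γ.≈ δ → part δ (h ∷ x) ≋ H.representative h ⊕ part δ x
        part-∷-≈ {δ} h x e with H.degree h Γ.≟ δ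
        ... | yes _ = ≡⇒≋ (≡.sym (⊕-≡ _ _))
        ... | no ¬e = contradiction e ¬e

        part-∷-≉ : ∀ {δ} h x → ¬ (H.degree h Γ.≈ δ) → part δ (h ∷ x) ≋ part δ x
        part-∷-≉ {δ} h x ¬e with H.degree h Γ.≟ δ
        ... | yes e = contradiction e ¬e
        ... | no _  = ≋-refl

      difference-≡ : ∀ δ x y → component μ δ x -ᴾ component μ δ y ≡ part δ x ⊝ part δ y
      difference-≡ δ x y = ≡.trans (≡.cong₂ _-ᴾ_ (≡.sym (part-≡ δ x)) (≡.sym (part-≡ δ y)))
        (≡.trans (≡.cong (part δ x +ᴾ_) (≡.sym (⊖-≡ (part δ y)))) (≡.sym (⊕-≡ (part δ x) (⊖ part δ y))))

      part-cong : ∀ x {δ ε} → δ Γ.≈ ε → part δ x ≋ part ε x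
      part-cong []      {δ} {ε} e = ≋-trans (part-[] δ) (≋-sym (part-[] ε))
      part-cong (h ∷ x) {δ} {ε} e with em {P = H.degree h Γ.≈ δ}
      ... | yes p = ≋-trans (part-∷-≈ h x p) (≋-trans (ᴾ.+-congˡ (part-cong x e))
                      (≋-sym (part-∷-≈ h x (Γ.Eq.trans p e))))
      ... | no ¬p = ≋-trans (part-∷-≉ h x ¬p) (≋-trans (part-cong x e)
                      (≋-sym (part-∷-≉ h x λ q → ¬p (Γ.Eq.trans q (Γ.Eq.sym e)))))

      part-bound : ∀ δ x → just δ ≤⁺ μ ⟦ part δ x ⟧
      part-bound δ []      = ⁺.trans ≤⊤ (⁺.reflexive (⁺.Eq.sym (⁺.Eq.trans (val-cong (part-[] δ)) zero-∞)))
      part-bound δ (h ∷ x) with em {P = H.degree h Γ.≈ δ}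
      ... | yes p = ⁺.trans (≤-val-+ (⁺.trans (⁺.reflexive [ Γ.Eq.sym p ]≈) (H.bound h)) (part-bound δ x))
                      (⁺.reflexive (val-cong (≋-sym (part-∷-≈ h x p))))
      ... | no ¬p = ⁺.trans (part-bound δ x) (⁺.reflexive (val-cong (≋-sym (part-∷-≉ h x ¬p))))

      part-++ : ∀ δ x y → part δ (x ++ y) ≋ part δ x ⊕ part δ y
      part-++ δ []      y = ≋-sym (≋-trans (ᴾ.+-congʳ (part-[] δ)) (ᴾ.+-identityˡ _))
      part-++ δ (h ∷ x) y with em {P = H.degree h Γ.≈ δ}
      ... | yes p = ≋-trans (part-∷-≈ h (x ++ y) p) (≋-trans (ᴾ.+-congˡ (part-++ δ x y))
                      (≋-trans (≋-sym (ᴾ.+-assoc _ _ _)) (ᴾ.+-congʳ (≋-sym (part-∷-≈ h x p)))))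
      ... | no ¬p = ≋-trans (part-∷-≉ h (x ++ y) ¬p) (≋-trans (part-++ δ x y)
                      (ᴾ.+-congʳ (≋-sym (part-∷-≉ h x ¬p))))

      shift-≈ : ∀ {a b δ} → a Γ.+ b Γ.≈ δ → b Γ.≈ δ Γ.- a
      shift-≈ {a} {b} {δ} e = Γ.Eq.trans (Γ.Eq.sym (Γ.xyx⁻¹≈y a b)) (Γ.∙-congʳ e)

      unshift-≈ : ∀ {a b δ} → b Γ.≈ δ Γ.- a → a Γ.+ b Γ.≈ δ
      unshift-≈ {a} {b} {δ} e = Γ.Eq.trans (Γ.∙-congˡ e) (Γ.Eq.trans (Γ.Eq.sym (Γ.assoc a δ (Γ.- a))) (Γ.xyx⁻¹≈y a δ))

      part-scale : ∀ δ h y → part δ (map (Theory._·ᴳ_ 𝕂 μ h) y) ≋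
                        H.representative h ⊗ part (δ Γ.- H.degree h) y
      part-scale δ h []      = ≋-trans (part-[] δ) (≋-sym (≋-trans (ᴾ.*-congˡ (part-[] _)) (ᴾ.zeroʳ _)))
      part-scale δ h (k ∷ y) with em {P = H.degree h Γ.+ H.degree k Γ.≈ δ}
      ... | yes p = ≋-trans (part-∷-≈ (Theory._·ᴳ_ 𝕂 μ h k) _ p) (≋-trans
                      (ᴾ.+-cong (≡⇒≋ (≡.sym (⊗-≡ _ _))) (part-scale δ h y))
                      (≋-trans (≋-sym (ᴾ.distribˡ _ _ _)) (ᴾ.*-congˡ (≋-sym (part-∷-≈ k y (shift-≈ p))))))
      ... | no ¬p = ≋-trans (part-∷-≉ (Theory._·ᴳ_ 𝕂 μ h k) _ ¬p) (≋-trans (part-scale δ h y)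
                      (ᴾ.*-congˡ (≋-sym (part-∷-≉ k y (¬p ∘ unshift-≈)))))

      part-singleton : ∀ δ h y → part δ ((h ∷ []) * y) ≋ H.representative h ⊗ part (δ Γ.- H.degree h) y
      part-singleton δ h y = ≋-trans (part-++ δ _ [])
        (≋-trans (ᴾ.+-congˡ (part-[] δ)) (≋-trans (ᴾ.+-identityʳ _) (part-scale δ h y)))

      -- The component of degree σ of the product of x with the element
      -- whose components are given by Y.
      convolution : ∣𝒢∣ μ → (Γ.Carrier → Poly) → Γ.Carrier → Poly
      convolution []      Y σ = []
      convolution (h ∷ x) Y σ = H.representative h ⊗ Y (σ Γ.- H.degree h) ⊕ convolution x Y σ

      part-* : ∀ σ x y → part σ (x * y) ≋ convolution x (λ τ → part τ y) σ
      part-* σ []      y = part-[] σ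
      part-* σ (h ∷ x) y = ≋-trans (part-++ σ _ (x * y)) (ᴾ.+-cong (part-scale σ h y) (part-* σ x y))

      -- A formal sum may list several summands of one degree, and only their total is meaningful.
      -- Removing them together lets an induction on the length treat one degree at a time.
      without : Γ.Carrier → ∣𝒢∣ μ → ∣𝒢∣ μ
      without δ []      = []
      without δ (h ∷ x) with H.degree h Γ.≟ δ
      ... | yes _ = without δ x
      ... | no  _ = h ∷ without δ x

      without-length : ∀ δ x → length (without δ x) ℕ.≤ length x
      without-length δ []      = z≤n
      without-length δ (h ∷ x) with H.degree h Γ.≟ δ
      ... | yes _ = ℕ.m≤n⇒m≤1+n (without-length δ x)
      ... | no  _ = s≤s (without-length δ x)

      without-head : ∀ h x → length (without (H.degree h) (h ∷ x)) ℕ.≤ length x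
      without-head h x with H.degree h Γ.≟ H.degree h
      ... | yes _ = without-length _ x
      ... | no ¬p = contradiction Γ.Eq.refl ¬p

      part-without-≈ : ∀ δ x → part δ (without δ x) ≋ []
      part-without-≈ δ []      = part-[] δ
      part-without-≈ δ (h ∷ x) with H.degree h Γ.≟ δ
      ... | yes _ = part-without-≈ δ x
      ... | no ¬p = ≋-trans (part-∷-≉ h _ ¬p) (part-without-≈ δ x)

      part-without-≉ : ∀ {δ τ} x → ¬ (τ Γ.≈ δ) → part τ (without δ x) ≋ part τ x
      part-without-≉ {δ} {τ} []      τ≉δ = ≋-refl
      part-without-≉ {δ} {τ} (h ∷ x) τ≉δ with H.degree h Γ.≟ δ
      ... | yes p = ≋-trans (part-without-≉ x τ≉δ) (≋-sym (part-∷-≉ h x λ q → τ≉δ (Γ.Eq.trans (Γ.Eq.sym q) p)))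
      ... | no _ with em {P = H.degree h Γ.≈ τ}
      ...   | yes q = ≋-trans (part-∷-≈ h _ q) (≋-trans (ᴾ.+-congˡ (part-without-≉ x τ≉δ)) (≋-sym (part-∷-≈ h x q)))
      ...   | no ¬q = ≋-trans (part-∷-≉ h _ ¬q) (≋-trans (part-without-≉ x τ≉δ) (≋-sym (part-∷-≉ h x ¬q)))

      convolution-split : ∀ δ x {Y} σ → (∀ {a b} → a Γ.≈ b → Y a ≋ Y b) →
        convolution x Y σ ≋ part δ x ⊗ Y (σ Γ.- δ) ⊕ convolution (without δ x) Y σ
      convolution-split δ []      {Y} σ Y-cong = ≋-sym (≋-trans (ᴾ.+-identityʳ _) (≋-trans (ᴾ.*-congʳ (part-[] δ)) (ᴾ.zeroˡ _)))
      convolution-split δ (h ∷ x) {Y} σ Y-cong with H.degree h Γ.≟ δ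
      ... | yes p = ≋-trans (ᴾ.+-cong (ᴾ.*-congˡ (Y-cong (Γ.∙-congˡ (Γ.⁻¹-cong p)))) (convolution-split δ x σ Y-cong))
        (≋-trans (ᴾ.solve 4 (λ r y c s → r ᴾ.:* y ᴾ.:+ (c ᴾ.:* y ᴾ.:+ s) ᴾ.:= (r ᴾ.:+ c) ᴾ.:* y ᴾ.:+ s) ≋-refl
            (H.representative h) (Y (σ Γ.- δ)) (part δ x) (convolution (without δ x) Y σ))
          (ᴾ.+-congʳ (ᴾ.*-congʳ (≋-sym (part-∷-≈ h x p)))))
      ... | no ¬p = ≋-trans (ᴾ.+-congˡ (convolution-split δ x σ Y-cong))
        (≋-trans (ᴾ.solve 3 (λ a b c → a ᴾ.:+ (b ᴾ.:+ c) ᴾ.:= b ᴾ.:+ (a ᴾ.:+ c)) ≋-refl _ _ _)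
          (ᴾ.+-congʳ (ᴾ.*-congʳ (≋-sym (part-∷-≉ h x ¬p)))))

  -- `ψ` has the least degree in which a value grows from `ρ` to `ρ′`. It is a key polynomial for
  -- `ρ` because the kernel of the induced map of graded algebras is prime and, by division with
  -- remainder, generated by the initial form of `ψ`.
  module MinimalJump (ρ ρ′ : Valuationˣ) (ρ≤ρ′ : ρ ≤ⱽ ρ′) {ψ d} (ψ-monic : IsMonic ψ d)
    (agree : ∀ {f} → Below f d → ρ ⟦ f ⟧ ≈⁺ ρ′ ⟦ f ⟧) (jump : ρ ⟦ ψ ⟧ <⁺ ρ′ ⟦ ψ ⟧) where

    private
      module ρ = Val ρ
      module ρ′ = Val ρ′
      open Graded ρ
      open RawSemiring (gradedAlgebra ρ) using (_≈_; _*_; 0#) renaming (1# to 1ᴳ)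

    -- If `q ψ` had a smaller value than `f`, its value would be that of `r` under `ρ`. Under `ρ′`
    -- both `q ψ` and `f` exceed this value, hence so does `r`, against the agreement below degree
    -- `d`.
    quotient-bound : ∀ {f q r} → f ≋ q ⊗ ψ ⊕ r → Below r d → ρ ⟦ f ⟧ ≤⁺ ρ ⟦ q ⟧ +⁺ ρ ⟦ ψ ⟧
    quotient-bound {f} {q} {r} f≋ r₀ = ≮⇒≥ λ qψ<f →
      let open ⁺-Reasoning
          below-f : ρ ⟦ q ⊗ ψ ⟧ <⁺ ρ ⟦ f ⟧
          below-f = proj₂ <-resp-≈ (⁺.Eq.sym (ρ.*-homo q ψ)) qψ<f
          r≋ : ⊖ (q ⊗ ψ) ⊕ f ≋ r
          r≋ = ≋-trans (ᴾ.+-congˡ f≋) (ᴾ.solve 2 (λ a b → ᴾ.:- a ᴾ.:+ (a ᴾ.:+ b) ᴾ.:= b) ≋-refl (q ⊗ ψ) r)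
      in <-irrefl ⁺.Eq.refl (begin-strict
        ρ ⟦ q ⊗ ψ ⟧      <⟨ ρ′.<-val-+ (begin-strict
            ρ ⟦ q ⊗ ψ ⟧              ≈⟨ ρ.*-homo q ψ ⟩
            ρ ⟦ q ⟧ +⁺ ρ ⟦ ψ ⟧       <⟨ +⁺-mono-≤-< (finite-+ˡ (<⇒finite qψ<f)) (ρ≤ρ′ q) jump ⟩
            ρ′ ⟦ q ⟧ +⁺ ρ′ ⟦ ψ ⟧     ≈⟨ ρ′.*-homo q ψ ⟨
            ρ′ ⟦ q ⊗ ψ ⟧             ≈⟨ ρ′.val-neg (q ⊗ ψ) ⟨
            ρ′ ⟦ ⊖ (q ⊗ ψ) ⟧         ∎)
          (<-≤-trans below-f (ρ≤ρ′ f)) ⟩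
        ρ′ ⟦ ⊖ (q ⊗ ψ) ⊕ f ⟧   ≈⟨ ρ′.val-cong r≋ ⟩
        ρ′ ⟦ r ⟧               ≈⟨ agree r₀ ⟨
        ρ ⟦ r ⟧                ≈⟨ ρ.val-cong r≋ ⟨
        ρ ⟦ ⊖ (q ⊗ ψ) ⊕ f ⟧    ≈⟨ ρ.val-+-dominant (proj₂ <-resp-≈ (⁺.Eq.sym (ρ.val-neg (q ⊗ ψ))) below-f) ⟩
        ρ ⟦ ⊖ (q ⊗ ψ) ⟧        ≈⟨ ρ.val-neg (q ⊗ ψ) ⟩
        ρ ⟦ q ⊗ ψ ⟧            ∎)

    -- `ρ` may have a nonzero support. If `f` belonged to it, then for `ρ` and `ρ′` alike `ψ` would
    -- have the value of its remainder modulo `f`, on which the two agree, and `ψ` could not jump.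
    finite-below : ∀ {f} → ¬ (f ≋ []) → Below f d → Finite (ρ ⟦ f ⟧)
    finite-below {f} f≄[] f₀ = dne λ ¬finite → go ¬finite (normalise f≄[] f₀)
      where
      go : ¬ Finite (ρ ⟦ f ⟧) → ¬ (∃₂ λ c i → ¬ (c K.≈ K.0#) × IsMonic (c ∙ f) i × i ℕ.< d)
      go ¬finite (c , i , _ , cf-monic , i<d) with divide cf-monic ψ
      ... | q , r , ψ≋ , r₀ = <-irrefl ⁺.Eq.refl (begin-strict
        ρ ⟦ ψ ⟧     <⟨ jump ⟩
        ρ′ ⟦ ψ ⟧    ≤⟨ ρ′.≤-val-+ ⁺.refl (⁺.trans ≤⊤ (⁺.reflexive (⁺.Eq.sym (vanishes ρ′ f′)))) ⟩
        ρ′ ⟦ ψ ⊕ ⊖ (q ⊗ (c ∙ f)) ⟧  ≈⟨ ρ′.val-cong r≋ ⟩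
        ρ′ ⟦ r ⟧    ≈⟨ agree (below-weaken (ℕ.<⇒≤ i<d) r₀) ⟨
        ρ ⟦ r ⟧     ≈⟨ ρ.val-cong r≋ ⟨
        ρ ⟦ ψ ⊕ ⊖ (q ⊗ (c ∙ f)) ⟧   ≈⟨ ρ.val-+-dominant (<-≤-trans (finite⇒<⊤ (<⇒finite jump)) (⁺.reflexive (⁺.Eq.sym (vanishes ρ (infinite ¬finite))))) ⟩
        ρ ⟦ ψ ⟧     ∎)
        where
        open ⁺-Reasoning
        r≋ : ψ ⊕ ⊖ (q ⊗ (c ∙ f)) ≋ r
        r≋ = ≋-trans (ᴾ.+-congʳ ψ≋) (ᴾ.solve 2 (λ a b → (a ᴾ.:+ b) ᴾ.:+ ᴾ.:- a ᴾ.:= b) ≋-refl (q ⊗ (c ∙ f)) r)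
        f′ : ρ′ ⟦ f ⟧ ≈⁺ ⊤⁺
        f′ = ⁺.Eq.trans (⁺.Eq.sym (agree f₀)) (infinite ¬finite)
        vanishes : ∀ μ → μ ⟦ f ⟧ ≈⁺ ⊤⁺ → μ ⟦ ⊖ (q ⊗ (c ∙ f)) ⟧ ≈⁺ ⊤⁺
        vanishes μ e = ⁺.Eq.trans (Val.val-neg μ (q ⊗ (c ∙ f))) (⁺.Eq.trans (Val.*-homo μ q (c ∙ f)) (⁺.Eq.trans
          (+⁺-congˡ {μ ⟦ q ⟧} (⁺.Eq.trans (Val.val-∙ μ c f) (⁺.Eq.trans (+⁺-congˡ {vᴷ c} e) (+⁺-⊤ (vᴷ c))))) (+⁺-⊤ (μ ⟦ q ⟧))))

    -- The kernel of the homomorphism from the graded algebra of ρ to that of ρ′.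
    Kernel : ∣𝒢∣ ρ → Set u
    Kernel x = ∀ δ → just δ <⁺ ρ′ ⟦ part δ x ⟧

    private
      bound′ : ∀ δ x → just δ ≤⁺ ρ′ ⟦ part δ x ⟧
      bound′ δ x = ⁺.trans (part-bound δ x) (ρ≤ρ′ _)

      ∞-bound : ∀ {δ f} → f ≋ [] → just δ <⁺ ρ′ ⟦ f ⟧
      ∞-bound {δ} e = <-≤-trans [ δ ]<⊤⁺ (⁺.reflexive (⁺.Eq.sym (⁺.Eq.trans (ρ′.val-cong e) ρ′.zero-∞)))

      opaque
        initialForm-ψ : ∃ λ e → ρ ⟦ ψ ⟧ ≡ just e × ∃ λ p → initialForm ρ ψ ≡ homogeneous e ψ p ∷ []
        initialForm-ψ with view ψ (ρ ⟦ ψ ⟧) ⁺.refl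
        ... | inj₁ v       = v
        ... | inj₂ (e , _) = ⊥-elim (<⇒≱ (≡.subst (_<⁺ ρ′ ⟦ ψ ⟧) e jump) ≤⊤)

      e : Γ.Carrier
      e = proj₁ initialForm-ψ

      ρψ≈e : ρ ⟦ ψ ⟧ ≈⁺ just e
      ρψ≈e = ⁺.Eq.reflexive (proj₁ (proj₂ initialForm-ψ))

      ψᴳ : Homogeneous ρ
      ψᴳ = homogeneous e ψ (proj₁ (proj₂ (proj₂ initialForm-ψ)))

      component-multiple : ∀ δ y → part δ (initialForm ρ ψ * y) ≋ ψ ⊗ part (δ Γ.- e) y
      component-multiple δ y = ≋-trans (≡⇒≋ (≡.cong (λ x → part δ (x * y)) (proj₂ (proj₂ (proj₂ initialForm-ψ)))))
        (part-singleton δ ψᴳ y)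

    ideal⇒kernel : ∀ {x} → I ρ ψ x → Kernel x
    ideal⇒kernel {x} (y , x≈ψy) δ = <-≤-trans (ρ′.<-val-+ difference multiple) (⁺.reflexive (ρ′.val-cong
        (ᴾ.solve 2 (λ a b → (a ᴾ.:- b) ᴾ.:+ b ᴾ.:= a) ≋-refl _ (part δ (initialForm ρ ψ * y)))))
      where
      open ⁺-Reasoning
      difference : just δ <⁺ ρ′ ⟦ part δ x ⊝ part δ (initialForm ρ ψ * y) ⟧
      difference = <-≤-trans (x≈ψy δ) (⁺.trans (⁺.reflexive (⁺.Eq.reflexive (≡.cong (ρ ⟦_⟧)
        (difference-≡ δ x (initialForm ρ ψ * y))))) (ρ≤ρ′ _))
      multiple : just δ <⁺ ρ′ ⟦ part δ (initialForm ρ ψ * y) ⟧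
      multiple = begin-strict
        just δ                                        ≈⟨ just-+-cancel δ e ⟨
        just (δ Γ.- e) +⁺ just e                      <⟨ +⁺-mono-≤-< (_ , ⁺.Eq.refl) (bound′ (δ Γ.- e) y) (proj₂ <-resp-≈ ρψ≈e jump) ⟩
        ρ′ ⟦ part (δ Γ.- e) y ⟧ +⁺ ρ′ ⟦ ψ ⟧    ≈⟨ ρ′.*-homo _ ψ ⟨
        ρ′ ⟦ part (δ Γ.- e) y ⊗ ψ ⟧            ≈⟨ ρ′.val-cong (ᴾ.*-comm _ ψ) ⟩
        ρ′ ⟦ ψ ⊗ part (δ Γ.- e) y ⟧            ≈⟨ ρ′.val-cong (component-multiple δ y) ⟨
        ρ′ ⟦ part δ (initialForm ρ ψ * y) ⟧    ∎

    private
      division : ∀ h → ∃₂ λ q r → H.representative {μ = ρ} h ≋ q ⊗ ψ ⊕ r × Below r d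
      division h = divide ψ-monic (H.representative h)

      opaque
        quotient-≥ : ∀ h → just (H.degree h Γ.- e) ≤⁺ ρ ⟦ proj₁ (division h) ⟧
        quotient-≥ h with division h
        ... | q , r , f≋ , r₀ = +⁺-cancelʳ (e , ⁺.Eq.refl) (begin
          just (H.degree h Γ.- e) +⁺ just e    ≈⟨ just-+-cancel (H.degree h) e ⟩
          just (H.degree h)                    ≤⟨ H.bound h ⟩
          ρ ⟦ H.representative h ⟧             ≤⟨ quotient-bound f≋ r₀ ⟩
          ρ ⟦ q ⟧ +⁺ ρ ⟦ ψ ⟧                   ≈⟨ +⁺-congˡ {ρ ⟦ q ⟧} ρψ≈e ⟩
          ρ ⟦ q ⟧ +⁺ just e                    ∎)
          where open ⁺-Reasoning

      quotient : Homogeneous ρ → Homogeneous ρ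
      quotient h = homogeneous (H.degree h Γ.- e) (proj₁ (division h)) (quotient-≥ h)

      Divided : Γ.Carrier → ∣𝒢∣ ρ → Set u
      Divided δ x = ∃ λ r → part δ x ≋ part (δ Γ.- e) (map quotient x) ⊗ ψ ⊕ r × Below r d

      opaque
        divided-[] : ∀ δ → Divided δ []
        divided-[] δ = [] , ≋-trans (part-[] δ) (≋-sym (≋-trans (ᴾ.+-identityʳ _) (≋-trans (ᴾ.*-congʳ (part-[] (δ Γ.- e))) (ᴾ.zeroˡ ψ)))) , below-[]

        divided-no : ∀ {δ} h x → ¬ (H.degree h Γ.≈ δ) → Divided δ x → Divided δ (h ∷ x)
        divided-no {δ} h x ¬p (r , x≋ , r₀) = r , ≋-trans (part-∷-≉ h x ¬p) (≋-trans x≋ (ᴾ.+-congʳ (ᴾ.*-congʳ (≋-sym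
          (part-∷-≉ (quotient h) (map quotient x) (λ q → ¬p (Γ.∙-cancelʳ (Γ.- e) _ _ q))))))) , r₀

        divided-yes : ∀ {δ} h x → H.degree h Γ.≈ δ → Divided δ x → Divided δ (h ∷ x)
        divided-yes {δ} h x p (r , x≋ , r₀) = s ⊕ r , x′≋ , below-⊕ (proj₂ (proj₂ (proj₂ (division h)))) r₀
          where
          q s c : Poly
          q = proj₁ (division h)
          s = proj₁ (proj₂ (division h))
          c = part (δ Γ.- e) (map quotient x)
          h≋ : H.representative h ≋ q ⊗ ψ ⊕ s
          h≋ = proj₁ (proj₂ (proj₂ (division h)))
          x′≋ : part δ (h ∷ x) ≋ part (δ Γ.- e) (quotient h ∷ map quotient x) ⊗ ψ ⊕ (s ⊕ r)
          x′≋ = begin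
            part δ (h ∷ x)                       ≈⟨ part-∷-≈ h x p ⟩
            H.representative h ⊕ part δ x        ≈⟨ ᴾ.+-cong h≋ x≋ ⟩
            (q ⊗ ψ ⊕ s) ⊕ (c ⊗ ψ ⊕ r)
              ≈⟨ ᴾ.solve 5 (λ q ψ s c r → (q ᴾ.:* ψ ᴾ.:+ s) ᴾ.:+ (c ᴾ.:* ψ ᴾ.:+ r) ᴾ.:= (q ᴾ.:+ c) ᴾ.:* ψ ᴾ.:+ (s ᴾ.:+ r)) ≋-refl q ψ s c r ⟩
            (q ⊕ c) ⊗ ψ ⊕ (s ⊕ r)                ≈⟨ ᴾ.+-congʳ (ᴾ.*-congʳ (part-∷-≈ (quotient h) (map quotient x) (Γ.∙-congʳ p))) ⟨
            part (δ Γ.- e) (quotient h ∷ map quotient x) ⊗ ψ ⊕ (s ⊕ r)   ∎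
            where open import Relation.Binary.Reasoning.Setoid ᴾ.setoid

      divide-component : ∀ δ x → Divided δ x
      divide-component δ []      = divided-[] δ
      divide-component δ (h ∷ x) with em {P = H.degree h Γ.≈ δ}
      ... | no ¬p = divided-no h x ¬p (divide-component δ x)
      ... | yes p = divided-yes h x p (divide-component δ x)

    -- Dividing every summand by `ψ` leaves a remainder of degree below `d` in each component. Its
    -- `ρ′`-value exceeds the degree of the component, since this holds for the component of `x` and
    -- for the multiple of `ψ`; and `ρ` gives the remainder the same value.
    kernel⇒ideal : ∀ {x} → Kernel x → I ρ ψ x
    kernel⇒ideal {x} x∈ker = map quotient x , λ δ → difference δ (divide-component δ x)
      where
      difference : ∀ δ → (∃ λ r → part δ x ≋ part (δ Γ.- e) (map quotient x) ⊗ ψ ⊕ r × Below r d) →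
                   just δ <⁺ ρ ⟦ component ρ δ x -ᴾ component ρ δ (initialForm ρ ψ * map quotient x) ⟧
      difference δ (r , x≋ , r₀) = begin-strict
        just δ                                           <⟨ ρ′.<-val-sub (x∈ker δ) (proj₁ <-resp-≈ (ρ′.val-cong (≋-trans (component-multiple δ _) (ᴾ.*-comm ψ _)))
                                                              (ideal⇒kernel {initialForm ρ ψ * map quotient x} (map quotient x , reflexiveᴳ) δ)) ⟩
        ρ′ ⟦ part δ x ⊝ c ⊗ ψ ⟧                   ≈⟨ ρ′.val-cong r≋ ⟩
        ρ′ ⟦ r ⟧                                         ≈⟨ agree r₀ ⟨
        ρ ⟦ r ⟧                                          ≈⟨ ρ.val-cong r≋ ⟨
        ρ ⟦ part δ x ⊝ c ⊗ ψ ⟧                    ≈⟨ ρ.val-cong (ᴾ.+-congˡ (ᴾ.-‿cong (≋-trans (component-multiple δ _) (ᴾ.*-comm ψ c)))) ⟨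
        ρ ⟦ part δ x ⊝ part δ (initialForm ρ ψ * map quotient x) ⟧
          ≈⟨ ⁺.Eq.reflexive (≡.cong (ρ ⟦_⟧) (difference-≡ δ x (initialForm ρ ψ * map quotient x))) ⟨
        ρ ⟦ component ρ δ x -ᴾ component ρ δ (initialForm ρ ψ * map quotient x) ⟧  ∎
        where
        open ⁺-Reasoning
        c : Poly
        c = part (δ Γ.- e) (map quotient x)
        r≋ : part δ x ⊝ c ⊗ ψ ≋ r
        r≋ = ≋-trans (ᴾ.+-congʳ x≋) (ᴾ.solve 2 (λ a b → (a ᴾ.:+ b) ᴾ.:- a ᴾ.:= b) ≋-refl (c ⊗ ψ) r)
        reflexiveᴳ : initialForm ρ ψ * map quotient x ≈ initialForm ρ ψ * map quotient x
        reflexiveᴳ δ = <-≤-trans [ δ ]<⊤⁺ (⁺.reflexive (⁺.Eq.sym (⁺.Eq.trans (⁺.Eq.reflexive (≡.cong (ρ ⟦_⟧)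
          (difference-≡ δ (initialForm ρ ψ * map quotient x) (initialForm ρ ψ * map quotient x))))
          (⁺.Eq.trans (ρ.val-cong (ᴾ.-‿inverseʳ _)) ρ.zero-∞))))

    private
      module Product {Y : Γ.Carrier → Poly} (Y-cong : ∀ {a b} → a Γ.≈ b → Y a ≋ Y b)
        (Y-bound : ∀ τ → just τ ≤⁺ ρ′ ⟦ Y τ ⟧) where

        term : ∀ x τ σ → (just τ <⁺ ρ′ ⟦ part τ x ⟧) ⊎ (just (σ Γ.- τ) <⁺ ρ′ ⟦ Y (σ Γ.- τ) ⟧) →
               just σ <⁺ ρ′ ⟦ part τ x ⊗ Y (σ Γ.- τ) ⟧
        term x τ σ c = begin-strict
          just σ                                            ≈⟨ just-+-cancel σ τ ⟨
          just (σ Γ.- τ) +⁺ just τ                          ≈⟨ +⁺-comm (just (σ Γ.- τ)) (just τ) ⟩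
          just τ +⁺ just (σ Γ.- τ)                          <⟨ cases c ⟩
          ρ′ ⟦ part τ x ⟧ +⁺ ρ′ ⟦ Y (σ Γ.- τ) ⟧      ≈⟨ ρ′.*-homo _ _ ⟨
          ρ′ ⟦ part τ x ⊗ Y (σ Γ.- τ) ⟧              ∎
          where
          open ⁺-Reasoning
          cases : (just τ <⁺ ρ′ ⟦ part τ x ⟧) ⊎ (just (σ Γ.- τ) <⁺ ρ′ ⟦ Y (σ Γ.- τ) ⟧) →
                  just τ +⁺ just (σ Γ.- τ) <⁺ ρ′ ⟦ part τ x ⟧ +⁺ ρ′ ⟦ Y (σ Γ.- τ) ⟧
          cases (inj₁ p) = +⁺-mono-<-≤ (_ , ⁺.Eq.refl) p (Y-bound _)
          cases (inj₂ p) = +⁺-mono-≤-< (_ , ⁺.Eq.refl) (bound′ τ x) p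

        -- Only a whole component is known to gain value, not the representative of a single
        -- summand. So the summands of the head's degree are taken together and removed, and the
        -- recursion runs on a bound for the length.
        convolution-< : ∀ n x σ → length x ℕ.≤ n →
          (∀ τ → (just τ <⁺ ρ′ ⟦ part τ x ⟧) ⊎ (just (σ Γ.- τ) <⁺ ρ′ ⟦ Y (σ Γ.- τ) ⟧)) →
          just σ <⁺ ρ′ ⟦ convolution x Y σ ⟧
        convolution-< n       []      σ _       c = ∞-bound {σ} {[]} ≋-refl
        convolution-< (suc n) (h ∷ x) σ (s≤s l) c = <-≤-trans
          (ρ′.<-val-+ (term (h ∷ x) (H.degree h) σ (c (H.degree h)))
            (convolution-< n (without (H.degree h) (h ∷ x)) σ (ℕ.≤-trans (without-head h x) l) rest))
          (⁺.reflexive (ρ′.val-cong (≋-sym (convolution-split (H.degree h) (h ∷ x) σ Y-cong))))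
          where
          rest : ∀ τ → (just τ <⁺ ρ′ ⟦ part τ (without (H.degree h) (h ∷ x)) ⟧) ⊎ (just (σ Γ.- τ) <⁺ ρ′ ⟦ Y (σ Γ.- τ) ⟧)
          rest τ with em {P = τ Γ.≈ H.degree h} | c τ
          ... | yes p | _ = inj₁ (∞-bound (≋-trans (part-cong (without (H.degree h) (h ∷ x)) p) (part-without-≈ (H.degree h) (h ∷ x))))
          ... | no ¬p | inj₁ q = inj₁ (<-≤-trans q (⁺.reflexive (ρ′.val-cong (≋-sym (part-without-≉ (h ∷ x) ¬p)))))
          ... | no ¬p | inj₂ q = inj₂ q

      -- The degrees in which the image of `x` in the graded algebra of `ρ′` is nonzero.
      Bad : ∣𝒢∣ ρ → Γ.Carrier → Set u
      Bad x δ = ¬ (just δ <⁺ ρ′ ⟦ part δ x ⟧)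

      bad-cong : ∀ {x δ ε} → δ Γ.≈ ε → Bad x δ → Bad x ε
      bad-cong {x} p b q = b (≤-<-trans (⁺.reflexive [ p ]≈) (<-≤-trans q (⁺.reflexive (ρ′.val-cong (part-cong x (Γ.Eq.sym p))))))

      part∈degrees : ∀ y {δ} → ¬ (part δ y ≋ []) → Any (λ h → H.degree h Γ.≈ δ) y
      part∈degrees []      {δ} c = contradiction (part-[] δ) c
      part∈degrees (h ∷ y) {δ} c with em {P = H.degree h Γ.≈ δ}
      ... | yes p = here p
      ... | no ¬p = there (part∈degrees y λ q → c (≋-trans (part-∷-≉ h y ¬p) q))

      -- Only degrees that occur in the list can be bad, all other components being zero, so the
      -- minimum is taken over a finite set.
      leastBad : ∀ x → ¬ Kernel x → ∃ λ δ → Bad x δ × (∀ τ → Bad x τ → δ Γ.≤ τ)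
      leastBad x x∉ker with ¬∀⇒∃¬ x∉ker
      ... | δ₀ , bad₀ with go x
        where
        go : ∀ y → (∀ τ → Bad x τ → ¬ Any (λ h → H.degree h Γ.≈ τ) y) ⊎
                   (∃ λ δ → Bad x δ × (∀ τ → Bad x τ → Any (λ h → H.degree h Γ.≈ τ) y → δ Γ.≤ τ))
        go []      = inj₁ λ τ _ ()
        go (h ∷ y) with em {P = Bad x (H.degree h)} | go y
        ... | no ¬b | inj₁ none = inj₁ λ { τ b (here p) → ¬b (bad-cong {x} (Γ.Eq.sym p) b) ; τ b (there i) → none τ b i }
        ... | no ¬b | inj₂ (δ , b , min) = inj₂ (δ , b , λ { τ b′ (here p) → contradiction (bad-cong {x} (Γ.Eq.sym p) b′) ¬b ; τ b′ (there i) → min τ b′ i })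
        ... | yes b | inj₁ none = inj₂ (H.degree h , b , λ { τ b′ (here p) → Γ.reflexive p ; τ b′ (there i) → contradiction i (none τ b′) })
        ... | yes b | inj₂ (δ , b″ , min) with Γ.total δ (H.degree h)
        ...   | inj₁ δ≤h = inj₂ (δ , b″ , λ { τ b′ (here p) → Γ.trans δ≤h (Γ.reflexive p) ; τ b′ (there i) → min τ b′ i })
        ...   | inj₂ h≤δ = inj₂ (H.degree h , b , λ { τ b′ (here p) → Γ.reflexive p ; τ b′ (there i) → Γ.trans h≤δ (min τ b′ i) })
      ...   | inj₁ none = contradiction (part∈degrees x (λ p → bad₀ (∞-bound p))) (none δ₀ bad₀)
      ...   | inj₂ (δ , b , min) = δ , b , λ τ b′ → min τ b′ (part∈degrees x (λ p → b′ (∞-bound p)))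

    -- The graded algebra of a valuation is a domain, by lowest terms: any other pair of degrees
    -- with sum `δ + ε` has a member below its least bad degree, so nothing cancels the product of
    -- the two lowest components.
    kernel-prime : ∀ x y → Kernel (x * y) → Kernel x ⊎ Kernel y
    kernel-prime x y xy∈ker with em {P = Kernel x} | em {P = Kernel y}
    ... | yes p | _     = inj₁ p
    ... | no _  | yes q = inj₂ q
    ... | no ¬p | no ¬q with leastBad x ¬p | leastBad y ¬q
    ...   | δ , bad-δ , min-δ | ε , bad-ε , min-ε = contradiction (xy∈ker σ) (λ σ<xy → <⇒≱ σ<xy (begin
        ρ′ ⟦ part σ (x * y) ⟧                      ≈⟨ ρ′.val-cong (≋-trans (part-* σ x y) (convolution-split δ x σ (part-cong y))) ⟩
        ρ′ ⟦ lead ⊕ convolution (without δ x) Y σ ⟧       ≈⟨ ρ′.val-+-dominant (≤-<-trans lead≤σ rest) ⟩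
        ρ′ ⟦ lead ⟧                                       ≤⟨ lead≤σ ⟩
        just σ                                            ∎))
      where
      open ⁺-Reasoning
      σ : Γ.Carrier
      σ = δ Γ.+ ε
      Y : Γ.Carrier → Poly
      Y τ = part τ y
      lead : Poly
      lead = part δ x ⊗ Y (σ Γ.- δ)
      σ-δ≈ε : σ Γ.- δ Γ.≈ ε
      σ-δ≈ε = Γ.xyx⁻¹≈y δ ε
      lead≤σ : ρ′ ⟦ lead ⟧ ≤⁺ just σ
      lead≤σ = begin
        ρ′ ⟦ lead ⟧                                        ≈⟨ ρ′.*-homo _ _ ⟩
        ρ′ ⟦ part δ x ⟧ +⁺ ρ′ ⟦ Y (σ Γ.- δ) ⟧       ≤⟨ +⁺-mono (≮⇒≥ bad-δ) (⁺.trans (⁺.reflexive (ρ′.val-cong (part-cong y σ-δ≈ε))) (≮⇒≥ bad-ε)) ⟩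
        just δ +⁺ just ε                                   ∎
      rest : just σ <⁺ ρ′ ⟦ convolution (without δ x) Y σ ⟧
      rest = Product.convolution-< (part-cong y) (λ τ → bound′ τ y) (length (without δ x)) (without δ x) σ ℕ.≤-refl cases
        where
        cases : ∀ τ → (just τ <⁺ ρ′ ⟦ part τ (without δ x) ⟧) ⊎ (just (σ Γ.- τ) <⁺ ρ′ ⟦ Y (σ Γ.- τ) ⟧)
        cases τ with em {P = τ Γ.≈ δ}
        ... | yes τ≈δ = inj₁ (∞-bound (≋-trans (part-cong (without δ x) τ≈δ) (part-without-≈ δ x)))
        ... | no  τ≉δ with em {P = Bad x τ}
        ...   | no ¬bad = inj₁ (<-≤-trans (dne ¬bad) (⁺.reflexive (ρ′.val-cong (≋-sym (part-without-≉ x τ≉δ)))))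
        ...   | yes bad = inj₂ (dne λ bad′ → τ≉δ (Γ.antisym (τ≤δ (min-ε _ bad′)) (min-δ τ bad)))
          where
          τ≤δ : ε Γ.≤ σ Γ.- τ → τ Γ.≤ δ
          τ≤δ p with +⁺-cancelʳ {just τ} {just δ} {just ε} (ε , ⁺.Eq.refl) (begin
            just τ +⁺ just ε            ≤⟨ +⁺-monoʳ (just τ) [ p ]≤ ⟩
            just τ +⁺ just (σ Γ.- τ)    ≈⟨ +⁺-comm (just τ) (just (σ Γ.- τ)) ⟩
            just (σ Γ.- τ) +⁺ just τ    ≈⟨ just-+-cancel σ τ ⟩
            just δ +⁺ just ε            ∎)
          ... | [ q ]≤ = q

    -- Membership in the ideal is tested under `ρ′`: 1 and the nonzero polynomials of degree below
    -- `d` keep their finite values, so their initial forms are not in the kernel.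
    isKeyPolynomial : IsKeyPolynomial ρ ψ d
    isKeyPolynomial = record
      { monic   = fromMonic ψ-monic
      ; minimal = λ f f≄[] f₀ → minimal (λ f≋[] → f≄[] (coefficient f≋[])) (below f₀)
      ; prime   = record
        { proper = λ 1∈I → <-irrefl (⁺.Eq.sym (⁺.Eq.trans (ρ′.val-cong one-component) ρ′.one-0)) (ideal⇒kernel 1∈I Γ.0#)
        ; prime  = λ x y xy∈I → Sum.map kernel⇒ideal kernel⇒ideal (kernel-prime x y (ideal⇒kernel xy∈I)) }
      ; nonzero = initialForm ρ ψ , kernel⇒ideal ψ∈ker , λ ψ≈0 → <⇒≱ (ψ≈0 e) (⁺.reflexive (⁺.Eq.trans
          (⁺.Eq.trans (⁺.Eq.reflexive (≡.cong (ρ ⟦_⟧) (difference-≡ e (initialForm ρ ψ) [])))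
            (ρ.val-cong (≋-trans (ᴾ.+-cong ψ-component (≋-trans (ᴾ.-‿cong (part-[] e)) ᴾ.-0#≈0#)) (ᴾ.+-identityʳ ψ)))) ρψ≈e)) }
      where
      one-component : part Γ.0# 1ᴳ ≋ const K.1#
      one-component = ≋-trans (part-∷-≈ _ [] Γ.Eq.refl) (≋-trans (ᴾ.+-congˡ (part-[] Γ.0#)) (ᴾ.+-identityʳ _))
      ψ-component : part e (initialForm ρ ψ) ≋ ψ
      ψ-component = ≋-trans (≡⇒≋ (≡.cong (part e) (proj₂ (proj₂ (proj₂ initialForm-ψ)))))
        (≋-trans (part-∷-≈ ψᴳ [] Γ.Eq.refl) (≋-trans (ᴾ.+-congˡ (part-[] e)) (ᴾ.+-identityʳ ψ)))
      ψ∈ker : Kernel (initialForm ρ ψ)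
      ψ∈ker δ with em {P = e Γ.≈ δ}
      ... | yes p = ≤-<-trans (⁺.reflexive (⁺.Eq.trans [ Γ.Eq.sym p ]≈ (⁺.Eq.sym ρψ≈e))) (<-≤-trans jump
              (⁺.reflexive (ρ′.val-cong (≋-trans (≋-sym ψ-component) (part-cong (initialForm ρ ψ) p)))))
      ... | no ¬p = ∞-bound (≋-trans (≡⇒≋ (≡.cong (part δ) (proj₂ (proj₂ (proj₂ initialForm-ψ))))) (≋-trans (part-∷-≉ ψᴳ [] ¬p) (part-[] δ)))
      minimal : ∀ {f} → ¬ (f ≋ []) → Below f d → ¬ I ρ ψ (initialForm ρ f)
      minimal {f} f≄[] f₀ f∈I with view f (ρ ⟦ f ⟧) ⁺.refl
      ... | inj₂ (f≡∞ , _) = <⇒≱ (finite⇒<⊤ (finite-below f≄[] f₀)) (⁺.reflexive (⁺.Eq.reflexive (≡.sym f≡∞)))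
      ... | inj₁ (c , f≡c , p , form) = <-irrefl (⁺.Eq.trans (⁺.Eq.reflexive (≡.sym f≡c)) (⁺.Eq.trans (agree f₀) (ρ′.val-cong (≋-sym f-component))))
              (ideal⇒kernel f∈I c)
        where
        f-component : part c (initialForm ρ f) ≋ f
        f-component = ≋-trans (≡⇒≋ (≡.cong (part c) form)) (≋-trans (part-∷-≈ (homogeneous c f p) [] Γ.Eq.refl) (≋-trans (ᴾ.+-congˡ (part-[] c)) (ᴾ.+-identityʳ f)))

  private
    module Jumps (ρ ρ′ : Valuationˣ) (ρ≤ρ′ : ρ ≤ⱽ ρ′) where

      Jump : ℕ → Set u
      Jump n = ∃ λ ψ → IsMonic ψ n × ρ ⟦ ψ ⟧ <⁺ ρ′ ⟦ ψ ⟧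

      monic-jump : ∀ {f n} → Below f n → ρ ⟦ f ⟧ <⁺ ρ′ ⟦ f ⟧ → ∃ λ m → Jump m × m ℕ.< n
      monic-jump {f} f₀ f< with normalise f≄[] f₀
        where
        f≄[] : ¬ (f ≋ [])
        f≄[] f≋[] = <-irrefl (⁺.Eq.trans (Val.val-cong ρ f≋[]) (⁺.Eq.trans (Valuationˣ.zero-∞ ρ)
          (⁺.Eq.sym (⁺.Eq.trans (Val.val-cong ρ′ f≋[]) (Valuationˣ.zero-∞ ρ′))))) f<
      ... | c , m , c≉0 , cf-monic , m<n = m , (c ∙ f , cf-monic , (begin-strict
        ρ ⟦ c ∙ f ⟧         ≈⟨ Val.val-∙ ρ c f ⟩
        vᴷ c +⁺ ρ ⟦ f ⟧     <⟨ +⁺-monoʳ-< (finite-vᴷ ρ c≉0) f< ⟩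
        vᴷ c +⁺ ρ′ ⟦ f ⟧    ≈⟨ Val.val-∙ ρ′ c f ⟨
        ρ′ ⟦ c ∙ f ⟧        ∎)) , m<n
        where open ⁺-Reasoning

      agree-below : ∀ {n} → (∀ m → m ℕ.< n → ¬ Jump m) → ∀ {f} → Below f n → ρ ⟦ f ⟧ ≈⁺ ρ′ ⟦ f ⟧
      agree-below none {f} f₀ = dne λ f≉ →
        let m , jump , m<n = monic-jump f₀ (≤∧≉⇒< (ρ≤ρ′ f) f≉) in none m m<n jump

      -- The least degree of a jump is that of a key polynomial, hence at least D.
      least-jump : ∀ {D} → HasDegree ρ D → ∃ Jump → ∃ λ n → Jump n × D ℕ.≤ n × (∀ m → m ℕ.< n → ¬ Jump m)
      least-jump (_ , D≤) jump with least Jump jump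
      ... | n , (ψ , ψ-monic , ψ<) , none = n , (ψ , ψ-monic , ψ<) ,
        D≤ ψ n (MinimalJump.isKeyPolynomial ρ ρ′ ρ≤ρ′ ψ-monic (agree-below none) ψ<) , none

  module _ {ρ ρ′ : Valuationˣ} {D} (ρ-degree : HasDegree ρ D) (ρ≤ρ′ : ρ ≤ⱽ ρ′) where

    open Jumps ρ ρ′ ρ≤ρ′

    -- A jump in degree below `D` would lead to one of least degree, which is a key polynomial of
    -- degree below `D`.
    degree⇒agree : ∀ {f} → Below f D → ρ ⟦ f ⟧ ≈⁺ ρ′ ⟦ f ⟧
    degree⇒agree f₀ = agree-below (λ m m<D jump →
      let n , _ , D≤n , none = least-jump ρ-degree (m , jump) in none m (ℕ.<-≤-trans m<D D≤n) jump) f₀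

    jump⇒minimal-jump : ∀ {f} → ρ ⟦ f ⟧ <⁺ ρ′ ⟦ f ⟧ → ∃₂ λ n ψ → IsMonic ψ n × ρ ⟦ ψ ⟧ <⁺ ρ′ ⟦ ψ ⟧ × D ℕ.≤ n ×
      (∀ {f} → Below f n → ρ ⟦ f ⟧ ≈⁺ ρ′ ⟦ f ⟧)
    jump⇒minimal-jump {f} f< with monic-jump (proj₂ (bounded-by f)) f<
      where
      bounded-by : ∀ f → ∃ λ n → Below f n
      bounded-by []      = 0 , below-[]
      bounded-by (a ∷ f) = let n , b = bounded-by f in suc n , below-∷ b
    ... | m , jump , _ with least-jump ρ-degree (m , jump)
    ...   | n , (ψ , ψ-monic , ψ<) , D≤n , none = n , ψ , ψ-monic , ψ< , D≤n , agree-below none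

  -- Below the degree of φ the initial forms for ρ′ are units, by a Bézout identity with φ.
  key-degree-≥ : ∀ {ρ′ φ d} → IsMonic φ d →
    (∀ fs → All (λ f → Below f d) fs → ∃ λ ρ → All (λ f → ρ ⟦ f ⟧ ≈⁺ ρ′ ⟦ f ⟧) fs × ρ ⟦ φ ⟧ <⁺ ρ′ ⟦ φ ⟧) →
    ∀ {χ D} → IsKeyPolynomial ρ′ χ D → d ℕ.≤ D
  key-degree-≥ {ρ′} {φ} {d} φ-monic approximate {χ} {D} χ-key = ℕ.≮⇒≥ λ D<d → go (bezout χ-monic φ-monic D<d) D<d
    where
    module ρ′ = Val ρ′
    open Graded ρ′
    open RawSemiring (gradedAlgebra ρ′) using (_*_) renaming (1# to 1ᴳ)
    open ⁺-Reasoning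
    open IsKeyPolynomial χ-key using (prime)
    χ-monic : IsMonic χ D
    χ-monic = toMonic (IsKeyPolynomial.monic χ-key)
    -- As `s χ` differs from 1 by a term of positive value, the initial form of `χ` is invertible;
    -- `y` is its inverse. An infinite value of `χ` would give 1 itself positive value.
    unit : ∀ {s t} → s ⊗ χ ⊕ t ⊗ φ ≋ const K.1# → just Γ.0# <⁺ ρ′ ⟦ t ⊗ φ ⟧ → I ρ′ χ 1ᴳ
    unit {s} {t} sχ+tφ≋1 0<tφ with view χ (ρ′ ⟦ χ ⟧) ⁺.refl
    ... | inj₂ (χ≡∞ , _) = ⊥-elim (<-irrefl (⁺.Eq.sym (⁺.Eq.trans (ρ′.val-cong sχ+tφ≋1) ρ′.one-0)) (ρ′.<-val-+ 0<sχ 0<tφ))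
      where
      0<sχ : just Γ.0# <⁺ ρ′ ⟦ s ⊗ χ ⟧
      0<sχ = <-≤-trans [ Γ.0# ]<⊤⁺ (⁺.reflexive (⁺.Eq.sym (⁺.Eq.trans (ρ′.*-homo s χ)
        (⁺.Eq.trans (+⁺-congˡ {ρ′ ⟦ s ⟧} (⁺.Eq.reflexive χ≡∞)) (+⁺-⊤ (ρ′ ⟦ s ⟧))))))
    ... | inj₁ (c , χ≡c , p , form) = y , λ δ → equal δ
      where
      χᴳ : Homogeneous ρ′
      χᴳ = homogeneous c χ p
      sχ≋ : const K.1# ⊝ t ⊗ φ ≋ s ⊗ χ
      sχ≋ = ≋-trans (ᴾ.+-congʳ (≋-sym sχ+tφ≋1)) (ᴾ.solve 2 (λ a b → (a ᴾ.:+ b) ᴾ.:- b ᴾ.:= a) ≋-refl (s ⊗ χ) (t ⊗ φ))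
      opaque
        s-bound : just (Γ.- c) ≤⁺ ρ′ ⟦ s ⟧
        s-bound = +⁺-cancelʳ (c , ⁺.Eq.refl) (begin
          just (Γ.- c) +⁺ just c      ≈⟨ [ Γ.inverseˡ c ]≈ ⟩
          just Γ.0#                   ≤⟨ ρ′.≤-val-sub (⁺.reflexive (⁺.Eq.sym ρ′.one-0)) (<⇒≤ 0<tφ) ⟩
          ρ′ ⟦ const K.1# ⊝ t ⊗ φ ⟧   ≈⟨ ρ′.val-cong sχ≋ ⟩
          ρ′ ⟦ s ⊗ χ ⟧                ≈⟨ ρ′.*-homo s χ ⟩
          ρ′ ⟦ s ⟧ +⁺ ρ′ ⟦ χ ⟧        ≈⟨ +⁺-congˡ {ρ′ ⟦ s ⟧} (⁺.Eq.reflexive χ≡c) ⟩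
          ρ′ ⟦ s ⟧ +⁺ just c          ∎)
      sᴳ : Homogeneous ρ′
      sᴳ = homogeneous (Γ.- c) s s-bound
      y : ∣𝒢∣ ρ′
      y = sᴳ ∷ []
      product : ∀ δ → part δ (initialForm ρ′ χ * y) ≋ χ ⊗ part (δ Γ.- c) y
      product δ = ≋-trans (≡⇒≋ (≡.cong (λ x → part δ (x * y)) form)) (part-singleton δ χᴳ y)
      difference : ∀ δ → just δ <⁺ ρ′ ⟦ part δ 1ᴳ ⊝ part δ (initialForm ρ′ χ * y) ⟧
      difference δ with em {P = Γ.0# Γ.≈ δ}
      ... | yes 0≈δ = begin-strict
        just δ                                           ≈⟨ [ Γ.Eq.sym 0≈δ ]≈ ⟩
        just Γ.0#                                        <⟨ 0<tφ ⟩
        ρ′ ⟦ t ⊗ φ ⟧                                     ≈⟨ ρ′.val-cong (≋-trans (ᴾ.solve 2 (λ a b → b ᴾ.:= (a ᴾ.:+ b) ᴾ.:- a) ≋-refl (s ⊗ χ) (t ⊗ φ))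
                                                              (ᴾ.+-congʳ sχ+tφ≋1)) ⟩
        ρ′ ⟦ const K.1# ⊝ s ⊗ χ ⟧                        ≈⟨ ρ′.val-cong (ᴾ.+-cong 1-part (ᴾ.-‿cong (≋-trans (product δ) (≋-trans (ᴾ.*-congˡ s-part) (ᴾ.*-comm χ s))))) ⟨
        ρ′ ⟦ part δ 1ᴳ ⊝ part δ (initialForm ρ′ χ * y) ⟧ ∎
        where
        1-part : part δ 1ᴳ ≋ const K.1#
        1-part = ≋-trans (part-∷-≈ _ [] 0≈δ) (≋-trans (ᴾ.+-congˡ (part-[] δ)) (ᴾ.+-identityʳ _))
        s-part : part (δ Γ.- c) y ≋ s
        s-part = ≋-trans (part-∷-≈ sᴳ [] (Γ.Eq.trans (Γ.Eq.sym (Γ.identityˡ _)) (Γ.∙-congʳ 0≈δ)))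
          (≋-trans (ᴾ.+-congˡ (part-[] (δ Γ.- c))) (ᴾ.+-identityʳ _))
      ... | no 0≉δ = <-≤-trans [ δ ]<⊤⁺ (⁺.reflexive (⁺.Eq.sym (⁺.Eq.trans (ρ′.val-cong zero-difference) ρ′.zero-∞)))
        where
        zero-difference : part δ 1ᴳ ⊝ part δ (initialForm ρ′ χ * y) ≋ []
        zero-difference = ≋-trans (ᴾ.+-cong (≋-trans (part-∷-≉ _ [] 0≉δ) (part-[] δ))
          (ᴾ.-‿cong (≋-trans (product δ) (≋-trans (ᴾ.*-congˡ (≋-trans (part-∷-≉ sᴳ [] λ q → 0≉δ (Γ.∙-cancelʳ (Γ.- c) _ _ (Γ.Eq.trans (Γ.identityˡ _) q)))
            (part-[] (δ Γ.- c)))) (ᴾ.zeroʳ χ))))) (ᴾ.-‿inverseʳ [])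
      equal : ∀ δ → just δ <⁺ ρ′ ⟦ component ρ′ δ 1ᴳ -ᴾ component ρ′ δ (initialForm ρ′ χ * y) ⟧
      equal δ = <-≤-trans (difference δ) (⁺.reflexive (⁺.Eq.reflexive (≡.cong (ρ′ ⟦_⟧) (≡.sym (difference-≡ δ 1ᴳ (initialForm ρ′ χ * y))))))
    -- If `t φ` had value at most 0, it would have negative value for `ρ`, and `s χ` would share
    -- that value since the sum is 1. But `s χ` keeps its value under `ρ′` while `t φ` jumps, so 1
    -- would have negative value for `ρ′`.
    small : ∀ {s t} → s ⊗ χ ⊕ t ⊗ φ ≋ const K.1# → Below s d → Below t d → D ℕ.< d → just Γ.0# <⁺ ρ′ ⟦ t ⊗ φ ⟧
    small {s} {t} sχ+tφ≋1 s₀ t₀ D<d with approximate (s ∷ t ∷ χ ∷ []) (s₀ ∷ t₀ ∷ below-weaken D<d (bounded χ-monic) ∷ [])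
    ... | ρ , s≈ ∷ t≈ ∷ χ≈ ∷ [] , φ< = ≰⇒> λ tφ≤0 → <-irrefl ⁺.Eq.refl (begin-strict
      ρ′ ⟦ const K.1# ⟧      ≈⟨ ρ′.val-cong sχ+tφ≋1 ⟨
      ρ′ ⟦ s ⊗ χ ⊕ t ⊗ φ ⟧   ≈⟨ ρ′.val-+-dominant (≤-<-trans (⁺.reflexive (sχ≈tφ tφ≤0)) (tφ< tφ≤0)) ⟩
      ρ′ ⟦ s ⊗ χ ⟧           ≈⟨ sχ≈tφ tφ≤0 ⟩
      ρ ⟦ t ⊗ φ ⟧            <⟨ tφ< tφ≤0 ⟩
      ρ′ ⟦ t ⊗ φ ⟧           ≤⟨ tφ≤0 ⟩
      just Γ.0#              ≈⟨ ρ′.one-0 ⟨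
      ρ′ ⟦ const K.1# ⟧      ∎)
      where
      module ρ = Val ρ
      tφ< : ρ′ ⟦ t ⊗ φ ⟧ ≤⁺ just Γ.0# → ρ ⟦ t ⊗ φ ⟧ <⁺ ρ′ ⟦ t ⊗ φ ⟧
      tφ< tφ≤0 = begin-strict
        ρ ⟦ t ⊗ φ ⟧            ≈⟨ ρ.*-homo t φ ⟩
        ρ ⟦ t ⟧ +⁺ ρ ⟦ φ ⟧     <⟨ +⁺-mono-≤-< (≈-finite t≈ (ρ′.val-*-finite (≤-finite tφ≤0 (_ , ⁺.Eq.refl)))) (⁺.reflexive t≈) φ< ⟩
        ρ′ ⟦ t ⟧ +⁺ ρ′ ⟦ φ ⟧   ≈⟨ ρ′.*-homo t φ ⟨
        ρ′ ⟦ t ⊗ φ ⟧           ∎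
      sχ≈tφ : ρ′ ⟦ t ⊗ φ ⟧ ≤⁺ just Γ.0# → ρ′ ⟦ s ⊗ χ ⟧ ≈⁺ ρ ⟦ t ⊗ φ ⟧
      sχ≈tφ tφ≤0 = begin-equality
        ρ′ ⟦ s ⊗ χ ⟧                      ≈⟨ ρ′.*-homo s χ ⟩
        ρ′ ⟦ s ⟧ +⁺ ρ′ ⟦ χ ⟧              ≈⟨ +⁺-cong s≈ χ≈ ⟨
        ρ ⟦ s ⟧ +⁺ ρ ⟦ χ ⟧                ≈⟨ ρ.*-homo s χ ⟨
        ρ ⟦ s ⊗ χ ⟧                       ≈⟨ ρ.val-cong (≋-trans (ᴾ.solve 2 (λ a b → a ᴾ.:= ᴾ.:- b ᴾ.:+ (a ᴾ.:+ b)) ≋-refl (s ⊗ χ) (t ⊗ φ)) (ᴾ.+-congˡ sχ+tφ≋1)) ⟩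
        ρ ⟦ ⊖ (t ⊗ φ) ⊕ const K.1# ⟧      ≈⟨ ρ.val-+-dominant (≤-<-trans (⁺.reflexive (ρ.val-neg (t ⊗ φ))) (<-≤-trans (tφ< tφ≤0) (⁺.trans tφ≤0 (⁺.reflexive (⁺.Eq.sym ρ.one-0))))) ⟩
        ρ ⟦ ⊖ (t ⊗ φ) ⟧                   ≈⟨ ρ.val-neg (t ⊗ φ) ⟩
        ρ ⟦ t ⊗ φ ⟧                       ∎
    go : (∃₂ λ b h → φ ≋ b ⊗ h × Below b d × Below h d) ⊎
         (∃₂ λ s t → s ⊗ χ ⊕ t ⊗ φ ≋ const K.1# × Below s d × Below t d) → ¬ (D ℕ.< d)
    go (inj₂ (s , t , e , s₀ , t₀)) D<d = Ideals.IsPrime.proper prime (unit e (small e s₀ t₀ D<d))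
    -- A product of two polynomials that keep their values cannot jump.
    go (inj₁ (b , h , φ≋bh , b₀ , h₀)) _ with approximate (b ∷ h ∷ []) (b₀ ∷ h₀ ∷ [])
    ... | ρ , b≈ ∷ h≈ ∷ [] , φ< = <-irrefl (begin-equality
      ρ ⟦ φ ⟧                 ≈⟨ Val.val-cong ρ φ≋bh ⟩
      ρ ⟦ b ⊗ h ⟧             ≈⟨ Val.*-homo ρ b h ⟩
      ρ ⟦ b ⟧ +⁺ ρ ⟦ h ⟧      ≈⟨ +⁺-cong b≈ h≈ ⟩
      ρ′ ⟦ b ⟧ +⁺ ρ′ ⟦ h ⟧    ≈⟨ ρ′.*-homo b h ⟨
      ρ′ ⟦ b ⊗ h ⟧            ≈⟨ ρ′.val-cong φ≋bh ⟨
      ρ′ ⟦ φ ⟧                ∎) φ<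

-- Subgroups of finite index

module Subgroups (Γ : OrderedAbelianGroup u) where

  open AbelianGroup (OrderedAbelianGroup.abelianGroup Γ) hiding (_-_)
    renaming (_∙_ to _+_; ε to 0#; _⁻¹ to -_; ∙-cong to +-cong; ∙-congˡ to +-congˡ; ∙-congʳ to +-congʳ)
  open AbelianGroupProperties (OrderedAbelianGroup.abelianGroup Γ)
  open OrderedAbelianGroup Γ using (_-_)
  open Valuations Γ using (HasIndex)
  open RawMonoidDefinitions rawMonoid using () renaming (_×_ to _·_)
  open MonoidSum commutativeMonoid using (sum-permute; sum-cong-≋; sum-replicate; ∑-distrib-+) renaming (sum to ∑)

  record IsSubgroup (H : Pred Carrier u) : Set u where
    field
      resp     : ∀ {a b} → a ≈ b → H a → H b
      0∈       : H 0#
      +-closed : ∀ {a b} → H a → H b → H (a + b)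
      -‿closed : ∀ {a} → H a → H (- a)

    sum-closed : ∀ {n} {t : Fin n → Carrier} → (∀ i → H (t i)) → H (∑ t)
    sum-closed {zero}  p = 0∈
    sum-closed {suc n} p = +-closed (p zero) (sum-closed (p ∘ suc))

  cancel-sub : ∀ a b → (a - b) + b ≈ a
  cancel-sub a b = trans (assoc a (- b) b) (trans (+-congˡ (inverseˡ b)) (identityʳ a))

  private
    telescope : ∀ a b c → (a - b) + (b - c) ≈ a - c
    telescope a b c = trans (sym (assoc (a - b) b (- c))) (+-congʳ (cancel-sub a b))

  -- Translation by γ permutes the cosets; summing representatives gives e γ ∈ H.
  opaque
    index-multiple : ∀ {G H e} → IsSubgroup G → IsSubgroup H → HasIndex G H e → ∀ {γ} → G γ → H (e · γ)
    index-multiple {G} {H} {e} G-subgroup H-subgroup (t , t∈G , coset , unique) {γ} γ∈G =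
      H.resp total (H.sum-closed (λ i → proj₂ (shift i γ∈G)))
      where
      module G = IsSubgroup G-subgroup
      module H = IsSubgroup H-subgroup
      shift : ∀ i {γ} → G γ → ∃ λ j → H ((t i + γ) - t j)
      shift i γ∈G = coset _ (G.+-closed (t∈G i) γ∈G)
      π π⁻¹ : Fin e → Fin e
      π i   = proj₁ (shift i γ∈G)
      π⁻¹ i = proj₁ (shift i (G.-‿closed γ∈G))
      returns : ∀ {γ} (γ∈G : G γ) (-γ∈G : G (- γ)) i → proj₁ (shift (proj₁ (shift i γ∈G)) -γ∈G) ≡ i
      returns {γ} γ∈G -γ∈G i = ≡.sym (unique i _ (H.resp round
        (H.+-closed (proj₂ (shift i γ∈G)) (proj₂ (shift (proj₁ (shift i γ∈G)) -γ∈G)))))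
        where
        a b c : Carrier
        a = t i
        b = t (proj₁ (shift i γ∈G))
        c = t (proj₁ (shift (proj₁ (shift i γ∈G)) -γ∈G))
        round : ((a + γ) - b) + ((b + - γ) - c) ≈ a - c
        round = trans (+-congˡ (trans (assoc b (- γ) (- c)) (trans (+-congˡ (comm (- γ) (- c))) (sym (assoc b (- c) (- γ))))))
          (trans (sym (assoc _ (b - c) (- γ))) (trans (+-congʳ (telescope (a + γ) b c))
            (trans (+-congʳ (trans (assoc a γ (- c)) (trans (+-congˡ (comm γ (- c))) (sym (assoc a (- c) γ)))))
              (trans (assoc (a - c) γ (- γ)) (trans (+-congˡ (inverseʳ γ)) (identityʳ (a - c)))))))
      returns⁻¹ : ∀ i → π (π⁻¹ i) ≡ i
      returns⁻¹ i = ≡.sym (unique i _ (H.resp round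
        (H.+-closed (proj₂ (shift i (G.-‿closed γ∈G))) (proj₂ (shift (π⁻¹ i) γ∈G)))))
        where
        a b c : Carrier
        a = t i
        b = t (π⁻¹ i)
        c = t (π (π⁻¹ i))
        round : ((a + - γ) - b) + ((b + γ) - c) ≈ a - c
        round = trans (+-congˡ (trans (assoc b γ (- c)) (trans (+-congˡ (comm γ (- c))) (sym (assoc b (- c) γ)))))
          (trans (sym (assoc _ (b - c) γ)) (trans (+-congʳ (telescope (a + - γ) b c))
            (trans (+-congʳ (trans (assoc a (- γ) (- c)) (trans (+-congˡ (comm (- γ) (- c))) (sym (assoc a (- c) (- γ))))))
              (trans (assoc (a - c) (- γ) γ) (trans (+-congˡ (inverseˡ γ)) (identityʳ (a - c)))))))
      total : ∑ (λ i → (t i + γ) - t (π i)) ≈ e · γ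
      total = ∙-cancelʳ (∑ t) _ _ (trans (+-congˡ (sum-permute t (permutation π π⁻¹ returns⁻¹ (returns γ∈G (G.-‿closed γ∈G)))))
        (trans (sym (∑-distrib-+ (λ i → (t i + γ) - t (π i)) (t ∘ π))) (trans (sum-cong-≋ (λ i → cancel-sub (t i + γ) (t (π i))))
          (trans (∑-distrib-+ t (λ _ → γ)) (trans (+-congˡ (sum-replicate e)) (comm (∑ t) (e · γ)))))))

-- Tameness: polynomials with a simple zero of the reduction at θ

module Tameness (em : ∀ {ℓ} → ExcludedMiddle ℓ) (𝕂 : ValuedField u)
  (θ : HeytingField.Carrier (ValuedField.K̄ 𝕂)) where

  open ValuedField 𝕂 using (K; K̄; embedding; Γ; valuation; valuationᴷ)
  open Theory 𝕂 using (v; vᴷ; vᴸ; Adjoin; base; gen; add; mul; inv; resp; IsTame; Kv; K⟨_⟩; module Lv/Kv)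
  open CommutativeRing (ring K̄) hiding (ring; rawRing; zero)
  open Extended Γ
  open ExtendedProperties Γ
  open Valuations Γ using (Valuation; Values)
  open ValuationProperties Γ (ring K̄) valuation hiding (val) renaming (*-homo to v-*)
  open FieldHom embedding using () renaming (⟦_⟧ to ι; isHom to ι-isHom)
  open IsRingHomomorphism ι-isHom using (⟦⟧-cong; +-homo; 0#-homo; 1#-homo)
  open PolynomialRing (ring K) hiding (_+ᴾ_; _*ᴾ_)
  open Polynomials (rawRing K) using (_+ᴾ_; _*ᴾ_)
  open Evaluation (ring K) (ring K̄) ι-isHom
  open Subgroups Γ
  open IntegralSolver (ring K̄)
  private
    module K where
      open CommutativeRing (ring K) public hiding (ring; rawRing)
      open FieldPolynomials em K public
      open RingProperties (CommutativeRing.ring (ring K)) public using (-0#≈0#)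
      open RawMonoidDefinitions (CommutativeRing.+-rawMonoid (ring K)) public using () renaming (_×_ to _·_)
    module K̄ = FieldPolynomials em K̄
    module vᴷ = ValuationProperties Γ (ring K) valuationᴷ
    module Γ where
      open OrderedAbelianGroup Γ public
      open RawMonoidDefinitions rawMonoid public using () renaming (_×_ to _·_)
    module kv = Polynomials (Kv θ)

  open RawMonoidDefinitions (CommutativeRing.+-rawMonoid (ring K̄)) using () renaming (_×_ to _·_)

  private
    values-subgroup : ∀ (R : CommutativeRing u u) (w : Valuation (CommutativeRing.rawRing R)) → let module R = CommutativeRing R in
      (∀ x → Finite (Valuation.val w x) → ∃ λ y → y R.* x R.≈ R.1#) → IsSubgroup (Values w)
    values-subgroup R w inverse = record
      { resp     = λ { e (x , p) → x , ⁺.Eq.trans p [ e ]≈ }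
      ; 0∈       = CommutativeRing.1# R , w.one-0
      ; +-closed = λ { (x , p) (y , q) → CommutativeRing._*_ R x y , ⁺.Eq.trans (w.*-homo x y) (+⁺-cong p q) }
      ; -‿closed = λ { {a} (x , p) → let y , yx≈1 = inverse x (a , p) in y , +⁺-cancelʳ-≈ (a , p)
          (⁺.Eq.trans (⁺.Eq.sym (w.*-homo y x)) (⁺.Eq.trans (w.cong yx≈1) (⁺.Eq.trans w.one-0
            (⁺.Eq.sym (⁺.Eq.trans (+⁺-congˡ {just (Γ.- a)} p) [ AbelianGroup.inverseˡ Γ.abelianGroup a ]≈))))) } }
      where module w = Valuation w

    finite≉0 : ∀ {x} → Finite (v x) → ¬ (x ≈ 0#)
    finite≉0 finite x≈0 = <-irrefl (⁺.Eq.trans (val-cong x≈0) zero-∞) (finite⇒<⊤ finite)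

    values-K : IsSubgroup (Values valuationᴷ)
    values-K = values-subgroup (ring K) valuationᴷ λ x finite → K.inverse λ x≈0 → finite≉0 finite (trans (⟦⟧-cong x≈0) 0#-homo)

    values-L : IsSubgroup (Values (vᴸ θ))
    values-L = values-subgroup (K⟨_⟩ θ) (vᴸ θ) λ (x , x∈L) finite →
      let y , yx≈1 = K̄.inverse (finite≉0 finite) in (y , inv x∈L (trans (*-comm x y) yx≈1)) , yx≈1

  evaluate-adjoin : ∀ f → Adjoin θ (evaluate f θ)
  evaluate-adjoin []      = resp 0#-homo (base K.0#)
  evaluate-adjoin (a ∷ f) = add (base a) (mul gen (evaluate-adjoin f))

  private
    -- Elements of the residue ring are integral elements under a coarser equality, so lifting
    -- merely forgets integrality and commutes with all operations on the nose.
    lift : kv.Poly → Poly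
    lift = map proj₁

    lift-+ : ∀ p q → lift (p kv.+ᴾ q) ≡ lift p +ᴾ lift q
    lift-+ []      q       = ≡.refl
    lift-+ (a ∷ p) []      = ≡.refl
    lift-+ (a ∷ p) (b ∷ q) = ≡.cong (_ ∷_) (lift-+ p q)

    lift-scale : ∀ a q → lift (map (RawRing._*_ (Kv θ) a) q) ≡ map (proj₁ a K.*_) (lift q)
    lift-scale a []      = ≡.refl
    lift-scale a (b ∷ q) = ≡.cong (_ ∷_) (lift-scale a q)

    lift-* : ∀ p q → lift (p kv.*ᴾ q) ≡ lift p *ᴾ lift q
    lift-* []      q = ≡.refl
    lift-* (a ∷ p) q = ≡.trans (lift-+ (map (RawRing._*_ (Kv θ) a) q) _)
      (≡.cong₂ _+ᴾ_ (lift-scale a q) (≡.cong (K.0# ∷_) (lift-* p q)))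

    open RawMonoidDefinitions (RawRing.+-rawMonoid (Kv θ)) using () renaming (_×_ to _·ᵏ_)

    lift-· : ∀ n a → proj₁ (n ·ᵏ a) ≡ n K.· proj₁ a
    lift-· zero    a = ≡.refl
    lift-· (suc n) a = ≡.cong (proj₁ a K.+_) (lift-· n a)

    lift-weight : ∀ n p → lift (kv.weight n p) ≡ Polynomials.weight (rawRing K) n (lift p)
    lift-weight n []      = ≡.refl
    lift-weight n (a ∷ p) = ≡.cong₂ _∷_ (lift-· n a) (lift-weight (suc n) p)

    lift-derivative : ∀ p → lift (kv.derivative p) ≡ Polynomials.derivative (rawRing K) (lift p)
    lift-derivative []      = ≡.refl
    lift-derivative (a ∷ p) = lift-weight 1 p

    lift-coeff : ∀ p n → proj₁ (kv.coeff p n) ≡ coeff (lift p) n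
    lift-coeff []      n       = ≡.refl
    lift-coeff (a ∷ p) zero    = ≡.refl
    lift-coeff (a ∷ p) (suc n) = lift-coeff p n

    lift-evaluate : ∀ p x → proj₁ (proj₁ (Lv/Kv.evaluate θ p x)) ≡ evaluate (lift p) (proj₁ (proj₁ x))
    lift-evaluate []      x = ≡.refl
    lift-evaluate (a ∷ p) x = ≡.cong (λ y → ι (proj₁ a) + proj₁ (proj₁ x) * y) (lift-evaluate p x)

  Integral : Poly → Set u
  Integral h = ∀ n → just Γ.0# ≤⁺ vᴷ (coeff h n)

  private
    lift-integral : ∀ p → Integral (lift p)
    lift-integral p n = ≡.subst (λ a → just Γ.0# ≤⁺ vᴷ a) (lift-coeff p n) (proj₂ (kv.coeff p n))

    *-≥0 : ∀ {x y} → just Γ.0# ≤⁺ v x → just Γ.0# ≤⁺ v y → just Γ.0# ≤⁺ v (x * y)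
    *-≥0 p q = ⁺.trans (+⁺-nonneg p q) (⁺.reflexive (⁺.Eq.sym (v-* _ _)))

    *->0 : ∀ {x y} → just Γ.0# ≤⁺ v x → just Γ.0# <⁺ v y → just Γ.0# <⁺ v (x * y)
    *->0 {x} {y} p q = ≤-<-trans (⁺.reflexive (⁺.Eq.sym (+⁺-identityˡ (just Γ.0#))))
      (<-≤-trans (+⁺-mono-≤-< (Γ.0# , ⁺.Eq.refl) p q) (⁺.reflexive (⁺.Eq.sym (v-* x y))))

  integral-value : ∀ {h x} → Integral h → just Γ.0# ≤⁺ v x → just Γ.0# ≤⁺ v (evaluate h x)
  integral-value {[]}    h≥0 x≥0 = ⁺.trans ≤⊤ (⁺.reflexive (⁺.Eq.sym zero-∞))
  integral-value {a ∷ h} h≥0 x≥0 = ≤-val-+ (h≥0 0) (*-≥0 x≥0 (integral-value {h} (h≥0 ∘ suc) x≥0))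

  positive-value : ∀ {h x} → (∀ n → just Γ.0# <⁺ vᴷ (coeff h n)) → just Γ.0# ≤⁺ v x → just Γ.0# <⁺ v (evaluate h x)
  positive-value {[]}    h>0 x≥0 = <-≤-trans [ _ ]<⊤⁺ (⁺.reflexive (⁺.Eq.sym zero-∞))
  positive-value {a ∷ h} h>0 x≥0 = <-val-+ (h>0 0) (*->0 x≥0 (positive-value {h} (h>0 ∘ suc) x≥0))

  derivative-integral : ∀ {h x} → Integral h → just Γ.0# ≤⁺ v x → just Γ.0# ≤⁺ v (derivativeAt h x)
  derivative-integral {[]}    h≥0 x≥0 = ⁺.trans ≤⊤ (⁺.reflexive (⁺.Eq.sym zero-∞))
  derivative-integral {a ∷ h} h≥0 x≥0 =
    ≤-val-+ (integral-value {h} (h≥0 ∘ suc) x≥0) (*-≥0 x≥0 (derivative-integral {h} (h≥0 ∘ suc) x≥0))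

  module _ (tame : IsTame θ) where

    open IsTame tame using (residueSeparable; e; ramificationIndex; p; characteristic; p∤e)

    opaque
      -- Separability gives `a h + b h′ = 1` over the residue field. Lifted and evaluated at `x`,
      -- this prevents `h(x)` and `h′(x)` from both having positive value, and `h(x)` has.
      residue-equation : ∀ {x} → Adjoin θ x → just Γ.0# ≤⁺ v x →
        ∃ λ h → Integral h × just Γ.0# <⁺ v (evaluate h x) × v (derivativeAt h x) ≈⁺ just Γ.0#
      residue-equation {x} x∈L x≥0 with residueSeparable ((x , x∈L) , x≥0)
      ... | h , minimal , a , b , ah+bh′≈1 = H , lift-integral h , 0<H , ⁺.antisym H′≤0 (derivative-integral {H} (lift-integral h) x≥0)
        where
        H A B : Poly
        H = lift h
        A = lift a
        B = lift b
        0<H : just Γ.0# <⁺ v (evaluate H x)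
        0<H = <-≤-trans (Lv/Kv.IsMinimalPolynomial.root minimal) (⁺.reflexive (val-cong
          (trans (+-congʳ (reflexive (lift-evaluate h ((x , x∈L) , x≥0)))) (solve 1 (λ x → x :- con (0 , 0) := x) refl (evaluate H x)))))
        H′≤0 : v (derivativeAt H x) ≤⁺ just Γ.0#
        H′≤0 = ≮⇒≥ λ 0<H′ → <-irrefl (⁺.Eq.sym one-0) (<-≤-trans
          (<-val-sub (<-val-+ (*->0 (integral-value {A} (lift-integral a) x≥0) 0<H) (*->0 (integral-value {B} (lift-integral b) x≥0) 0<H′))
            (positive-value {E} E>0 x≥0))
          (⁺.reflexive (val-cong E-value)))
          where
          -- The defect of the lifted Bézout identity; its coefficients vanish in the residue field.
          E : Poly
          E = (A ⊗ H ⊕ B ⊗ Polynomials.derivative (rawRing K) H) ⊝ const K.1#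
          lifted : lift ((a kv.*ᴾ h) kv.+ᴾ (b kv.*ᴾ kv.derivative h)) ≡ A ⊗ H ⊕ B ⊗ Polynomials.derivative (rawRing K) H
          lifted = ≡.trans (lift-+ (a kv.*ᴾ h) _) (≡.trans (≡.cong₂ _+ᴾ_ (lift-* a h) (≡.trans (lift-* b _) (≡.cong (B *ᴾ_) (lift-derivative h))))
            (≡.sym (≡.trans (⊕-≡ (A ⊗ H) _) (≡.cong₂ _+ᴾ_ (⊗-≡ A H) (⊗-≡ B _)))))
          E>0 : ∀ n → just Γ.0# <⁺ vᴷ (coeff E n)
          E>0 n = <-≤-trans (ah+bh′≈1 n) (⁺.reflexive (vᴷ.val-cong (K.trans
            (K.+-cong (K.reflexive (≡.trans (lift-coeff ((a kv.*ᴾ h) kv.+ᴾ (b kv.*ᴾ kv.derivative h)) n) (≡.cong (λ q → coeff q n) lifted)))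
              (K.-‿cong (K.reflexive (lift-coeff (kv.const (RawRing.1# (Kv θ))) n))))
            (K.sym (K.trans (coeff-⊕ (A ⊗ H ⊕ B ⊗ Polynomials.derivative (rawRing K) H) (⊖ const K.1#) n) (K.+-congˡ (coeff-⊖ (const K.1#) n)))))))
          E-value : (evaluate A x * evaluate H x + evaluate B x * derivativeAt H x) - evaluate E x ≈ 1#
          E-value = trans (+-congˡ (-‿cong (trans (evaluate-⊕ (A ⊗ H ⊕ B ⊗ Polynomials.derivative (rawRing K) H) _ x) (+-cong
              (trans (evaluate-⊕ (A ⊗ H) _ x) (+-cong (evaluate-⊗ A H x) (trans (evaluate-⊗ B _ x) (*-congˡ (evaluate-derivative H x)))))
              (trans (evaluate-⊖ (const K.1#) x) (-‿cong (trans (evaluate-const K.1# x) 1#-homo)))))))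
            (solve 2 (λ s i → s :- (s :+ :- i) := i) refl _ 1#)

    private
      -- That the residue characteristic does not divide `e` means that `e` is nonzero in the
      -- residue field.
      multiple-unit : v (e · 1#) ≈⁺ just Γ.0#
      multiple-unit = ⁺.antisym (≮⇒≥ λ 0<e → p∤e (Equivalence.to (characteristic e) (<-≤-trans 0<e (⁺.reflexive (e-value e)))))
        (multiple-≥0 e)
        where
        multiple-≥0 : ∀ n → just Γ.0# ≤⁺ v (n · 1#)
        multiple-≥0 zero    = ⁺.trans ≤⊤ (⁺.reflexive (⁺.Eq.sym zero-∞))
        multiple-≥0 (suc n) = ≤-val-+ (⁺.reflexive (⁺.Eq.sym one-0)) (multiple-≥0 n)
        ι-· : ∀ n → n · 1# ≈ ι (n K.· K.1#)
        ι-· zero    = sym 0#-homo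
        ι-· (suc n) = sym (trans (+-homo K.1# (n K.· K.1#)) (+-cong 1#-homo (sym (ι-· n))))
        e-value : ∀ n → v (n · 1#) ≈⁺ vᴷ (proj₁ (n ·ᵏ RawRing.1# (Kv θ)) K.- K.0#)
        e-value n = val-cong (trans (ι-· n) (⟦⟧-cong (K.trans (K.reflexive (≡.sym (lift-· n (RawRing.1# (Kv θ)))))
          (K.sym (K.trans (K.+-congˡ K.-0#≈0#) (K.+-identityʳ _))))))

      power-value : ∀ f k {y γ} → v (evaluate f y) ≈⁺ just γ → v (evaluate (power f k) y) ≈⁺ just (k Γ.· γ)
      power-value f zero    {y} e = ⁺.Eq.trans (val-cong (trans (evaluate-const K.1# y) 1#-homo)) one-0
      power-value f (suc k) {y} e = ⁺.Eq.trans (val-cong (evaluate-⊗ f (power f k) y))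
        (⁺.Eq.trans (v-* _ _) (+⁺-cong e (power-value f k e)))

      unit-value : ∀ f {a w y γ} → vᴷ a ≈⁺ just (e Γ.· γ) → w K.* a K.≈ K.1# → v (evaluate f y) ≈⁺ just γ →
        v (evaluate (const w ⊗ power f e) y) ≈⁺ just Γ.0#
      unit-value f {a} {w} {y} {γ} a≈eγ wa≈1 fy≈γ = begin-equality
        v (evaluate (const w ⊗ power f e) y)                   ≈⟨ val-cong (evaluate-⊗ (const w) (power f e) y) ⟩
        v (evaluate (const w) y * evaluate (power f e) y)      ≈⟨ v-* _ _ ⟩
        v (evaluate (const w) y) +⁺ v (evaluate (power f e) y) ≈⟨ +⁺-cong (val-cong (evaluate-const w y)) (⁺.Eq.trans (power-value f e fy≈γ) (⁺.Eq.sym a≈eγ)) ⟩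
        vᴷ w +⁺ vᴷ a                                           ≈⟨ vᴷ.*-homo w a ⟨
        vᴷ (w K.* a)                                           ≈⟨ ⁺.Eq.trans (vᴷ.val-cong wa≈1) vᴷ.one-0 ⟩
        just Γ.0#                                              ∎
        where open ⁺-Reasoning

      unit-* : ∀ {x y} → v x ≈⁺ just Γ.0# → v (x * y) ≈⁺ v y
      unit-* {x} {y} x≈0 = ⁺.Eq.trans (v-* x y) (⁺.Eq.trans (+⁺-congʳ {v y} x≈0) (+⁺-identityˡ (v y)))

      Witness : Poly → Poly → Set u
      Witness f G = just Γ.0# <⁺ v (evaluate G θ) ×
        v (derivativeAt G θ) +⁺ v (evaluate f θ) ≈⁺ v (derivativeAt f θ) ×
        (∀ {y} → v (evaluate f y) ≈⁺ v (evaluate f θ) → just Γ.0# ≤⁺ v (evaluate G y))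

      -- For `g = w fᵉ` one has `g′ f = e g f′`, and `e`, `g(θ)` and `h′(g(θ))` all have value 0.
      -- The last clause holds because `g(y)` is integral whenever `f(y)` has the value of `f(θ)`.
      witness : ∀ f {γ a w h} → v (evaluate f θ) ≈⁺ just γ → vᴷ a ≈⁺ just (e Γ.· γ) → w K.* a K.≈ K.1# →
        Integral h → just Γ.0# <⁺ v (evaluate h (evaluate (const w ⊗ power f e) θ)) →
        v (derivativeAt h (evaluate (const w ⊗ power f e) θ)) ≈⁺ just Γ.0# →
        Witness f (compose h (const w ⊗ power f e))
      witness f {γ} {a} {w} {h} fθ≈γ a≈eγ wa≈1 h-integral 0<h h′≈0 =
        <-≤-trans 0<h (⁺.reflexive (val-cong (sym (evaluate-compose h g θ)))) , slope ,
        λ {y} fy≈fθ → ⁺.trans (integral-value {h} h-integral (⁺.reflexive (⁺.Eq.sym (unit-value f a≈eγ wa≈1 (⁺.Eq.trans fy≈fθ fθ≈γ)))))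
          (⁺.reflexive (val-cong (sym (evaluate-compose h g y))))
        where
        g : Poly
        g = const w ⊗ power f e
        product : derivativeAt g θ * evaluate f θ ≈ evaluate g θ * ((e · 1#) * derivativeAt f θ)
        product = begin
          derivativeAt g θ * evaluate f θ    ≈⟨ *-congʳ (derivativeAt-⊗ (const w) (power f e) θ) ⟩
          (derivativeAt (const w) θ * evaluate (power f e) θ + evaluate (const w) θ * derivativeAt (power f e) θ) * evaluate f θ
            ≈⟨ *-congʳ (+-congʳ (trans (*-congʳ (derivativeAt-const w θ)) (zeroˡ _))) ⟩
          (0# + evaluate (const w) θ * derivativeAt (power f e) θ) * evaluate f θ
            ≈⟨ solve 3 (λ w p f → (con (0 , 0) :+ w :* p) :* f := w :* (f :* p)) refl (evaluate (const w) θ) (derivativeAt (power f e) θ) (evaluate f θ) ⟩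
          evaluate (const w) θ * (evaluate f θ * derivativeAt (power f e) θ)    ≈⟨ *-congˡ (derivativeAt-power f e θ) ⟩
          evaluate (const w) θ * ((e · 1#) * (evaluate (power f e) θ * derivativeAt f θ))
            ≈⟨ solve 4 (λ w n p d → w :* (n :* (p :* d)) := w :* p :* (n :* d)) refl (evaluate (const w) θ) (e · 1#) (evaluate (power f e) θ) (derivativeAt f θ) ⟩
          evaluate (const w) θ * evaluate (power f e) θ * ((e · 1#) * derivativeAt f θ)  ≈⟨ *-congʳ (evaluate-⊗ (const w) (power f e) θ) ⟨
          evaluate g θ * ((e · 1#) * derivativeAt f θ)   ∎
          where
          open import Relation.Binary.Reasoning.Setoid setoid
        slope : v (derivativeAt (compose h g) θ) +⁺ v (evaluate f θ) ≈⁺ v (derivativeAt f θ)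
        slope = begin-equality
          v (derivativeAt (compose h g) θ) +⁺ v (evaluate f θ)     ≈⟨ v-* _ _ ⟨
          v (derivativeAt (compose h g) θ * evaluate f θ)          ≈⟨ val-cong (trans (*-congʳ (derivativeAt-compose h g θ)) (trans (*-assoc _ _ _) (*-congˡ product))) ⟩
          v (derivativeAt h (evaluate g θ) * (evaluate g θ * ((e · 1#) * derivativeAt f θ)))  ≈⟨ unit-* h′≈0 ⟩
          v (evaluate g θ * ((e · 1#) * derivativeAt f θ))         ≈⟨ unit-* (unit-value f a≈eγ wa≈1 fθ≈γ) ⟩
          v ((e · 1#) * derivativeAt f θ)                          ≈⟨ unit-* multiple-unit ⟩
          v (derivativeAt f θ)                                     ∎
          where open ⁺-Reasoning

    -- A polynomial whose reduction at θ has a simple zero: h(fᵉ / a) for a ∈ K of value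
    -- e v(f(θ)) and h lifting the minimal polynomial of the residue of f(θ)ᵉ / a.
    opaque
      tame-witness : ∀ f → Finite (v (evaluate f θ)) → ∃ λ G → just Γ.0# <⁺ v (evaluate G θ) ×
        v (derivativeAt G θ) +⁺ v (evaluate f θ) ≈⁺ v (derivativeAt f θ) ×
        (∀ {y} → v (evaluate f y) ≈⁺ v (evaluate f θ) → just Γ.0# ≤⁺ v (evaluate G y))
      tame-witness f (γ , fθ≈γ) = from-value (index-multiple values-L values-K ramificationIndex ((evaluate f θ , evaluate-adjoin f) , fθ≈γ))
        where
        from-inverse : ∀ {a} → vᴷ a ≈⁺ just (e Γ.· γ) → (∃ λ w → w K.* a K.≈ K.1#) → ∃ (Witness f)
        from-inverse a≈eγ (w , wa≈1) =
          let h , h-integral , 0<h , h′≈0 = residue-equation (evaluate-adjoin (const w ⊗ power f e))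
                (⁺.reflexive (⁺.Eq.sym (unit-value f a≈eγ wa≈1 fθ≈γ)))
          in compose h (const w ⊗ power f e) , witness f {h = h} fθ≈γ a≈eγ wa≈1 h-integral 0<h h′≈0
        from-value : Values valuationᴷ (e Γ.· γ) → ∃ (Witness f)
        from-value (a , a≈eγ) = from-inverse a≈eγ (K.inverse λ a≈0 →
          <-irrefl (⁺.Eq.trans (⁺.Eq.sym a≈eγ) (⁺.Eq.trans (vᴷ.val-cong a≈0) vᴷ.zero-∞)) [ _ ]<⊤⁺)

-- Isolated roots of key polynomials, and values of expansions at generic points

module Approximation (em : ∀ {ℓ} → ExcludedMiddle ℓ) (𝕂 : ValuedField u)
  (θ : HeytingField.Carrier (ValuedField.K̄ 𝕂)) where

  open ValuedField 𝕂 using (K; K̄; embedding; Γ; valuation)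
  open Theory 𝕂 using (v; IsTame; minTerms)
  open CommutativeRing (ring K̄) hiding (ring; rawRing; zero)
  open Extended Γ
  open ExtendedProperties Γ
  open ValuationProperties Γ (ring K̄) valuation
  open FieldHom embedding using () renaming (isHom to ι-isHom)
  open PolynomialRing (ring K)
  open Evaluation (ring K) (ring K̄) ι-isHom
  open GenericPoints em 𝕂 θ
  open Tameness em 𝕂 θ using (tame-witness)
  open IntegralSolver (ring K̄) using (solve; _:=_; _:+_; _:-_; :-_)
  open Classical em
  private
    module Γ = OrderedAbelianGroup Γ
    module K = CommutativeRing (ring K)

  V : Poly → Carrier → Γ⁺
  V f z = v (evaluate f z)

  V-⊗ : ∀ f g z → V (f ⊗ g) z ≈⁺ V f z +⁺ V g z
  V-⊗ f g z = ⁺.Eq.trans (val-cong (evaluate-⊗ f g z)) (*-homo _ _)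

  θ-near : ∀ {ε} → Near ε θ
  θ-near = ⁺.trans ≤⊤ (⁺.reflexive (⁺.Eq.sym (⁺.Eq.trans (val-cong (-‿inverseʳ θ)) zero-∞)))

  Constant : Γ.Carrier → Poly → Set u
  Constant δ a = Generically δ (λ y → V a y ≈⁺ V a θ)

  -- Dividing G = q φ + r by φ, the remainder is negligible because it does not
  -- jump at θ, so the simple zero of G at θ comes from φ.
  private
    module Division {δ y G φ q r} (G≋ : G ≋ q ⊗ φ ⊕ r)
      (0≤Gy : just Γ.0# ≤⁺ V G y) (0<Gθ : just Γ.0# <⁺ V G θ) (G′ : v (derivativeAt G θ) +⁺ just δ ≈⁺ just Γ.0#)
      (r-constant : V r y ≈⁺ V r θ) (φ-jump : V φ y <⁺ V φ θ) (q-minimum : V q y ≤⁺ V q θ)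
      (q′-bound : V q y ≤⁺ v (derivativeAt q θ) +⁺ just δ) (r′-bound : V r y ≤⁺ v (derivativeAt r θ) +⁺ just δ) where

      open ⁺-Reasoning

      product : ∀ z → evaluate (q ⊗ φ) z ≈ evaluate G z - evaluate r z
      product z = trans (solve 2 (λ a b → a := (a :+ b) :- b) refl _ (evaluate r z))
        (+-congʳ (sym (trans (evaluate-cong z G≋) (evaluate-⊕ (q ⊗ φ) r z))))

      remainder : ∀ z → evaluate r z ≈ evaluate G z - evaluate (q ⊗ φ) z
      remainder z = trans (solve 2 (λ a b → b := (a :+ b) :- a) refl (evaluate (q ⊗ φ) z) _)
        (+-congʳ (sym (trans (evaluate-cong z G≋) (evaluate-⊕ (q ⊗ φ) r z))))

      -- Suppose `r(y)` has value at most 0, hence at most that of `q φ` at `y`. At `θ` both `G` and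
      -- the jumping product `q φ` have larger values, and so would `r`, which is constant.
      0<r : just Γ.0# <⁺ V r y
      0<r = ≰⇒> λ r≤0 → <-irrefl r-constant (begin-strict
        V r y                                         <⟨ <-val-sub (≤-<-trans r≤0 0<Gθ) (jump r≤0) ⟩
        v (evaluate G θ - evaluate (q ⊗ φ) θ)         ≈⟨ val-cong (remainder θ) ⟨
        V r θ                                         ∎)
        where
        r≤qφ : V r y ≤⁺ just Γ.0# → V r y ≤⁺ V q y +⁺ V φ y
        r≤qφ r≤0 = begin
          V r y                                       ≤⟨ ≤-val-sub (⁺.trans r≤0 0≤Gy) ⁺.refl ⟩
          v (evaluate G y - evaluate r y)             ≈⟨ val-cong (product y) ⟨
          V (q ⊗ φ) y                                 ≈⟨ V-⊗ q φ y ⟩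
          V q y +⁺ V φ y                              ∎
        jump : V r y ≤⁺ just Γ.0# → V r y <⁺ V (q ⊗ φ) θ
        jump r≤0 = <-≤-trans (+⁺-<-jump (≤-finite r≤0 (_ , ⁺.Eq.refl)) (r≤qφ r≤0) q-minimum φ-jump)
          (⁺.reflexive (⁺.Eq.sym (V-⊗ q φ θ)))

      0≤qφ : just Γ.0# ≤⁺ V q y +⁺ V φ y
      0≤qφ = begin
        just Γ.0#                                     ≤⟨ ≤-val-sub 0≤Gy (<⇒≤ 0<r) ⟩
        v (evaluate G y - evaluate r y)               ≈⟨ val-cong (product y) ⟨
        V (q ⊗ φ) y                                   ≈⟨ V-⊗ q φ y ⟩
        V q y +⁺ V φ y                                ∎

      0<q′φ : just Γ.0# <⁺ v (derivativeAt q θ * evaluate φ θ) +⁺ just δ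
      0<q′φ = begin-strict
        just Γ.0#                                     <⟨ +⁺-<-jump (_ , ⁺.Eq.refl) 0≤qφ q′-bound φ-jump ⟩
        (v (derivativeAt q θ) +⁺ just δ) +⁺ V φ θ     ≈⟨ +⁺-assoc (v (derivativeAt q θ)) (just δ) (V φ θ) ⟩
        v (derivativeAt q θ) +⁺ (just δ +⁺ V φ θ)     ≈⟨ +⁺-congˡ {v (derivativeAt q θ)} (+⁺-comm (just δ) (V φ θ)) ⟩
        v (derivativeAt q θ) +⁺ (V φ θ +⁺ just δ)     ≈⟨ +⁺-assoc (v (derivativeAt q θ)) (V φ θ) (just δ) ⟨
        (v (derivativeAt q θ) +⁺ V φ θ) +⁺ just δ     ≈⟨ +⁺-congʳ {just δ} (*-homo _ _) ⟨
        v (derivativeAt q θ * evaluate φ θ) +⁺ just δ ∎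

      -- Of the three terms of `G′(θ)`, those with `q′` and `r′` have value above `-δ`, so the term
      -- `q φ′` has value at most `-δ`. Comparison with `0 ≤ v(q(y)) + v(φ(y))` cancels `q`.
      slope : v (derivativeAt φ θ) +⁺ just δ ≤⁺ V φ y
      slope = +⁺-cancelʳ finite-q (begin
        (v (derivativeAt φ θ) +⁺ just δ) +⁺ V q y     ≤⟨ +⁺-monoʳ (v (derivativeAt φ θ) +⁺ just δ) q-minimum ⟩
        (v (derivativeAt φ θ) +⁺ just δ) +⁺ V q θ     ≈⟨ +⁺-comm (v (derivativeAt φ θ) +⁺ just δ) (V q θ) ⟩
        V q θ +⁺ (v (derivativeAt φ θ) +⁺ just δ)     ≈⟨ +⁺-assoc (V q θ) _ (just δ) ⟨
        (V q θ +⁺ v (derivativeAt φ θ)) +⁺ just δ     ≈⟨ +⁺-congʳ {just δ} (*-homo _ _) ⟨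
        v (evaluate q θ * derivativeAt φ θ) +⁺ just δ ≤⟨ qφ′≤0 ⟩
        just Γ.0#                                     ≤⟨ 0≤qφ ⟩
        V q y +⁺ V φ y                                ≈⟨ +⁺-comm (V q y) (V φ y) ⟩
        V φ y +⁺ V q y                                ∎)
        where
        G′-value : derivativeAt G θ ≈ (derivativeAt q θ * evaluate φ θ + evaluate q θ * derivativeAt φ θ) + derivativeAt r θ
        G′-value = trans (derivativeAt-cong θ G≋) (trans (derivativeAt-⊕ (q ⊗ φ) r θ) (+-congʳ (derivativeAt-⊗ q φ θ)))
        qφ′≤0 : v (evaluate q θ * derivativeAt φ θ) +⁺ just δ ≤⁺ just Γ.0#
        qφ′≤0 = ≮⇒≥ λ 0<qφ′ → <-irrefl (⁺.Eq.sym G′) (begin-strict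
          just Γ.0#                                   <⟨ <-val-+⁺ (just δ) (<-val-+⁺ (just δ) 0<q′φ 0<qφ′) (<-≤-trans 0<r r′-bound) ⟩
          v ((derivativeAt q θ * evaluate φ θ + evaluate q θ * derivativeAt φ θ) + derivativeAt r θ) +⁺ just δ
            ≈⟨ +⁺-congʳ {just δ} (val-cong G′-value) ⟨
          v (derivativeAt G θ) +⁺ just δ              ∎)
        finite-q : Finite (V q y)
        finite-q = ≤-finite q-minimum (≈-finite (⁺.Eq.refl) (finite-+ˡ (≈-finite (⁺.Eq.sym (*-homo (evaluate q θ) (derivativeAt φ θ)))
          (finite-+ˡ {y = just δ} (≤-finite qφ′≤0 (_ , ⁺.Eq.refl))))))

  opaque
    -- `f` is meant to be the preceding key polynomial, whose slope gives `G′(θ)` the value `-δ`.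
    -- Together with `derivative-bound`, the conclusion pins `v(φ′(θ))` to the value that it has
    -- when a single root is closer to `θ` than `δ`.
    tame-slope : IsTame θ → ∀ {f δ} → Finite (V f θ) → Constant δ f → v (derivativeAt f θ) +⁺ just δ ≈⁺ V f θ →
      ∀ {φ d} → IsMonic φ d → (∀ {a} → Below a d → Constant δ a) → Generically δ (λ y → V φ y <⁺ V φ θ) →
      Generically δ (λ y → v (derivativeAt φ θ) +⁺ just δ ≤⁺ V φ y)
    tame-slope tame {f} {δ} fθ-finite f-constant f′ {φ} φ-monic constant jump =
      from-witness (tame-witness tame f fθ-finite)
      where
      from-witness : (∃ λ G → just Γ.0# <⁺ V G θ × v (derivativeAt G θ) +⁺ V f θ ≈⁺ v (derivativeAt f θ) ×
        (∀ {y} → V f y ≈⁺ V f θ → just Γ.0# ≤⁺ V G y)) → Generically δ (λ y → v (derivativeAt φ θ) +⁺ just δ ≤⁺ V φ y)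
      from-witness (G , 0<Gθ , G′ , 0≤G) with divide φ-monic G
      ... | q , r , G≋ , r₀ = generically-map
        (λ (fy , ry , φy , qy , q′ , r′) → Division.slope G≋ (0≤G fy) 0<Gθ G′-value ry φy (qy θ-near) q′ r′)
        (f-constant ⟪×⟫ constant r₀ ⟪×⟫ jump ⟪×⟫ minimum q ⟪×⟫ derivative-bound q ⟪×⟫ derivative-bound r)
        where
        open ⁺-Reasoning
        G′-value : v (derivativeAt G θ) +⁺ just δ ≈⁺ just Γ.0#
        G′-value = +⁺-cancelʳ-≈ fθ-finite (begin-equality
          (v (derivativeAt G θ) +⁺ just δ) +⁺ V f θ     ≈⟨ +⁺-assoc (v (derivativeAt G θ)) (just δ) (V f θ) ⟩
          v (derivativeAt G θ) +⁺ (just δ +⁺ V f θ)     ≈⟨ +⁺-congˡ {v (derivativeAt G θ)} (+⁺-comm (just δ) (V f θ)) ⟩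
          v (derivativeAt G θ) +⁺ (V f θ +⁺ just δ)     ≈⟨ +⁺-assoc (v (derivativeAt G θ)) (V f θ) (just δ) ⟨
          (v (derivativeAt G θ) +⁺ V f θ) +⁺ just δ     ≈⟨ +⁺-congʳ {just δ} G′ ⟩
          v (derivativeAt f θ) +⁺ just δ                ≈⟨ f′ ⟩
          V f θ                                         ≈⟨ +⁺-identityˡ (V f θ) ⟨
          just Γ.0# +⁺ V f θ                            ∎)

  -- A larger value at `z` would produce a root near `z`, hence near `θ`, and so a larger value at
  -- `θ` too.
  constant-on-ball : ∀ {δ a} → Constant δ a → ∀ {z} → just δ <⁺ v (z - θ) → V a z ≈⁺ V a θ
  constant-on-ball {δ} {a} a-constant {z} z-near with em {P = a ≋ []}
  ... | yes a≋[] = val-cong (trans (evaluate-zero z a≋[]) (sym (evaluate-zero θ a≋[])))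
  ... | no  a≄[] = from-point (point (a-constant ⟪×⟫ minimum a ⟪×⟫ jump⇒root a ⟪×⟫ root⇒jump a≄[]))
    where
    from-point : (∃ λ y → (V a y ≈⁺ V a θ) × (∀ {z} → Near δ z → V a y ≤⁺ V a z) ×
      (∀ {z} → Near δ z → V a y <⁺ V a z → ∃ λ b → evaluate a b ≈ 0# × just δ <⁺ v (z - b)) ×
      (∀ {b z} → evaluate a b ≈ 0# → Near δ z → just δ <⁺ v (z - b) → V a y <⁺ V a z)) → V a z ≈⁺ V a θ
    from-point (y , y≈θ , min , root , jump) = ⁺.antisym
      (⁺.trans (≮⇒≥ λ y<z → let b , a[b]≈0 , p = root (<⇒≤ z-near) y<z in
        <-irrefl y≈θ (jump a[b]≈0 θ-near (<-≤-trans (<-val-+ (proj₁ <-resp-≈ (val-swap z θ) z-near) p)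
          (⁺.reflexive (val-cong (solve 3 (λ θ z b → (θ :- z) :+ (z :- b) := θ :- b) refl θ z b))))))
        (⁺.reflexive y≈θ))
      (⁺.trans (⁺.reflexive (⁺.Eq.sym y≈θ)) (min (<⇒≤ z-near)))

  -- The consequences of isolation that the induction uses: by `slope`, `φ′ / φ` has at `θ` the
  -- value `-κ` of the single term `1 / (θ - β)`, and `generic-value` leaves no room for a root
  -- closer than `κ`.
  record IsolatedRoot (φ : Poly) (κ : Γ.Carrier) : Set u where
    field
      β             : Carrier
      root          : evaluate φ β ≈ 0#
      distance      : v (θ - β) ≈⁺ just κ
      generic-value : Constant κ φ
      slope         : v (derivativeAt φ θ) +⁺ just κ ≈⁺ V φ θ

  -- A root at distance at least κ carries the whole jump λ of φ, so the cofactor is constant.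
  opaque
    isolated-root : ∀ {φ δ κ l m} → ¬ (φ ≋ []) → Finite (V φ θ) → just δ <⁺ just κ → just κ ≈⁺ just δ +⁺ l →
      l +⁺ m ≈⁺ V φ θ → Generically δ (λ y → V φ y ≈⁺ m) → v (derivativeAt φ θ) +⁺ just δ ≤⁺ m → IsolatedRoot φ κ
    isolated-root {φ} {δ} {κ} {l} {m} φ≄[] φθ-finite δ<κ κ≈δ+l l+m≈φθ generic-m slope≤m = from-root close
      where
      open ⁺-Reasoning
      slope≤ : v (derivativeAt φ θ) +⁺ just κ ≤⁺ V φ θ
      slope≤ = begin
        v (derivativeAt φ θ) +⁺ just κ            ≈⟨ +⁺-congˡ {v (derivativeAt φ θ)} κ≈δ+l ⟩
        v (derivativeAt φ θ) +⁺ (just δ +⁺ l)     ≈⟨ +⁺-assoc (v (derivativeAt φ θ)) (just δ) l ⟨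
        (v (derivativeAt φ θ) +⁺ just δ) +⁺ l     ≤⟨ +⁺-monoˡ l slope≤m ⟩
        m +⁺ l                                    ≈⟨ +⁺-comm m l ⟩
        l +⁺ m                                    ≈⟨ l+m≈φθ ⟩
        V φ θ                                     ∎
      -- By `close-root`, roots that are all farther than `κ` would make `v(φ(θ))` too small for
      -- `slope≤`.
      close : ∃ λ β → evaluate φ β ≈ 0# × just κ ≤⁺ v (θ - β)
      close = dne λ ¬close → <⇒≱ (close-root φ≄[] θ λ {b} φ[b]≈0 → ≰⇒> λ p → ¬close (b , φ[b]≈0 , p)) slope≤
      from-root : (∃ λ β → evaluate φ β ≈ 0# × just κ ≤⁺ v (θ - β)) → IsolatedRoot φ κ
      from-root (β , φ[β]≈0 , κ≤) with cofactor φ≄[] φ[β]≈0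
      ... | h , φ≈ , h-minimum = record
        { β = β ; root = φ[β]≈0 ; distance = distance
        ; generic-value = generically-map value (generically-radius ⟪×⟫ generically-avoids β ⟪×⟫ h-minimum κ)
        ; slope = ⁺.antisym slope≤ (from-κ (point (generically-radius {κ} ⟪×⟫ generically-avoids β ⟪×⟫ h-minimum κ ⟪×⟫ derivative-bound φ)))
        }
        where
        φ-value : ∀ z → V φ z ≈⁺ v (z - β) +⁺ v (h z)
        φ-value z = ⁺.Eq.trans (val-cong (φ≈ z)) (*-homo _ _)
        at-δ : ∃ λ y → (V φ y ≈⁺ m) × (v (y - θ) ≈⁺ just δ) × (∀ {z} → Near δ z → v (h y) ≤⁺ v (h z))
        at-δ = point (generic-m ⟪×⟫ generically-radius ⟪×⟫ h-minimum δ)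
        y : Carrier
        y = proj₁ at-δ
        h-≤ : ∀ {z} → Near δ z → v (h y) ≤⁺ v (h z)
        h-≤ = proj₂ (proj₂ (proj₂ at-δ))
        y-β : v (y - β) ≈⁺ just δ
        y-β = ⁺.Eq.trans (val-cong (solve 3 (λ y θ β → y :- β := (y :- θ) :+ (θ :- β)) refl y θ β))
          (⁺.Eq.trans (val-+-dominant (≤-<-trans (⁺.reflexive (proj₁ (proj₂ (proj₂ at-δ)))) (<-≤-trans δ<κ κ≤))) (proj₁ (proj₂ (proj₂ at-δ))))
        φθ≈ : V φ θ ≈⁺ just κ +⁺ v (h y)
        φθ≈ = begin-equality
          V φ θ                          ≈⟨ l+m≈φθ ⟨
          l +⁺ m                         ≈⟨ +⁺-congˡ {l} (proj₁ (proj₂ at-δ)) ⟨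
          l +⁺ V φ y                     ≈⟨ +⁺-congˡ {l} (φ-value y) ⟩
          l +⁺ (v (y - β) +⁺ v (h y))    ≈⟨ +⁺-congˡ {l} (+⁺-congʳ {v (h y)} y-β) ⟩
          l +⁺ (just δ +⁺ v (h y))       ≈⟨ +⁺-assoc l (just δ) (v (h y)) ⟨
          (l +⁺ just δ) +⁺ v (h y)       ≈⟨ +⁺-congʳ {v (h y)} (⁺.Eq.trans (+⁺-comm l (just δ)) (⁺.Eq.sym κ≈δ+l)) ⟩
          just κ +⁺ v (h y)              ∎
        -- The whole jump `l` of `φ` is spent on moving the factor of `β` from `δ` to `κ`; nothing
        -- remains for the cofactor.
        tight : (v (θ - β) ≤⁺ just κ) × (v (h θ) ≤⁺ v (h y))
        tight = +⁺-≤-split (≈-finite (⁺.Eq.sym (φ-value θ)) φθ-finite) κ≤ (h-≤ θ-near)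
          (⁺.reflexive (⁺.Eq.trans (⁺.Eq.sym (φ-value θ)) φθ≈))
        distance : v (θ - β) ≈⁺ just κ
        distance = ⁺.antisym (proj₁ tight) κ≤
        value : ∀ {z} → (v (z - θ) ≈⁺ just κ) × (v (z - β) ≤⁺ just κ) × (∀ {w} → Near κ w → v (h z) ≤⁺ v (h w)) → V φ z ≈⁺ V φ θ
        value {z} (radius , avoids , h-min) = begin-equality
          V φ z                          ≈⟨ φ-value z ⟩
          v (z - β) +⁺ v (h z)           ≈⟨ +⁺-cong z-β (⁺.antisym (⁺.trans (h-min θ-near) (proj₂ tight))
                                              (h-≤ (⁺.trans (<⇒≤ δ<κ) (generic-near radius)))) ⟩
          just κ +⁺ v (h y)              ≈⟨ φθ≈ ⟨
          V φ θ                          ∎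
          where
          z-β : v (z - β) ≈⁺ just κ
          z-β = ⁺.antisym avoids (⁺.trans (≤-val-+ (generic-near radius) κ≤)
            (⁺.reflexive (val-cong (solve 3 (λ z θ β → (z :- θ) :+ (θ :- β) := z :- β) refl z θ β))))
        -- The reverse inequality for `slope` is `derivative-bound` at radius `κ`, taken where `φ`
        -- already has its value at `θ`.
        from-κ : (∃ λ z → (v (z - θ) ≈⁺ just κ) × (v (z - β) ≤⁺ just κ) × (∀ {w} → Near κ w → v (h z) ≤⁺ v (h w)) ×
          (V φ z ≤⁺ v (derivativeAt φ θ) +⁺ just κ)) → V φ θ ≤⁺ v (derivativeAt φ θ) +⁺ just κ
        from-κ (z , radius , avoids , h-min , bound) = ⁺.trans (⁺.reflexive (⁺.Eq.sym (value (radius , avoids , h-min)))) bound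

  minTerms-suc : ∀ γ k xs → minTerms γ (suc k) xs ≈⁺ γ +⁺ minTerms γ k xs
  minTerms-suc γ k []       = ⁺.Eq.sym (+⁺-⊤ γ)
  minTerms-suc γ k (x ∷ xs) = ⁺.Eq.trans (⊓-cong
      (⁺.Eq.trans (⁺.Eq.sym (+⁺-assoc x γ (k ×⁺ γ))) (⁺.Eq.trans (+⁺-congʳ {k ×⁺ γ} (+⁺-comm x γ)) (+⁺-assoc γ x (k ×⁺ γ))))
      (minTerms-suc γ (suc k) xs))
    (⁺.antisym
      (⁺.trans (≤-+⁺-⊓ γ
        (⁺.trans (x⊓y≤x (γ +⁺ (x +⁺ k ×⁺ γ)) (γ +⁺ minTerms γ (suc k) xs)) (⁺.reflexive (+⁺-comm γ (x +⁺ k ×⁺ γ))))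
        (⁺.trans (x⊓y≤y (γ +⁺ (x +⁺ k ×⁺ γ)) (γ +⁺ minTerms γ (suc k) xs)) (⁺.reflexive (+⁺-comm γ (minTerms γ (suc k) xs)))))
        (⁺.reflexive (+⁺-comm _ γ)))
      (⊓-glb (+⁺-monoʳ γ (x⊓y≤x (x +⁺ k ×⁺ γ) (minTerms γ (suc k) xs))) (+⁺-monoʳ γ (x⊓y≤y (x +⁺ k ×⁺ γ) (minTerms γ (suc k) xs)))))

  minTerms-∷ : ∀ γ x xs → minTerms γ 0 (x ∷ xs) ≈⁺ x ⊓ (γ +⁺ minTerms γ 0 xs)
  minTerms-∷ γ x xs = ⊓-cong (+⁺-identityʳ x) (minTerms-suc γ 0 xs)

  -- The value of an expansion is bounded above by that of its constant term: compare
  -- a generic point with the root β of φ.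
  generic-expansion : ∀ {ε φ d β γ ρ} → evaluate φ β ≈ 0# → Near ε β →
    (∀ {a} → Below a d → Generically ε (λ y → V a y ≈⁺ ρ a)) → (∀ {a} → Below a d → V a β ≈⁺ ρ a) →
    Generically ε (λ y → V φ y ≈⁺ γ) →
    ∀ {as} → All (λ a → Below a d) as → Generically ε (λ y → V (expansion φ as) y ≈⁺ minTerms γ 0 (map ρ as))
  generic-expansion φ[β]≈0 β-near low low-β φ-value [] = generically-map (λ _ → zero-∞) generically-radius
  generic-expansion {ε} {φ} {d} {β} {γ} {ρ} φ[β]≈0 β-near low low-β φ-value {a ∷ as} (a₀ ∷ as₀) = generically-map
    (λ {y} (a≈ , φ≈ , F≈ , min) → let open ⁺-Reasoning in begin-equality
      V (expansion φ (a ∷ as)) y                   ≈⟨ value y a≈ φ≈ F≈ min ⟩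
      ρ a ⊓ (γ +⁺ minTerms γ 0 (map ρ as))         ≈⟨ minTerms-∷ γ (ρ a) (map ρ as) ⟨
      minTerms γ 0 (ρ a ∷ map ρ as)                ∎)
    (low a₀ ⟪×⟫ φ-value ⟪×⟫ generic-expansion φ[β]≈0 β-near low low-β φ-value as₀ ⟪×⟫ minimum (expansion φ (a ∷ as)))
    where
    F f : Poly
    F = expansion φ as
    f = expansion φ (a ∷ as)
    f-value : ∀ z → evaluate f z ≈ evaluate a z + evaluate φ z * evaluate F z
    f-value z = trans (evaluate-cong z (≡⇒≋ (≡.sym (≡.trans (⊕-≡ a (φ ⊗ F)) (≡.cong (a +ᴾ_) (⊗-≡ φ F))))))
      (trans (evaluate-⊕ a (φ ⊗ F) z) (+-congˡ (evaluate-⊗ φ F z)))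
    value : ∀ y → V a y ≈⁺ ρ a → V φ y ≈⁺ γ → V F y ≈⁺ minTerms γ 0 (map ρ as) →
      (∀ {z} → Near ε z → V f y ≤⁺ V f z) → V f y ≈⁺ ρ a ⊓ (γ +⁺ minTerms γ 0 (map ρ as))
    value y a≈ φ≈ F≈ min = ⁺.antisym (⊓-glb f≤a f≤φF) (⁺.trans (≤-val-+
        (⁺.trans (x⊓y≤x (ρ a) (γ +⁺ minTerms γ 0 (map ρ as))) (⁺.reflexive (⁺.Eq.sym a≈)))
        (⁺.trans (x⊓y≤y (ρ a) (γ +⁺ minTerms γ 0 (map ρ as))) (⁺.reflexive (⁺.Eq.sym φF≈))))
      (⁺.reflexive (val-cong (sym (f-value y)))))
      where
      open ⁺-Reasoning
      φF≈ : v (evaluate φ y * evaluate F y) ≈⁺ γ +⁺ minTerms γ 0 (map ρ as)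
      φF≈ = ⁺.Eq.trans (*-homo _ _) (+⁺-cong φ≈ F≈)
      f≤a : V f y ≤⁺ ρ a
      f≤a = begin
        V f y                                            ≤⟨ min β-near ⟩
        V f β                                            ≈⟨ val-cong (trans (f-value β) (trans (+-congˡ (trans (*-congʳ φ[β]≈0) (zeroˡ _))) (+-identityʳ _))) ⟩
        V a β                                            ≈⟨ low-β a₀ ⟩
        ρ a                                              ∎
      f≤φF : V f y ≤⁺ γ +⁺ minTerms γ 0 (map ρ as)
      f≤φF = begin
        V f y                                            ≤⟨ ≤-val-sub ⁺.refl (⁺.trans f≤a (⁺.reflexive (⁺.Eq.sym a≈))) ⟩
        v (evaluate f y - evaluate a y)                  ≈⟨ val-cong (trans (+-congʳ (f-value y)) (solve 2 (λ a b → (a :+ b) :- a := b) refl (evaluate a y) _)) ⟩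
        v (evaluate φ y * evaluate F y)                  ≈⟨ φF≈ ⟩
        γ +⁺ minTerms γ 0 (map ρ as)                     ∎

-- Augmentations and continuous families

module Augmentations {u} (em : ∀ {ℓ} → ExcludedMiddle ℓ) (𝕂 : ValuedField u) where

  open ValuedField 𝕂 using (K; Γ)
  open Theory 𝕂 using (Valuationˣ; _⟦_⟧; _≤ⱽ_; _≈ⱽ_; vᴷ; IsAugmented; Family; Augmentation; ordinary; limit; OrdinaryAugmentation; LimitAugmentation)
  open Extended Γ
  open ExtendedProperties Γ
  open PolynomialRing (ring K)
  open PolynomialValuations em 𝕂
  open Classical em
  private
    module Γ = OrderedAbelianGroup Γ
    module K = CommutativeRing (ring K)

  module _ {ρ φ d γ ν} (augmented : IsAugmented ρ φ d γ ν) where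

    private
      module ν = Val ν
      open ⁺-Reasoning

      expansion-≋ : ∀ a as → a ⊕ φ ⊗ expansion φ as ≋ expansion φ (a ∷ as)
      expansion-≋ a as = ≡⇒≋ (≡.trans (⊕-≡ a _) (≡.cong (a +ᴾ_) (⊗-≡ φ (expansion φ as))))

    augmented-low : ∀ {a} → Below a d → ν ⟦ a ⟧ ≈⁺ ρ a
    augmented-low {a} a₀ = begin-equality
      ν ⟦ a ⟧                           ≈⟨ ν.val-cong (≋-trans (≋-sym (≋-trans (ᴾ.+-congˡ (ᴾ.zeroʳ φ)) (ᴾ.+-identityʳ a))) (expansion-≋ a [])) ⟩
      ν ⟦ expansion φ (a ∷ []) ⟧        ≈⟨ augmented (a ∷ []) (isBelow a₀ ∷ []) ⟩
      (ρ a +⁺ just Γ.0#) ⊓ ⊤⁺           ≈⟨ ⁺.antisym (x⊓y≤x (ρ a +⁺ just Γ.0#) ⊤⁺) (⊓-glb ⁺.refl ≤⊤) ⟩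
      ρ a +⁺ just Γ.0#                  ≈⟨ +⁺-identityʳ (ρ a) ⟩
      ρ a                               ∎

    -- The expansion of `φ` has the coefficients 0 and 1, and 1 is an admissible coefficient because
    -- of `1 ≤ d`.
    augmented-key : 1 ℕ.≤ d → ν ⟦ φ ⟧ ≈⁺ γ
    augmented-key 1≤d = begin-equality
      ν ⟦ φ ⟧                                        ≈⟨ ν.val-cong φ≋ ⟩
      ν ⟦ expansion φ ([] ∷ const K.1# ∷ []) ⟧       ≈⟨ augmented ([] ∷ const K.1# ∷ []) (isBelow below-[] ∷ isBelow one₀ ∷ []) ⟩
      (ρ [] +⁺ just Γ.0#) ⊓ ((ρ (const K.1#) +⁺ (γ +⁺ just Γ.0#)) ⊓ ⊤⁺)
        ≈⟨ ⁺.antisym (⁺.trans (x⊓y≤y (ρ [] +⁺ just Γ.0#) _) (x⊓y≤x (ρ (const K.1#) +⁺ (γ +⁺ just Γ.0#)) ⊤⁺))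
             (⊓-glb (⁺.trans ≤⊤ (⁺.reflexive (⁺.Eq.sym ρ[]≈∞))) (⊓-glb ⁺.refl ≤⊤)) ⟩
      ρ (const K.1#) +⁺ (γ +⁺ just Γ.0#)             ≈⟨ +⁺-cong (⁺.Eq.trans (⁺.Eq.sym (augmented-low one₀)) ν.one-0) (+⁺-identityʳ γ) ⟩
      just Γ.0# +⁺ γ                                 ≈⟨ +⁺-identityˡ γ ⟩
      γ                                              ∎
      where
      one₀ : Below (const K.1#) d
      one₀ = below-weaken 1≤d below-const
      ρ[]≈∞ : ρ [] +⁺ just Γ.0# ≈⁺ ⊤⁺
      ρ[]≈∞ = ⁺.Eq.trans (+⁺-identityʳ (ρ [])) (⁺.Eq.trans (⁺.Eq.sym (augmented-low below-[])) ν.zero-∞)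
      φ≋ : φ ≋ expansion φ ([] ∷ const K.1# ∷ [])
      φ≋ = ≋-trans (≋-sym (≋-trans (ᴾ.+-identityˡ _) (≋-trans (ᴾ.*-congˡ (≋-trans (≋-sym (expansion-≋ (const K.1#) []))
        (≋-trans (ᴾ.+-congˡ (ᴾ.zeroʳ φ)) (ᴾ.+-identityʳ _)))) (ᴾ.*-identityʳ φ)))) (expansion-≋ [] (const K.1# ∷ []))

  module Families (𝒜 : Family) where

    open Family 𝒜 public
    open StrictTotalOrder index public using (compare) renaming (trans to <ᴶ-trans; <-resp-≈ to <ᴶ-resp-≈; module Eq to ≈ᴶ)

    <ᴶ-irrefl : ∀ {i} → ¬ (i <ᴶ i)
    <ᴶ-irrefl = StrictTotalOrder.irrefl index ≈ᴶ.refl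

    ρ-≤ : ∀ {i j} → ¬ (j <ᴶ i) → ρ i ≤ⱽ ρ j
    ρ-≤ {i} {j} j≮i with compare i j
    ... | tri< i<j _ _ = proj₁ (ρ-mono i<j)
    ... | tri≈ _ i≈j _ = λ f → ⁺.reflexive (ρ-cong i≈j f)
    ... | tri> _ _ j<i = contradiction j<i j≮i

    later : ∀ i j → ∃ λ k → (∀ l → ¬ (l <ᴶ k) → ¬ (l <ᴶ i)) × (∀ l → ¬ (l <ᴶ k) → ¬ (l <ᴶ j))
    later i j with compare i j
    ... | tri< i<j _ _ = j , (λ l l≮j l<i → l≮j (<ᴶ-trans l<i i<j)) , λ l l≮j → l≮j
    ... | tri≈ _ i≈j _ = j , (λ l l≮j l<i → l≮j (proj₁ <ᴶ-resp-≈ i≈j l<i)) , λ l l≮j → l≮j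
    ... | tri> _ _ j<i = i , (λ l l≮i → l≮i) , λ l l≮i l<j → l≮i (<ᴶ-trans l<j j<i)

    module _ {ρ∞ : Poly → Γ⁺} {d} (stable : ∀ {a} → Below a d → HasStableValue a (ρ∞ a)) where

      stable-≤ : ∀ j {a} → Below a d → ρ j ⟦ a ⟧ ≤⁺ ρ∞ a
      stable-≤ j {a} a₀ with stable a₀
      ... | i , ρᵢ≈ with compare j i
      ...   | tri< j<i _ j≯i = ⁺.trans (proj₁ (ρ-mono j<i) a) (⁺.reflexive (ρᵢ≈ i <ᴶ-irrefl))
      ...   | tri≈ j≮i _ _ = ⁺.reflexive (ρᵢ≈ j j≮i)
      ...   | tri> j≮i _ _ = ⁺.reflexive (ρᵢ≈ j j≮i)

      eventually : J → ∀ {as} → All (λ a → Below a d) as →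
        ∃ λ i → ∀ j → ¬ (j <ᴶ i) → All (λ a → ρ j ⟦ a ⟧ ≈⁺ ρ∞ a) as
      eventually i₀ []        = i₀ , λ _ _ → []
      eventually i₀ (a₀ ∷ as) with stable a₀ | eventually i₀ as
      ... | i , ρᵢ≈ | j , ρⱼ≈ with later i j
      ...   | k , k≥i , k≥j = k , λ l l≮k → ρᵢ≈ l (k≥i l l≮k) ∷ ρⱼ≈ l (k≥j l l≮k)

  private
    stable-value : ∀ {μ φ d γ ν} (A : LimitAugmentation μ φ d γ ν) → let open LimitAugmentation A in
      ∀ {a} → Below a d → Family.HasStableValue 𝒜 a (ρ∞ a)
    stable-value A a₀ = LimitAugmentation.ρ∞-stable A _ (isBelow a₀)

  -- In the limit case no single member of the family need agree with `ν` on all polynomials of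
  -- degree below `d`, but on finitely many it does from some index on. The hypothesis of
  -- `key-degree-≥` is shaped to cover both kinds of augmentation.
  approximate : ∀ {μ φ d γ ν} → 1 ℕ.≤ d → Augmentation μ φ d γ ν → ∀ fs → All (λ f → Below f d) fs →
    ∃ λ ρ → All (λ f → ρ ⟦ f ⟧ ≈⁺ ν ⟦ f ⟧) fs × ρ ⟦ φ ⟧ <⁺ ν ⟦ φ ⟧
  approximate {μ} {φ} {d} {γ} {ν} 1≤d (ordinary A) fs fs₀ =
    μ , All.map (λ f₀ → ⁺.Eq.sym (augmented-low {μ ⟦_⟧} {φ} {d} {γ} {ν} isAugmented f₀)) fs₀ ,
    proj₁ <-resp-≈ (⁺.Eq.sym (augmented-key {μ ⟦_⟧} {φ} {d} {γ} {ν} isAugmented 1≤d)) above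
    where open OrdinaryAugmentation A
  approximate {φ = φ} {d} {γ} {ν} 1≤d (limit A) fs fs₀ with Families.eventually (LimitAugmentation.𝒜 A) (stable-value A) (proj₁ (LimitAugmentation.isFirst A)) fs₀
  ... | i , ρ≈ = Family.ρ 𝒜 i ,
    All.zipWith (λ (e , f₀) → ⁺.Eq.trans e (⁺.Eq.sym (augmented-low {ρ∞} {φ} {d} {γ} {ν} isAugmented f₀)))
      (ρ≈ i (Families.<ᴶ-irrefl 𝒜) , fs₀) ,
    proj₁ <-resp-≈ (⁺.Eq.sym (augmented-key {ρ∞} {φ} {d} {γ} {ν} isAugmented 1≤d)) (above i)
    where open LimitAugmentation A

  -- Quantified over all families with first member `μ`, because it is not known in advance which of
  -- them, if any, the next step of the chain uses.
  KeepsBelow : Valuationˣ → ℕ → Set (lsuc u)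
  KeepsBelow μ m = ∀ 𝒜 → Family.IsFirst 𝒜 μ → ∀ j {f} → Below f m → Family.ρ 𝒜 j ⟦ f ⟧ ≈⁺ μ ⟦ f ⟧

  constants-keep : ∀ {μ} → KeepsBelow μ 1
  constants-keep {μ} 𝒜 _ j {f} f₀ = begin-equality
    ρ j ⟦ f ⟧                  ≈⟨ Val.val-cong (ρ j) (below-1⇒const f₀) ⟩
    ρ j ⟦ const (coeff f 0) ⟧  ≈⟨ Valuationˣ.extends (ρ j) (coeff f 0) ⟩
    vᴷ (coeff f 0)             ≈⟨ Valuationˣ.extends μ (coeff f 0) ⟨
    μ ⟦ const (coeff f 0) ⟧    ≈⟨ Val.val-cong μ (below-1⇒const f₀) ⟨
    μ ⟦ f ⟧                    ∎
    where
    open Family 𝒜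
    open ⁺-Reasoning

  -- All members have the degree of the first, which is `ν`. By `key-degree-≥` this degree is at
  -- least `d`, and below its degree a valuation agrees with any larger one.
  augmentation-keeps : ∀ {μ φ d γ ν} → 1 ℕ.≤ d → IsMonic φ d → Augmentation μ φ d γ ν → KeepsBelow ν d
  augmentation-keeps {μ} {φ} {d} {γ} {ν} 1≤d φ-monic A 𝒜 (i , first , ρᵢ≈ν) j {f} f₀ = ⁺.Eq.trans
    (⁺.Eq.sym (degree⇒agree {ρ i} {ρ j} (degrees i) (ρ-≤ (first j)) (below-weaken d≤D f₀))) (ρᵢ≈ν f)
    where
    open Families 𝒜
    approximate′ : ∀ fs → All (λ f → Below f d) fs → ∃ λ ρ′ → All (λ f → ρ′ ⟦ f ⟧ ≈⁺ ρ i ⟦ f ⟧) fs × ρ′ ⟦ φ ⟧ <⁺ ρ i ⟦ φ ⟧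
    approximate′ fs fs₀ with approximate 1≤d A fs fs₀
    ... | ρ′ , ρ′≈ , φ< = ρ′ , All.map (λ {f} e → ⁺.Eq.trans e (⁺.Eq.sym (ρᵢ≈ν f))) ρ′≈ , proj₁ <-resp-≈ (⁺.Eq.sym (ρᵢ≈ν φ)) φ<
    d≤D : d ℕ.≤ degree
    d≤D = key-degree-≥ φ-monic approximate′ (proj₂ (proj₁ (degrees i)))

  keeps-step : ∀ {μ φ d γ ν m} → Augmentation μ φ d γ ν → KeepsBelow μ m → m ℕ.≤ d → ∀ {f} → Below f m → ν ⟦ f ⟧ ≈⁺ μ ⟦ f ⟧
  keeps-step {μ} {φ} {d} {γ} {ν} (ordinary A) keeps m≤d f₀ = augmented-low {μ ⟦_⟧} {φ} {d} {γ} {ν} (OrdinaryAugmentation.isAugmented A) (below-weaken m≤d f₀)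
  keeps-step {μ} {φ} {d} {γ} {ν} (limit A) keeps m≤d {f} f₀ with stable-value A (below-weaken m≤d f₀)
  ... | i , ρ≈ = ⁺.Eq.trans (augmented-low {ρ∞} {φ} {d} {γ} {ν} isAugmented (below-weaken m≤d f₀)) (⁺.Eq.trans
    (⁺.Eq.sym (ρ≈ i (Families.<ᴶ-irrefl 𝒜)))
    (keeps 𝒜 isFirst i f₀))
    where open LimitAugmentation A

-- Exclusion of limit augmentations

module LimitSteps (em : ∀ {ℓ} → ExcludedMiddle ℓ) (𝕂 : ValuedField u)
  (θ : HeytingField.Carrier (ValuedField.K̄ 𝕂)) where

  open ValuedField 𝕂 using (K; K̄; embedding; Γ; valuation)
  open Theory 𝕂 using (v; Valuationˣ; _⟦_⟧; _≤ⱽ_; _≈ⱽ_; Family; LimitAugmentation)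
  open CommutativeRing (ring K̄) hiding (ring; rawRing; zero)
  open Extended Γ
  open ExtendedProperties Γ
  open ValuationProperties Γ (ring K̄) valuation
  open FieldHom embedding using () renaming (isHom to ι-isHom)
  open PolynomialRing (ring K)
  open Evaluation (ring K) (ring K̄) ι-isHom
  open FieldPolynomials em K using (monic≄[])
  open PolynomialValuations em 𝕂
  open Augmentations em 𝕂
  open GenericPoints em 𝕂 θ
  open Approximation em 𝕂 θ using (V)
  open Valuations Γ using (comap)
  open Classical em

  evaluationAt : Carrier → Valuationˣ
  evaluationAt β = record
    { isValuation = comap (evaluate-isHom β) valuation
    ; extends     = λ a → val-cong (evaluate-const a β) }

  module _ {μ φ m ε} (φ-monic : IsMonic φ m) (value : ∀ f → Generically ε (λ y → μ ⟦ f ⟧ ≈⁺ V f y))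
    {β} (φ[β]≈0 : evaluate φ β ≈ 0#) (β-near : Near ε β)
    (keeps : KeepsBelow μ m) (low : ∀ {f} → Below f m → μ ⟦ f ⟧ ≈⁺ V f θ)
    {g} (g-monic : IsMonic g m) (optimal : ∀ {ψ} → IsMonic ψ m → μ ⟦ ψ ⟧ <⁺ V ψ θ → V ψ θ ≤⁺ V g θ) where

    -- The degree of the family is m, so any two of its members differ at a monic polynomial ψ
    -- of degree m; since g is at least as close to θ as ψ, they differ at g, which is thus unstable.
    no-limit : ∀ {φ′ d γ ν} → m ℕ.< d → (A : LimitAugmentation μ φ′ d γ ν) → ¬ (∀ {f} → Below f d → ν ⟦ f ⟧ ≈⁺ V f θ)
    no-limit {φ′} {d} {γ} {ν} m<d A ν≈ = isLimitKeyPolynomial .Family.IsLimitKeyPolynomial.minimal g g-unstable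
      (isBelow (below-weaken m<d (bounded g-monic)))
      where
      open LimitAugmentation A using (𝒜; isFirst; isLimitKeyPolynomial; ρ∞; ρ∞-stable; isAugmented)
      open Families 𝒜
      open ⁺-Reasoning
      i₀ : J
      i₀ = proj₁ isFirst
      ρ-first : ρ i₀ ≈ⱽ μ
      ρ-first = proj₂ (proj₂ isFirst)
      μ≤ρ : ∀ j → μ ≤ⱽ ρ j
      μ≤ρ j f = ⁺.trans (⁺.reflexive (⁺.Eq.sym (ρ-first f))) (ρ-≤ (proj₁ (proj₂ isFirst) j) f)
      ρ≤θ : ∀ j {f} → Below f d → ρ j ⟦ f ⟧ ≤⁺ V f θ
      ρ≤θ j {f} f₀ = begin
        ρ j ⟦ f ⟧     ≤⟨ stable-≤ (λ a₀ → ρ∞-stable _ (isBelow a₀)) j f₀ ⟩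
        ρ∞ f          ≈⟨ augmented-low {ρ∞} {φ′} {d} {γ} {ν} isAugmented f₀ ⟨
        ν ⟦ f ⟧       ≈⟨ ν≈ f₀ ⟩
        V f θ         ∎
      -- Below the degree of the family its first member agrees with any larger valuation, in
      -- particular with evaluation at `β`. The latter sends `φ`, of degree `m`, to ∞, whereas
      -- `μ ⟦ φ ⟧` is finite.
      D≤m : degree ℕ.≤ m
      D≤m = ℕ.≮⇒≥ λ m<D → <-irrefl (⁺.Eq.trans (⁺.Eq.sym (ρ-first φ))
          (⁺.Eq.trans (degree⇒agree {ρ i₀} {evaluationAt β} (degrees i₀) ρ≤β (below-weaken m<D (bounded φ-monic))) (⁺.Eq.trans (val-cong φ[β]≈0) zero-∞)))
        (finite⇒<⊤ φ-finite)
        where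
        ρ≤β : ρ i₀ ≤ⱽ evaluationAt β
        ρ≤β f = let y , μ≈ , min = point (value f ⟪×⟫ minimum f) in
          ⁺.trans (⁺.reflexive (⁺.Eq.trans (ρ-first f) μ≈)) (min β-near)
        φ-finite : Finite (μ ⟦ φ ⟧)
        φ-finite = let y , μ≈ , finite = point (value φ ⟪×⟫ generically-finite (monic≄[] φ-monic)) in ≈-finite μ≈ finite
      ρ-low : ∀ j {f} → Below f m → ρ j ⟦ f ⟧ ≈⁺ V f θ
      ρ-low j f₀ = ⁺.Eq.trans (keeps 𝒜 isFirst j f₀) (low f₀)
      module _ {i j} (i<j : i <ᴶ j) where
        jump-at : ∃ λ f → ρ i ⟦ f ⟧ <⁺ ρ j ⟦ f ⟧
        jump-at = let f , f≉ = ¬∀⇒∃¬ (proj₂ (ρ-mono i<j)) in f , ≤∧≉⇒< (proj₁ (ρ-mono i<j) f) f≉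
        -- The degree of a least jump from `ρ i` to `ρ j` is at most the degree of `ρ j`, hence at
        -- most `m`. It is not smaller, since below `m` all members give the value at `θ`.
        jump-monic : ∃ λ ψ → IsMonic ψ m × ρ i ⟦ ψ ⟧ <⁺ ρ j ⟦ ψ ⟧
        jump-monic = from-minimal (jump⇒minimal-jump {ρ i} {ρ j} (degrees i) (proj₁ (ρ-mono i<j)) (proj₂ jump-at))
          where
          from-minimal : (∃₂ λ n ψ → IsMonic ψ n × ρ i ⟦ ψ ⟧ <⁺ ρ j ⟦ ψ ⟧ × degree ℕ.≤ n ×
            (∀ {f} → Below f n → ρ i ⟦ f ⟧ ≈⁺ ρ j ⟦ f ⟧)) → ∃ λ ψ → IsMonic ψ m × ρ i ⟦ ψ ⟧ <⁺ ρ j ⟦ ψ ⟧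
          from-minimal (n , ψ , ψ-monic , ψ< , _ , agree) = ψ , ≡.subst (IsMonic ψ) (ℕ.≤-antisym n≤m m≤n) ψ-monic , ψ<
            where
            n≤m : n ℕ.≤ m
            n≤m = ℕ.≤-trans (key-degree-≥ ψ-monic (λ fs fs₀ → ρ i , All.map agree fs₀ , ψ<) (proj₂ (proj₁ (degrees j)))) D≤m
            m≤n : m ℕ.≤ n
            m≤n = ℕ.≮⇒≥ λ n<m → let ψ₀ = below-weaken n<m (bounded ψ-monic) in
              <-irrefl (⁺.Eq.trans (ρ-low i ψ₀) (⁺.Eq.sym (ρ-low j ψ₀))) ψ<
        -- By the optimality of `g`, the difference of `g` and `ψ`, of degree below `m`, has value
        -- at least `ρ j ⟦ ψ ⟧` for both members; so `g` inherits the jump of `ψ`.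
        jump-g : (∃ λ ψ → IsMonic ψ m × ρ i ⟦ ψ ⟧ <⁺ ρ j ⟦ ψ ⟧) → ρ i ⟦ g ⟧ <⁺ ρ j ⟦ g ⟧
        jump-g (ψ , ψ-monic , ψ<) = begin-strict
          ρ i ⟦ g ⟧       ≈⟨ Val.val-cong (ρ i) g≋ ⟩
          ρ i ⟦ ψ ⊕ w ⟧   ≈⟨ Val.val-+-dominant (ρ i) (<-≤-trans ψ< (⁺.trans ψ≤w (⁺.reflexive (⁺.Eq.sym (ρ-low i w₀))))) ⟩
          ρ i ⟦ ψ ⟧       <⟨ ψ< ⟩
          ρ j ⟦ ψ ⟧       ≤⟨ Val.≤-val-+ (ρ j) ⁺.refl (⁺.trans ψ≤w (⁺.reflexive (⁺.Eq.sym (ρ-low j w₀)))) ⟩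
          ρ j ⟦ ψ ⊕ w ⟧   ≈⟨ Val.val-cong (ρ j) g≋ ⟨
          ρ j ⟦ g ⟧       ∎
          where
          w : Poly
          w = g ⊝ ψ
          w₀ : Below w m
          w₀ = monic-⊝ g-monic ψ-monic
          g≋ : g ≋ ψ ⊕ w
          g≋ = ᴾ.solve 2 (λ g ψ → g ᴾ.:= ψ ᴾ.:+ (g ᴾ.:- ψ)) ≋-refl g ψ
          ψ≤θ : ρ j ⟦ ψ ⟧ ≤⁺ V ψ θ
          ψ≤θ = ρ≤θ j (below-weaken m<d (bounded ψ-monic))
          ψ≤w : ρ j ⟦ ψ ⟧ ≤⁺ V w θ
          ψ≤w = begin
            ρ j ⟦ ψ ⟧                           ≤⟨ ≤-val-sub (⁺.trans ψ≤θ (optimal ψ-monic (≤-<-trans (μ≤ρ i ψ) (<-≤-trans ψ< ψ≤θ)))) ψ≤θ ⟩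
            v (evaluate g θ - evaluate ψ θ)     ≈⟨ val-cong (trans (evaluate-⊕ g (⊖ ψ) θ) (+-congˡ (evaluate-⊖ ψ θ))) ⟨
            V w θ                               ∎
      g-unstable : Unstable g
      g-unstable i<j = jump-g i<j (jump-monic i<j)

-- The induction along the chain

module Stages (em : ∀ {ℓ} → ExcludedMiddle ℓ) (𝕂 : ValuedField u)
  (θ : HeytingField.Carrier (ValuedField.K̄ 𝕂)) where

  open ValuedField 𝕂 using (K; K̄; embedding; Γ; valuation)
  open Theory 𝕂 using (v; vᴷ; Valuationˣ; _⟦_⟧; Degree; IsTame; IsInitial; minTerms; Augmentation; ordinary; limit; OrdinaryAugmentation)
  open CommutativeRing (ring K̄) hiding (ring; rawRing; zero)
  open Extended Γ
  open ExtendedProperties Γ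
  open ValuationProperties Γ (ring K̄) valuation
  open FieldHom embedding using () renaming (⟦_⟧ to ι; isHom to ι-isHom)
  open IsRingHomomorphism ι-isHom using (1#-homo)
  open PolynomialRing (ring K)
  open Evaluation (ring K) (ring K̄) ι-isHom
  open FieldPolynomials em K using (monic≄[])
  open PolynomialValuations em 𝕂
  open Augmentations em 𝕂
  open GenericPoints em 𝕂 θ
  open Approximation em 𝕂 θ
  open LimitSteps em 𝕂 θ using (no-limit)
  open SimpleExtensions em 𝕂 using (annihilator; root-degree)
  open RingProperties (CommutativeRing.ring (ring K̄)) using (-0#≈0#)
  open IntegralSolver (ring K̄) using (solve; _:=_; _:+_; _:-_; :-_)
  private
    module Γ = OrderedAbelianGroup Γ
    module K = CommutativeRing (ring K)

  -- The induction hypothesis. `value` identifies `μ` on all of K[x], and `isolated` feeds the next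
  -- use of tameness. `optimal` serves to exclude a limit step; it is restricted to those `ψ` that
  -- jump beyond `μ`, since only for these is there a slope estimate.
  record Stage (μ : Valuationˣ) (φ : Poly) (m : ℕ) (α : Carrier) (ε : Γ.Carrier) : Set u where
    field
      value    : ∀ f → Generically ε (λ y → μ ⟦ f ⟧ ≈⁺ V f y)
      isolated : IsolatedRoot φ ε
      optimal  : ∀ {g ψ} → IsMonic g m → evaluate g α ≈ 0# → IsMonic ψ m → μ ⟦ ψ ⟧ <⁺ V ψ θ → V ψ θ ≤⁺ V g θ

    open IsolatedRoot isolated public

    β-near : Near ε β
    β-near = ⁺.trans (⁺.reflexive (⁺.Eq.sym distance)) (⁺.reflexive (val-swap θ β))

    far-root : ∀ {f b} → ¬ (f ≋ []) → evaluate f b ≈ 0# → μ ⟦ f ⟧ ≈⁺ V f θ → v (θ - b) ≤⁺ just ε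
    far-root {f} {b} f≄[] f[b]≈0 μ≈θ = ≮⇒≥ λ ε<b →
      let y , μ≈y , jump = point (value f ⟪×⟫ root⇒jump f≄[]) in
      <-irrefl (⁺.Eq.trans (⁺.Eq.sym μ≈y) μ≈θ) (jump f[b]≈0 θ-near ε<b)

  Best : Carrier → ℕ → Set u
  Best α m = ∀ b k → Degree b k → k ℕ.< m → v (θ - b) ≤⁺ v (θ - α)

  best-root : ∀ {α m f k b} → Best α m → ¬ (f ≋ []) → Below f k → k ℕ.≤ m → evaluate f b ≈ 0# → v (θ - b) ≤⁺ v (θ - α)
  best-root {b = b} best f≄[] f₀ k≤m f[b]≈0 = let j , b-degree , j<k = root-degree f≄[] f₀ f[b]≈0 in
    best b j b-degree (ℕ.<-≤-trans j<k k≤m)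

  -- Dependence of the powers of `α` gives degree at most `m`; an annihilator of smaller degree
  -- would give `α` a degree below `m`.
  monic-annihilator : ∀ {α m} → Degree α m → (∀ k → Degree α k → ¬ (k ℕ.< m)) → ∃ λ g → IsMonic g m × evaluate g α ≈ 0#
  monic-annihilator {α} {m} α-degree least with annihilator α-degree
  ... | g , d , g-monic , d≤m , g[α]≈0 = g , ≡.subst (IsMonic g) (ℕ.≤-antisym d≤m (ℕ.≮⇒≥ λ d<m →
    let k , degree , k<1+d = root-degree (monic≄[] g-monic) (bounded g-monic) g[α]≈0 in
    least k degree (ℕ.<-≤-trans k<1+d d<m))) g-monic , g[α]≈0

  -- A monic linear polynomial is `x - b`, so its values are distances, and the claims reduce to the
  -- ultrametric inequality and to the maximality of `v (θ - α)`.
  initial-stage : ∀ {μ φ α ε γ m} → IsMonic φ 1 → IsInitial φ γ μ → V φ θ ≈⁺ γ → γ ≈⁺ just ε →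
    1 ℕ.< m → Best α m → Stage μ φ 1 α ε
  initial-stage {μ} {φ} {α} {ε} {γ} {m} φ-monic initial φθ≈γ γ≈ε 1<m best = record
    { value    = λ f → generic-value′ (expand φ-monic (s≤s z≤n) f)
    ; isolated = record
      { β = β ; root = φ[β]≈0
      ; distance = ⁺.Eq.trans (⁺.Eq.sym (linear-value φ-monic θ)) φθ≈ε
      ; generic-value = generically-map (λ {y} (radius , avoids) → let open ⁺-Reasoning in begin-equality
          V φ y       ≈⟨ linear-value φ-monic y ⟩
          v (y - β)   ≈⟨ ⁺.antisym avoids (⁺.trans (≤-val-+ (generic-near radius) θ-β) (⁺.reflexive (val-cong
                           (solve 3 (λ y θ β → (y :- θ) :+ (θ :- β) := y :- β) refl y θ β)))) ⟩
          just ε      ≈⟨ φθ≈ε ⟨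
          V φ θ       ∎) (generically-radius ⟪×⟫ generically-avoids β)
      ; slope = ⁺.Eq.trans (+⁺-congʳ {just ε} φ′≈0) (⁺.Eq.trans (+⁺-identityˡ (just ε)) (⁺.Eq.sym φθ≈ε)) }
    ; optimal  = λ {g} {ψ} g-monic g[α]≈0 ψ-monic _ → let open ⁺-Reasoning in begin
        V ψ θ                        ≈⟨ linear-value ψ-monic θ ⟩
        v (θ - linear-root ψ)        ≤⟨ best-root best (monic≄[] ψ-monic) (bounded ψ-monic) 1<m (linear-root-value ψ-monic) ⟩
        v (θ - α)                    ≈⟨ val-cong (linear-difference g-monic g[α]≈0) ⟩
        V g θ                        ∎
    }
    where
    linear-root : Poly → Carrier
    linear-root f = - ι (coeff f 0)

    linear-evaluate : ∀ {f} → IsMonic f 1 → ∀ z → evaluate f z ≈ ι (coeff f 0) + z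
    linear-evaluate {f} (monic f₁ f₀) z = trans (evaluate-cong z f≋) (+-congˡ (trans (*-congˡ (trans (evaluate-const K.1# z) 1#-homo)) (*-identityʳ z)))
      where
      f≋ : f ≋ coeff f 0 ∷ K.1# ∷ []
      f≋ = coefficients λ
        { zero          → K.refl
        ; (suc zero)    → f₁
        ; (suc (suc k)) → isBelow f₀ (suc (suc k)) (s≤s (s≤s z≤n)) }

    linear-difference : ∀ {f b} → IsMonic f 1 → evaluate f b ≈ 0# → ∀ {z} → z - b ≈ evaluate f z
    linear-difference {f} {b} f-monic f[b]≈0 {z} = trans (solve 3 (λ c z b → z :- b := (c :+ z) :- (c :+ b)) refl (ι (coeff f 0)) z b)
      (trans (+-cong (sym (linear-evaluate f-monic z)) (-‿cong (trans (sym (linear-evaluate f-monic b)) f[b]≈0)))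
        (trans (+-congˡ -0#≈0#) (+-identityʳ _)))

    linear-root-value : ∀ {f} → IsMonic f 1 → evaluate f (linear-root f) ≈ 0#
    linear-root-value {f} f-monic = trans (linear-evaluate f-monic _) (-‿inverseʳ _)

    linear-value : ∀ {f} → IsMonic f 1 → ∀ z → V f z ≈⁺ v (z - linear-root f)
    linear-value f-monic z = val-cong (sym (linear-difference f-monic (linear-root-value f-monic)))

    β : Carrier
    β = linear-root φ

    φ[β]≈0 : evaluate φ β ≈ 0#
    φ[β]≈0 = linear-root-value φ-monic

    φθ≈ε : V φ θ ≈⁺ just ε
    φθ≈ε = ⁺.Eq.trans φθ≈γ γ≈ε

    θ-β : just ε ≤⁺ v (θ - β)
    θ-β = ⁺.reflexive (⁺.Eq.trans (⁺.Eq.sym φθ≈ε) (linear-value φ-monic θ))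

    φ′≈0 : v (derivativeAt φ θ) ≈⁺ just Γ.0#
    φ′≈0 = ⁺.Eq.trans (val-cong (trans (derivativeAt-cong θ f≋) (trans (+-cong (trans (evaluate-const K.1# θ) 1#-homo)
        (trans (*-congˡ (derivativeAt-const K.1# θ)) (zeroʳ θ))) (+-identityʳ 1#)))) one-0
      where
      f≋ : φ ≋ coeff φ 0 ∷ K.1# ∷ []
      f≋ = coefficients λ
        { zero          → K.refl
        ; (suc zero)    → leading φ-monic
        ; (suc (suc k)) → isBelow (bounded φ-monic) (suc (suc k)) (s≤s (s≤s z≤n)) }

    ρ : Poly → Γ⁺
    ρ a = vᴷ (coeff a 0)

    constant-value : ∀ {a} → Below a 1 → ∀ z → V a z ≈⁺ ρ a
    constant-value {a} a₀ z = val-cong (trans (evaluate-cong z (below-1⇒const a₀)) (evaluate-const (coeff a 0) z))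

    expansion-constants : ∀ {as} → All (λ a → Below a 1) as → expansion φ as ≋ expansion φ (map const (map (λ a → coeff a 0) as))
    expansion-constants []                    = ≋-refl
    expansion-constants (_∷_ {a} {as} a₀ as₀) = ≋-trans (step a as) (≋-trans
      (ᴾ.+-cong (below-1⇒const a₀) (ᴾ.*-congˡ (expansion-constants as₀))) (≋-sym (step (const (coeff a 0)) (map const (map (λ a → coeff a 0) as)))))
      where
      step : ∀ a as → expansion φ (a ∷ as) ≋ a ⊕ φ ⊗ expansion φ as
      step a as = ≡⇒≋ (≡.sym (≡.trans (⊕-≡ a _) (≡.cong (a +ᴾ_) (⊗-≡ φ (expansion φ as)))))

    generic-value′ : ∀ {f} → (∃ λ as → All (λ a → Below a 1) as × expansion φ as ≋ f) → Generically ε (λ y → μ ⟦ f ⟧ ≈⁺ V f y)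
    generic-value′ {f} (as , as₀ , e) = generically-map (λ {y} F≈ → let open ⁺-Reasoning in begin-equality
        μ ⟦ f ⟧                                                ≈⟨ Val.val-cong μ (≋-trans (≋-sym e) (expansion-constants as₀)) ⟩
        μ ⟦ expansion φ (map const (map (λ a → coeff a 0) as)) ⟧   ≈⟨ initial (map (λ a → coeff a 0) as) ⟩
        minTerms γ 0 (map vᴷ (map (λ a → coeff a 0) as))       ≈⟨ ⁺.Eq.reflexive (≡.cong (minTerms γ 0) (≡.sym (map-∘ as))) ⟩
        minTerms γ 0 (map ρ as)                                ≈⟨ F≈ ⟨
        V (expansion φ as) y                                   ≈⟨ val-cong (evaluate-cong y e) ⟩
        V f y                                                  ∎)
      (generic-expansion {ρ = ρ} φ[β]≈0 (⁺.trans θ-β (⁺.reflexive (val-swap θ β)))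
        (λ a₀ → generically-map (λ {y} _ → constant-value a₀ y) generically-radius) (λ a₀ → constant-value a₀ β)
        (generically-map (λ {y} (radius , avoids) → let open ⁺-Reasoning in begin-equality
          V φ y       ≈⟨ linear-value φ-monic y ⟩
          v (y - β)   ≈⟨ ⁺.antisym avoids (⁺.trans (≤-val-+ (generic-near radius) θ-β) (⁺.reflexive (val-cong
                           (solve 3 (λ y θ β → (y :- θ) :+ (θ :- β) := y :- β) refl y θ β)))) ⟩
          just ε      ≈⟨ γ≈ε ⟨
          γ           ∎) (generically-radius ⟪×⟫ generically-avoids β)) as₀)

  module _ {μ φ m α ε} (stage : Stage μ φ m α ε) (φ-monic : IsMonic φ m)
    (keeps : KeepsBelow μ m) (low : ∀ {f} → Below f m → μ ⟦ f ⟧ ≈⁺ V f θ)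
    {g} (g-monic : IsMonic g m) (g[α]≈0 : evaluate g α ≈ 0#) where

    open Stage stage

    ordinary-step : ∀ {φ′ d γ ν} → m ℕ.< d → Augmentation μ φ′ d γ ν → (∀ {f} → Below f d → ν ⟦ f ⟧ ≈⁺ V f θ) →
                    OrdinaryAugmentation μ φ′ d γ ν
    ordinary-step m<d (ordinary A) ν≈ = A
    ordinary-step m<d (limit A)    ν≈ = ⊥-elim
      (no-limit φ-monic value root β-near keeps low g-monic (λ ψ-monic → optimal g-monic g[α]≈0 ψ-monic) m<d A ν≈)

    -- `α` is no closer than `ε`, being a root of `g`, whose degree is below `d`, where nothing
    -- jumps. It is no farther, because the root `β` of `φ` has degree at most `m < m′` and competes
    -- with `α`.
    stage-distance : ∀ {d m′} → m ℕ.< d → (∀ {f} → Below f d → μ ⟦ f ⟧ ≈⁺ V f θ) → m ℕ.< m′ → Best α m′ → v (θ - α) ≈⁺ just ε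
    stage-distance m<d μ≈ m<m′ best = ⁺.antisym
      (far-root (monic≄[] g-monic) g[α]≈0 (μ≈ (below-weaken m<d (bounded g-monic))))
      (⁺.trans (⁺.reflexive (⁺.Eq.sym distance)) (best-root best (monic≄[] φ-monic) (bounded φ-monic) m<m′ root))

  -- `α′` and `m′` are the next member of the Okutsu sequence and its degree, `m″` is the degree
  -- after it, `l` the new secondary slope and `κ` the new radius.
  module NextStage (tame : IsTame θ) {μ φ m α ε} (stage : Stage μ φ m α ε) (φθ-finite : Finite (V φ θ))
    {φ′ d γ ν} (φ′-monic : IsMonic φ′ d) (1≤d : 1 ℕ.≤ d) (A : OrdinaryAugmentation μ φ′ d γ ν)
    (μ≈ : ∀ {f} → Below f d → μ ⟦ f ⟧ ≈⁺ V f θ) (φ′θ≈γ : V φ′ θ ≈⁺ γ) (γ-finite : Finite γ)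
    {α′ m′ m″} (ε≈ : v (θ - α) ≈⁺ just ε) (best : Best α m′) (best′ : Best α′ m″) (m′<m″ : m′ ℕ.< m″)
    (closer : v (θ - α) <⁺ v (θ - α′)) {g′} (g′-monic : IsMonic g′ m′) (g′[α′]≈0 : evaluate g′ α′ ≈ 0#)
    {κ l} (κ≈ε+l : just κ ≈⁺ just ε +⁺ l) (l+μφ′≈γ : l +⁺ μ ⟦ φ′ ⟧ ≈⁺ γ) where

    private
      open Stage stage
      open OrdinaryAugmentation A using (above; isAugmented)
      open ⁺-Reasoning

      ε<α′ : just ε <⁺ v (θ - α′)
      ε<α′ = ≤-<-trans (⁺.reflexive (⁺.Eq.sym ε≈)) closer

      jump-root : ∀ f → μ ⟦ f ⟧ <⁺ V f θ → ∃ λ b → evaluate f b ≈ 0# × just ε <⁺ v (θ - b)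
      jump-root f f< = let y , μ≈y , root = point (value f ⟪×⟫ jump⇒root f) in
        root θ-near (≤-<-trans (⁺.reflexive (⁺.Eq.sym μ≈y)) f<)

      φ′-jump : μ ⟦ φ′ ⟧ <⁺ V φ′ θ
      φ′-jump = <-≤-trans above (⁺.reflexive (⁺.Eq.sym φ′θ≈γ))

    -- If `m′ < d`, the annihilator `g′` could not jump, yet its root `α′` is closer than `ε`. If
    -- `d < m′`, the jump of `φ′` yields a root closer than `ε` of degree below `m′`, closer than
    -- the best approximation `α`.
    degree-≡ : d ≡ m′
    degree-≡ = ℕ.≤-antisym
      (ℕ.≮⇒≥ λ m′<d → <⇒≱ ε<α′ (far-root (monic≄[] g′-monic) g′[α′]≈0 (μ≈ (below-weaken m′<d (bounded g′-monic)))))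
      (ℕ.≮⇒≥ λ d<m′ → let b , φ′[b]≈0 , ε<b = jump-root φ′ φ′-jump in
        <⇒≱ ε<b (⁺.trans (best-root best (monic≄[] φ′-monic) (bounded φ′-monic) d<m′ φ′[b]≈0) (⁺.reflexive ε≈)))

    private
      constant : ∀ {a} → Below a d → Constant ε a
      constant {a} a₀ = generically-map (λ μ≈y → ⁺.Eq.trans (⁺.Eq.sym μ≈y) (μ≈ a₀)) (value a)

      -- Needed for every jumping monic `ψ` of degree `d` and not only for `φ′`, since `optimal′`
      -- applies it to the competitors of `g`.
      slope-≤ : ∀ {ψ} → IsMonic ψ d → μ ⟦ ψ ⟧ <⁺ V ψ θ → v (derivativeAt ψ θ) +⁺ just ε ≤⁺ μ ⟦ ψ ⟧
      slope-≤ {ψ} ψ-monic ψ< =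
        let y , bound , μ≈y = point (tame-slope tame {φ} φθ-finite generic-value slope ψ-monic constant
              (generically-map (λ μ≈y → ≤-<-trans (⁺.reflexive (⁺.Eq.sym μ≈y)) ψ<) (value ψ)) ⟪×⟫ value ψ)
        in ⁺.trans bound (⁺.reflexive (⁺.Eq.sym μ≈y))

      ε<κ : just ε <⁺ just κ
      ε<κ = begin-strict
        just ε              ≈⟨ +⁺-identityʳ (just ε) ⟨
        just ε +⁺ just Γ.0# <⟨ +⁺-monoʳ-< (ε , ⁺.Eq.refl) 0<l ⟩
        just ε +⁺ l         ≈⟨ κ≈ε+l ⟨
        just κ              ∎
        where
        0<l : just Γ.0# <⁺ l
        0<l = ≰⇒> λ l≤0 → <⇒≱ above (begin
          γ                        ≈⟨ l+μφ′≈γ ⟨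
          l +⁺ μ ⟦ φ′ ⟧            ≤⟨ +⁺-monoˡ (μ ⟦ φ′ ⟧) l≤0 ⟩
          just Γ.0# +⁺ μ ⟦ φ′ ⟧    ≈⟨ +⁺-identityˡ (μ ⟦ φ′ ⟧) ⟩
          μ ⟦ φ′ ⟧                 ∎)

      isolated′ : IsolatedRoot φ′ κ
      isolated′ = isolated-root {l = l} {m = μ ⟦ φ′ ⟧} (monic≄[] φ′-monic) (≈-finite φ′θ≈γ γ-finite) ε<κ κ≈ε+l (⁺.Eq.trans l+μφ′≈γ (⁺.Eq.sym φ′θ≈γ))
        (generically-map ⁺.Eq.sym (value φ′)) (slope-≤ φ′-monic φ′-jump)

      module β′ = IsolatedRoot isolated′

      ball-value : ∀ {a z} → Below a d → just κ ≤⁺ v (z - θ) → V a z ≈⁺ μ ⟦ a ⟧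
      ball-value {a} a₀ z-near = ⁺.Eq.trans (constant-on-ball {ε} {a} (constant a₀) (<-≤-trans ε<κ z-near)) (⁺.Eq.sym (μ≈ a₀))

      β′-near : Near κ β′.β
      β′-near = ⁺.trans (⁺.reflexive (⁺.Eq.sym β′.distance)) (⁺.reflexive (val-swap θ β′.β))

      value′ : ∀ {f} → (∃ λ as → All (λ a → Below a d) as × expansion φ′ as ≋ f) → Generically κ (λ y → ν ⟦ f ⟧ ≈⁺ V f y)
      value′ {f} (as , as₀ , e) = generically-map (λ {y} F≈ → begin-equality
          ν ⟦ f ⟧                             ≈⟨ Val.val-cong ν e ⟨
          ν ⟦ expansion φ′ as ⟧               ≈⟨ isAugmented as (All.map isBelow as₀) ⟩
          minTerms γ 0 (map (μ ⟦_⟧) as)       ≈⟨ F≈ ⟨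
          V (expansion φ′ as) y               ≈⟨ val-cong (evaluate-cong y e) ⟩
          V f y                               ∎)
        (generic-expansion {ρ = μ ⟦_⟧} β′.root β′-near
          (λ a₀ → generically-map (λ radius → ball-value a₀ (generic-near radius)) generically-radius)
          (λ a₀ → ball-value a₀ β′-near)
          (generically-map (λ e → ⁺.Eq.trans e φ′θ≈γ) β′.generic-value) as₀)

      -- The minimum over the larger ball is at most the value at a point of the smaller one.
      μ≤ν : ∀ f → μ ⟦ f ⟧ ≤⁺ ν ⟦ f ⟧
      μ≤ν f =
        let y , μ≈y , min = point (value f ⟪×⟫ minimum f)
            z , radius , ν≈z = point (generically-radius {κ} ⟪×⟫ value′ (expand φ′-monic 1≤d f))
        in begin
          μ ⟦ f ⟧     ≈⟨ μ≈y ⟩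
          V f y       ≤⟨ min (⁺.trans (<⇒≤ ε<κ) (generic-near radius)) ⟩
          V f z       ≈⟨ ν≈z ⟨
          ν ⟦ f ⟧     ∎

      -- In terms of values: no root of `ψ` is closer to `θ` than `α′`, so `ψ(θ)` is bounded by
      -- `ψ′(θ)` times `θ - α′`. The slope estimate bounds `ψ′(θ)` by the cofactor of `x - α′` in
      -- `g`, and cofactor times `θ - α′` is `g(θ)`.
      optimal′ : ∀ {g ψ} → IsMonic g d → evaluate g α′ ≈ 0# → IsMonic ψ d → ν ⟦ ψ ⟧ <⁺ V ψ θ → V ψ θ ≤⁺ V g θ
      optimal′ {g} {ψ} g-monic g[α′]≈0 ψ-monic ψ<θ = from-cofactor (cofactor (monic≄[] g-monic) g[α′]≈0)
        where
        ψ< : μ ⟦ ψ ⟧ <⁺ V ψ θ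
        ψ< = ≤-<-trans (μ≤ν ψ) ψ<θ
        g< : μ ⟦ g ⟧ <⁺ V g θ
        g< = let y , μ≈y , jump = point (value g ⟪×⟫ root⇒jump (monic≄[] g-monic)) in
          ≤-<-trans (⁺.reflexive μ≈y) (jump g[α′]≈0 θ-near ε<α′)
        w₀ : Below (ψ ⊝ g) d
        w₀ = monic-⊝ ψ-monic g-monic
        -- Both polynomials jump. If `g` had the smaller `μ`-value, then `ψ - g` would have that
        -- value for `μ` and a larger one at `θ`, although its degree is below `d`.
        ψ≤g : μ ⟦ ψ ⟧ ≤⁺ μ ⟦ g ⟧
        ψ≤g = ≮⇒≥ λ g<ψ → <-irrefl (⁺.Eq.trans (⁺.Eq.trans (⁺.Eq.sym (Val.val-neg μ g)) (⁺.Eq.sym (Val.val-+-dominant μ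
              (≤-<-trans (⁺.reflexive (Val.val-neg μ g)) g<ψ)))) (⁺.Eq.trans (Val.val-cong μ (ᴾ.+-comm (⊖ g) ψ)) (μ≈ w₀)))
            (<-≤-trans (<-val-sub (<-trans g<ψ ψ<) g<) (⁺.reflexive (val-cong
              (sym (trans (evaluate-⊕ ψ (⊖ g) θ) (+-congˡ (evaluate-⊖ g θ)))))))
        from-cofactor : (Σ (Carrier → Carrier) λ h → (∀ z → evaluate g z ≈ (z - α′) * h z) ×
          (∀ ε → Generically ε (λ y → ∀ {z} → Near ε z → v (h y) ≤⁺ v (h z)))) → V ψ θ ≤⁺ V g θ
        from-cofactor (h , g≈ , h-minimum) = begin
          V ψ θ                                     ≤⟨ close-root-≤ ψ θ (best-root best′ (monic≄[] ψ-monic) (bounded ψ-monic) (≡.subst (ℕ._< m″) (≡.sym degree-≡) m′<m″)) ⟩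
          v (derivativeAt ψ θ) +⁺ v (θ - α′)        ≤⟨ +⁺-monoˡ (v (θ - α′)) ψ′≤h ⟩
          v (h θ) +⁺ v (θ - α′)                     ≈⟨ +⁺-comm (v (h θ)) (v (θ - α′)) ⟩
          v (θ - α′) +⁺ v (h θ)                     ≈⟨ *-homo _ _ ⟨
          v ((θ - α′) * h θ)                        ≈⟨ val-cong (g≈ θ) ⟨
          V g θ                                     ∎
          where
          ψ′≤h : v (derivativeAt ψ θ) ≤⁺ v (h θ)
          ψ′≤h = let y , μ≈y , avoids , h-min = point (value g ⟪×⟫ generically-avoids α′ ⟪×⟫ h-minimum ε) in
            +⁺-cancelʳ (ε , ⁺.Eq.refl) (begin
              v (derivativeAt ψ θ) +⁺ just ε        ≤⟨ slope-≤ ψ-monic ψ< ⟩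
              μ ⟦ ψ ⟧                               ≤⟨ ψ≤g ⟩
              μ ⟦ g ⟧                               ≈⟨ μ≈y ⟩
              V g y                                 ≈⟨ val-cong (g≈ y) ⟩
              v ((y - α′) * h y)                    ≈⟨ *-homo _ _ ⟩
              v (y - α′) +⁺ v (h y)                 ≤⟨ +⁺-mono avoids (h-min θ-near) ⟩
              just ε +⁺ v (h θ)                     ≈⟨ +⁺-comm (just ε) (v (h θ)) ⟩
              v (h θ) +⁺ just ε                     ∎)

    nextStage : Stage ν φ′ d α′ κ
    nextStage = record { value = λ f → value′ (expand φ′-monic 1≤d f) ; isolated = isolated′ ; optimal = optimal′ }

-- Partial sums

module PartialSums (Γ : OrderedAbelianGroup u) where

  open OrderedAbelianGroup Γ hiding (_≤_)
  open IsAbelianGroup isAbelianGroup using (assoc; identityʳ; ∙-congˡ; ∙-congʳ)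

  partialSum : ∀ {r} → (Fin r → Carrier) → Fin r → Carrier
  partialSum t i = sum rawMonoid (λ j → t (inject! {i = suc i} j))

  partialSum-suc : ∀ {r} (t : Fin (suc r) → Carrier) i → partialSum t (suc i) ≈ partialSum t (inject₁ i) + t (suc i)
  partialSum-suc t zero    = Eq.trans (∙-congˡ (identityʳ (t (suc zero)))) (Eq.sym (∙-congʳ (identityʳ (t zero))))
  partialSum-suc {suc r} t (suc i) = Eq.trans (∙-congˡ (partialSum-suc (t ∘ suc) i)) (Eq.sym (assoc (t zero) _ _))

-- Assembly of the chain and the Okutsu sequence

module MacLaneVaquié {u} (em : ∀ {ℓ} → ExcludedMiddle ℓ) (𝕂 : ValuedField u) where

  open ValuedField 𝕂 using (K; K̄; embedding; Γ)
  open Theory 𝕂 using (module K̄; v; _⟦_⟧; OkutsuSequence; MLVChain; IsTame; slope; finite; augmentation-<; appendInfinity; OrdinaryAugmentation)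
  open Extended Γ using (Γ⁺; _≈⁺_; _<⁺_; _+⁺_; module ⁺)
  open ExtendedProperties Γ
  open PolynomialRing (ring K)
  open PartialSums Γ
  open PolynomialValuations em 𝕂 using (just-+-cancel)
  open Extension (CommutativeRing.rawRing (ring K)) (CommutativeRing.rawRing (ring K̄)) (FieldHom.⟦_⟧ embedding) renaming (evaluate to evaluateAt)
  private module Γ = OrderedAbelianGroup Γ

  finite-≈ : ∀ {x y : Γ⁺} (p : x <⁺ y) → x ≈⁺ just (finite p)
  finite-≈ {just a} p = ⁺.Eq.refl

  appendInfinity-inject₁ : ∀ {r} (γ : Fin r → Γ.Carrier) i → appendInfinity γ (inject₁ i) ≡ just (γ i)
  appendInfinity-inject₁ γ zero    = ≡.refl
  appendInfinity-inject₁ γ (suc i) = appendInfinity-inject₁ (γ ∘ suc) i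

  module _ (θ : K̄.Carrier) (tame : IsTame θ) {n F r} (O : OkutsuSequence θ n (suc r)) (C : MLVChain θ F (suc r)) where

    open OkutsuSequence O
    open MLVChain C
    open Approximation em 𝕂 θ using (V)
    open Augmentations em 𝕂
    open Stages em 𝕂 θ

    private
      monic-φ : ∀ k → IsMonic (φ k) (deg k)
      monic-φ k = toMonic (φ-monic k)

      1≤deg : ∀ k → 1 ℕ.≤ deg k
      1≤deg = <-weakInduction (λ k → 1 ℕ.≤ deg k) (ℕ.≤-reflexive (≡.sym deg-first)) λ i 1≤ → ℕ.≤-trans 1≤ (ℕ.<⇒≤ (deg-mono i))

      keeps : ∀ k → KeepsBelow (μ k) (deg k)
      keeps zero    = ≡.subst (KeepsBelow (μ zero)) (≡.sym deg-first) (constants-keep {μ zero})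
      keeps (suc i) = augmentation-keeps (1≤deg (suc i)) (monic-φ (suc i)) (step i)

      -- Descent from μᵣ = v_F: a step, be it ordinary or limit, changes no value below the degree
      -- of the preceding key polynomial.
      stable : ∀ k {f} → Below f (deg k) → μ k ⟦ f ⟧ ≈⁺ V f θ
      stable = >-weakInduction (λ k → ∀ {f} → Below f (deg k) → μ k ⟦ f ⟧ ≈⁺ V f θ) (λ {f} _ → μ-last f) λ i above f₀ →
        ⁺.Eq.trans (⁺.Eq.sym (keeps-step (step i) (keeps (inject₁ i)) (ℕ.<⇒≤ (deg-mono i)) f₀))
          (above (below-weaken (ℕ.<⇒≤ (deg-mono i)) f₀))

      g : ∀ i → ∃ λ g → IsMonic g (m (inject₁ i)) × evaluateAt g (α (inject₁ i)) K̄.≈ K̄.0#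
      -- A second degree of `α (inject₁ i)`, below `m (inject₁ i)`, would make it compete with
      -- itself in the strict inequality of the Okutsu sequence.
      g i = monic-annihilator (degrees (inject₁ i)) λ k degree k<m → <-irrefl ⁺.Eq.refl (strict i (α (inject₁ i)) k degree k<m)

    StageAt : Fin (suc r) → Set u
    StageAt i = deg (inject₁ i) ≡ m (inject₁ i) ×
      Stage (μ (inject₁ i)) (φ (inject₁ i)) (m (inject₁ i)) (α (inject₁ i)) (partialSum (slope C) i)

    private
      -- The order matters: only when the next step is known to be ordinary does μᵢ agree with v_F
      -- in all degrees below that of the next key polynomial, and the distance is computed from
      -- this agreement.
      module After {i} (at : StageAt i) where

        deg≡m : deg (inject₁ i) ≡ m (inject₁ i)
        deg≡m = proj₁ at

        stage : Stage (μ (inject₁ i)) (φ (inject₁ i)) (m (inject₁ i)) (α (inject₁ i)) (partialSum (slope C) i)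
        stage = proj₂ at

        m<deg : m (inject₁ i) < deg (suc i)
        m<deg = ≡.subst (_< deg (suc i)) deg≡m (deg-mono i)

        φ-monic′ : IsMonic (φ (inject₁ i)) (m (inject₁ i))
        φ-monic′ = ≡.subst (IsMonic _) deg≡m (monic-φ (inject₁ i))

        keeps′ : KeepsBelow (μ (inject₁ i)) (m (inject₁ i))
        keeps′ = ≡.subst (KeepsBelow (μ (inject₁ i))) deg≡m (keeps (inject₁ i))

        low : ∀ {f} → Below f (m (inject₁ i)) → μ (inject₁ i) ⟦ f ⟧ ≈⁺ V f θ
        low f₀ = stable (inject₁ i) (≡.subst (Below _) (≡.sym deg≡m) f₀)

        g-monic : IsMonic (proj₁ (g i)) (m (inject₁ i))
        g-monic = proj₁ (proj₂ (g i))

        ordinaryStep : OrdinaryAugmentation (μ (inject₁ i)) (φ (suc i)) (deg (suc i)) (γ⁺ (suc i)) (μ (suc i))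
        ordinaryStep = ordinary-step stage φ-monic′ keeps′ low g-monic (proj₂ (proj₂ (g i))) m<deg (step i) (stable (suc i))

        μ≈ : ∀ {f} → Below f (deg (suc i)) → μ (inject₁ i) ⟦ f ⟧ ≈⁺ V f θ
        μ≈ {f} f₀ = ⁺.Eq.trans (⁺.Eq.sym (augmented-low {μ (inject₁ i) ⟦_⟧} {φ (suc i)} {deg (suc i)} {γ⁺ (suc i)} {μ (suc i)}
          (OrdinaryAugmentation.isAugmented ordinaryStep) f₀)) (stable (suc i) f₀)

        distance : v (θ K̄.- α (inject₁ i)) ≈⁺ just (partialSum (slope C) i)
        distance = stage-distance stage φ-monic′ keeps′ low g-monic (proj₂ (proj₂ (g i))) m<deg μ≈ (m-mono i) (best i)

    stageAt : ∀ i → StageAt i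
    stageAt = <-weakInduction StageAt initial-stage′ next
      where
      initial-stage′ : StageAt zero
      initial-stage′ = ≡.trans deg-first (≡.sym m-first) ,
        ≡.subst (λ m → Stage (μ zero) (φ zero) m (α zero) (partialSum (slope C) zero)) (≡.sym m-first)
          (initial-stage (≡.subst (IsMonic (φ zero)) deg-first (monic-φ zero)) initial (v-φ zero)
            [ Γ.Eq.sym (IsAbelianGroup.identityʳ Γ.isAbelianGroup (γ zero)) ]≈
            (≡.subst (_< m (suc zero)) m-first (m-mono zero)) (best zero))
      next : ∀ i → StageAt (inject₁ i) → StageAt (suc i)
      next i at = NS.degree-≡ , ≡.subst (λ d → Stage (μ (suc (inject₁ i))) (φ (suc (inject₁ i))) d (α (suc (inject₁ i))) (partialSum (slope C) (suc i)))
          NS.degree-≡ NS.nextStage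
        where
        open After at
        γ≈ : γ⁺ (suc (inject₁ i)) ≈⁺ just (γ (suc i))
        γ≈ = ⁺.Eq.reflexive (appendInfinity-inject₁ γ (suc i))
        jump : μ (inject₁ (inject₁ i)) ⟦ φ (suc (inject₁ i)) ⟧ <⁺ γ⁺ (suc (inject₁ i))
        jump = augmentation-< (step (inject₁ i))
        cancel : just (slope C (suc i)) +⁺ just (finite jump) ≈⁺ just (γ (suc i))
        cancel = just-+-cancel (γ (suc i)) (finite jump)
        module NS = NextStage tame stage (γ (inject₁ i) , v-φ (inject₁ i)) (monic-φ (suc (inject₁ i))) (1≤deg (suc (inject₁ i)))
          ordinaryStep μ≈ (⁺.Eq.trans (v-φ (suc i)) (⁺.Eq.sym γ≈)) (γ (suc i) , γ≈)
          distance (best (inject₁ i)) (best (suc i)) (m-mono (suc i))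
          -- The preceding member of the Okutsu sequence has smaller degree, so the new one is
          -- strictly closer to `θ`.
          (strict (suc i) (α (inject₁ (inject₁ i))) (m (inject₁ (inject₁ i))) (degrees (inject₁ (inject₁ i))) (m-mono (inject₁ i)))
          (proj₁ (proj₂ (g (suc i)))) (proj₂ (proj₂ (g (suc i))))
          {l = just (slope C (suc i))} [ partialSum-suc (slope C) i ]≈
          (⁺.Eq.trans (+⁺-cong ⁺.Eq.refl (finite-≈ jump)) (⁺.Eq.trans cancel (⁺.Eq.sym γ≈)))

    okutsu-distance : ∀ i → v (θ K̄.- α (inject₁ i)) ≈⁺ just (partialSum (slope C) i)
    okutsu-distance i = After.distance (stageAt i)

corollary4p7 : (∀ {ℓ} → ExcludedMiddle ℓ) →
    ∀ {u : Level} (𝕂 : ValuedField u) → ValuedField.IsHenselian 𝕂 →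
    let open Theory 𝕂 hiding (_<_) in
    ∀ (θ : K̄.Carrier) (n : ℕ) → Degree θ n → 1 < n → IsTame θ →
    ∀ (F : Poly) → IsMinimalPolynomial F θ →
    ∀ (r : ℕ) (O : OkutsuSequence θ n r) →
    let open OkutsuSequence O using (α) in
    (∀ (i : Fin r) → IsSeparable (α (inject₁ i))) →
    ∀ (C : MLVChain θ F r) (i : Fin r) →
    v (θ K̄.- α (inject₁ i)) ≈⁺ just (sum Γ.rawMonoid (λ j → slope C (inject! {i = suc i} j)))
corollary4p7 em 𝕂 _ θ n _ _ tame F _ (suc r) O _ C i = MacLaneVaquié.okutsu-distance em 𝕂 θ tame O C i
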